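{- For every integer $N\geq 1$, $B_0(N,2)=\varepsilon_0(N-1,2)=(N-1)\cdot 4^{N-2}$.
   Context: Let $N\ge 1$, $K\ge 1$. A gluing datum with $N$ edges and $K$ faces consists of a composition $(m_1,\dots,m_K)$ of $2N$ into positive integers and a fixed-point-free involution $\iota$ of $\{1,\dots,2N\}$. With $s_0=0$, $s_i=m_1+\dots+m_i$, let $\tau$ have cycles $(s_{i-1}+1,\dots,s_i)$. The datum is connected if $\langle\iota,\tau\rangle$ is transitive, and has genus $g$ if $\tau\iota$ has $N-K+2-2g$ cycles. $\varepsilon_g(N,K)$ is the number of connected genus-$g$ data; $\varepsilon_g(0,K)=0$ for $g+K>1$. The datum is bicolored if every $m_i$ is even and $\iota$ maps each element $s_{i-1}+r$ with $r$ odd to an element $s_{j-1}+r'$ with $r'$ even. $B_g(N,K)$ is the number of connected bicolored genus-$g$ data with $N$ edges and $K$ faces. (Geometrically these count gluings of polygons into a closed orientable surface of genus $g$, resp. gluings of properly black/white vertex-colored polygons respecting colors, with distinguished edges starting at white vertices.) For $N=1$ the right-hand side $(N-1)4^{N-2}$ equals $0$. -}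

module Defs where

open import Data.Nat using (ℕ; zero; suc; _+_; _*_; _∸_; _<_; _≤_; _<ᵇ_; _<?_)
open import Data.Nat.Divisibility using (_∣_)
open import Data.Bool using (if_then_else_)
open import Data.Fin using (Fin; toℕ; fromℕ<)
open import Data.Vec using (Vec; lookup; toList; sum)
open import Data.Vec.Relation.Unary.All using (All)
open import Data.List using (List; []; _∷_; length)
open import Data.List.Membership.Propositional using (_∈_)
open import Data.List.Relation.Unary.Unique.Propositional using (Unique)
open import Data.Product using (Σ; _×_; _,_; proj₁; proj₂)
open import Relation.Binary.PropositionalEquality using (_≡_; _≢_)
open import Relation.Nullary using (¬_; yes; no)
open import Function.Bundles using (_⇔_)

HasCard : ∀ {A : Set} → (A → Set) → ℕ → Set
HasCard {A} P n =
  Σ (List A) λ L → Unique L × ((a : A) → (a ∈ L) ⇔ P a) × length L ≡ n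

-- Gluing data.  Elements of {1,…,2N} are represented 0-based by Fin (2N).
-- A composition (m_1,…,m_K) is a Vec ℕ K; the involution ι is the
-- table Vec (Fin (2N)) (2N), x ↦ lookup ι x.

Datum : ℕ → ℕ → Set
Datum N K = Vec ℕ K × Vec (Fin (2 * N)) (2 * N)

IsComposition : ∀ {K} → ℕ → Vec ℕ K → Set
IsComposition M ms = All (λ m → 1 ≤ m) ms × sum ms ≡ M

IsFPFInvolution : ∀ {M} → (Fin M → Fin M) → Set
IsFPFInvolution {M} ι = (x : Fin M) → ι (ι x) ≡ x × ι x ≢ x

locate : List ℕ → ℕ → ℕ → ℕ × ℕ
locate []       base p = base , base
locate (m ∷ ms) base p =
  if p <ᵇ base + m then (base , base + m) else locate ms (base + m) p

blockStart : ∀ {K} → Vec ℕ K → ℕ → ℕ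
blockStart ms p = proj₁ (locate (toList ms) 0 p)

τℕ : ∀ {K} → Vec ℕ K → ℕ → ℕ
τℕ ms p with locate (toList ms) 0 p
... | s , e = if suc p <ᵇ e then suc p else s

τ : ∀ {K M} → Vec ℕ K → Fin M → Fin M
τ {M = M} ms x with τℕ ms (toℕ x) <? M
... | yes lt = fromℕ< lt
... | no  _  = x

-- 0-based offset of a position inside its block (offset r-1 for the
-- paper's 1-based r).
offset : ∀ {K} → Vec ℕ K → ℕ → ℕ
offset ms p = p ∸ blockStart ms p

-- Orbit relation of the group ⟨ι,τ⟩ (generated as a monoid; the same
-- thing for permutations of a finite set).
data Reach {M : ℕ} (ι τ' : Fin M → Fin M) (x : Fin M) : Fin M → Set where
  here  : Reach ι τ' x x
  stepι : ∀ {y} → Reach ι τ' x y → Reach ι τ' x (ι y)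
  stepτ : ∀ {y} → Reach ι τ' x y → Reach ι τ' x (τ' y)

Transitive : ∀ {M} → (Fin M → Fin M) → (Fin M → Fin M) → Set
Transitive {M} ι τ' = (x y : Fin M) → Reach ι τ' x y

iter : ∀ {A : Set} → (A → A) → ℕ → A → A
iter f zero    a = a
iter f (suc k) a = f (iter f k a)

-- x is the least element of its σ-cycle; cycles ↔ their minima.
CycleMin : ∀ {M} → (Fin M → Fin M) → Fin M → Set
CycleMin σ x = (k : ℕ) → toℕ x ≤ toℕ (iter σ k x)

HasCycles : ∀ {M} → (Fin M → Fin M) → ℕ → Set
HasCycles σ c = HasCard (CycleMin σ) c

-- a connected gluing datum of genus g: τι has N - K + 2 - 2g cycles,
-- written without truncated subtraction as  c + 2g + K = N + 2.
ConnectedGenus : (g N K : ℕ) → Datum N K → Set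
ConnectedGenus g N K (ms , ιv) =
  IsComposition (2 * N) ms
  × IsFPFInvolution (lookup ιv)
  × Transitive (lookup ιv) (τ ms)
  × Σ ℕ λ c → HasCycles (λ x → τ ms (lookup ιv x)) c
              × c + 2 * g + K ≡ N + 2

-- bicolored: every m_i even; ι maps paper-odd offsets r (0-based even)
-- to paper-even offsets r' (0-based odd).
Even : ℕ → Set
Even n = 2 ∣ n

Bicolored : (N K : ℕ) → Datum N K → Set
Bicolored N K (ms , ιv) =
  All Even ms
  × ((x : Fin (2 * N)) → Even (offset ms (toℕ x))
        → ¬ Even (offset ms (toℕ (lookup ιv x))))

εIs : (g N K : ℕ) → ℕ → Set
εIs g N K n = HasCard (ConnectedGenus g N K) n

BIs : (g N K : ℕ) → ℕ → Set
BIs g N K n = HasCard (λ d → ConnectedGenus g N K d × Bicolored N K d) n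

{-# OPTIONS --safe #-}
-- Delete edges one at a time and follow the number of cycles of τ ∘ ι. An edge whose sides are
-- consecutive in a face carries a vertex of degree one; an edge between two faces merges them.
-- So a single face with 2n sides has the maximal number n + 1 of vertices exactly for noncrossing
-- matchings, and a gluing of two faces is connected and planar exactly if some edge joins the
-- faces and the other edges match the sides of the merged face without crossings. The partner
-- of the first side of a face then gives Tutte's recursion
--   A(m,n) = κ(n) C(m+n-2) + 2 Σ_{i+j=m-2} C(i) A(j,n)
-- for the gluings of an m-gon and an n-gon, with aerated Catalan numbers C and κ(n) = n, or
-- κ(n) = n/2 for bicolored gluings. Summed over m + n it is a linear recursion in one variable.

module Submission where

open import Defs
open import Data.Bool using (Bool; true; false; not; if_then_else_)
open import Data.Bool.Properties as Bool using (not-involutive; not-¬)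
open import Data.Fin as Fin using (Fin; zero; suc; toℕ; fromℕ<)
open import Data.Fin.Permutation.Components using (transpose)
open import Data.Fin.Properties as Fin using (_≟_; toℕ-injective; toℕ<n; toℕ-fromℕ<; injective⇒≤; pigeonhole; any?; ¬∀⟶∃¬-smallest)
open import Data.List as List using (List; []; _∷_; _++_; length; map; allFin; filter; [_]; cartesianProduct; take; drop)
open import Data.List.Membership.Propositional using (_∈_; _∉_)
open import Data.List.Membership.Propositional.Properties
  using (∈-map⁺; ∈-map⁻; ∈-allFin; ∈-++⁺ˡ; ∈-++⁺ʳ; ∈-++⁻; ∈-∃++; ∈-filter⁻; ∈-lookup; ∈-insert; ∈-cartesianProduct⁺; ∈-cartesianProduct⁻)
open import Data.List.Membership.Propositional.Properties.WithK using (unique∧set⇒bag)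
open import Data.List.Properties
  using (length-map; length-tabulate; length-++; length-++-comm; length-take; length-drop; take++drop≡id; filter-accept; filter-reject
        ; ++-assoc; ++-identityʳ; ++-conicalˡ; ++-conicalʳ; ++-monoid; ∷-injectiveˡ; ∷-injectiveʳ)
open import Data.List.Relation.Binary.BagAndSetEquality using (∼bag⇒↭)
open import Data.List.Relation.Binary.Permutation.Propositional using (_↭_; ↭⇒↭ₛ; ↭-trans; ↭-sym; ↭-reflexive; prep)
open import Data.List.Relation.Binary.Permutation.Propositional.Properties using (↭-length; ++-comm; ++⁺; ++⁺ˡ; shift; shifts; ∈-resp-↭)
import Data.List.Relation.Binary.Permutation.Setoid.Properties as Permₛ
open import Data.List.Relation.Unary.All as All using (All; []; _∷_)
import Data.List.Relation.Unary.All.Properties as All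
open import Data.List.Relation.Unary.AllPairs as AllPairs using ([]; _∷_)
open import Data.List.Relation.Unary.Any using (here; there)
open import Data.List.Relation.Unary.Unique.Propositional using (Unique)
import Data.List.Relation.Unary.Unique.Propositional.Properties as Unique
open import Data.Nat as ℕ using (ℕ; zero; suc; pred; _+_; _*_; _∸_; _^_; _≤_; _<_; _<?_; _<ᵇ_; z≤n; s≤s)
open import Data.Nat.Divisibility using (divides)
open import Data.Nat.Induction using (<-rec)
import Data.Nat.Properties as ℕ
open import Data.Nat.Solver using (module +-*-Solver)
open import Data.Product using (∃; ∃₂; _×_; _,_; proj₁; proj₂)
open import Data.Sum using (_⊎_; inj₁; inj₂)
open import Data.Unit using (⊤; tt)
open import Data.Vec using (Vec; []; _∷_; lookup; tabulate; toList)
open import Data.Vec.Properties using (tabulate∘lookup; lookup∘tabulate; tabulate-cong)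
import Data.Vec.Relation.Unary.All as VecAll
open import Function using (_∘_; id; _⇔_; mk⇔; Equivalence; case_of_)
open import Relation.Binary.PropositionalEquality hiding ([_])
open import Relation.Nullary using (¬_; Dec; yes; no; does; contradiction)
open import Relation.Nullary.Decidable using (map′; dec-true; dec-false; ¬?; _×-dec_)
open import Relation.Unary using (Decidable)
import Tactic.MonoidSolver as MonoidSolver

open Equivalence using (to; from)

-- The set of points is `Fin M` throughout: a deleted side stays as a fixed point and counts as a
-- cycle. A planar gluing of one face along n edges, with M - 2n sides deleted, therefore has (n +
-- 1) + (M - 2n) cycles, whence the condition `c + n ≡ suc M`. An edge joining the two faces is not
-- unique, so gluings cannot be counted by such edges; the partner of the first side is unique and
-- takes their place. The second face never changes in this recursion, and its size is a mere
-- parameter. Colours enter through κ alone: in an alternating word every arc of a noncrossing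
-- matching joins opposite colours by itself. The equality of the two numbers does not come from a
-- bijection. Summed over the sizes, both recursions read T(n+2) = K(n+1) C(n) + 2 Σ C(i) T(j),
-- where K(n+1) is the sum of κ(1), ..., κ(n+1). The ratio (n+4) C(n+2) = 4 (n+1) C(n) makes the
-- inhomogeneous term for κ(n) = n/2 agree with the one for κ(n) = n at two sides fewer. The
-- solution is guessed, and verified by closed forms of its convolution with C.

private variable
  A B : Set
  P Q : A → Set
  M m n n′ : ℕ

-- Cycle counts of permutations

HasCard-unique : HasCard P n → HasCard P n′ → n ≡ n′
HasCard-unique (xs , ux , ex , refl) (ys , uy , ey , refl) =
  ↭-length (∼bag⇒↭ (unique∧set⇒bag ux uy
    (mk⇔ (λ i → from (ey _) (to (ex _) i)) (λ i → from (ex _) (to (ey _) i)))))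

iter-comm : (f : A → A) (k : ℕ) (x : A) → iter f k (f x) ≡ f (iter f k x)
iter-comm f zero x = refl
iter-comm f (suc k) x = cong f (iter-comm f k x)

iter-+ : (f : A → A) (j k : ℕ) (x : A) → iter f (j + k) x ≡ iter f j (iter f k x)
iter-+ f zero k x = refl
iter-+ f (suc j) k x = cong f (iter-+ f j k x)

Orbit : (A → A) → A → A → Set
Orbit f x y = ∃ λ k → iter f k x ≡ y

Injective : (A → A) → Set
Injective f = ∀ {x y} → f x ≡ f y → x ≡ y

iter-injective : {f : A → A} → Injective f → ∀ k → Injective (iter f k)
iter-injective inj zero e = e
iter-injective inj (suc k) e = iter-injective inj k (inj e)

orbit-trans : {f : A → A} {x y z : A} → Orbit f x y → Orbit f y z → Orbit f x z
orbit-trans {f = f} (j , refl) (k , refl) = k + j , iter-+ f k j _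

module _ {f : Fin M → Fin M} (inj : Injective f) where

  -- Two of the first M + 1 iterates coincide, and injectivity cancels the common part. The bound on
  -- `d` turns membership in an orbit into a search over `Fin M`.
  period : ∀ x → ∃ λ d → d < M × iter f (suc d) x ≡ x
  period x with pigeonhole (ℕ.n<1+n M) (λ i → iter f (toℕ i) x)
  ... | i , j , i<j , e = d , d<M , iter-injective inj (toℕ i)
      (trans (sym (iter-+ f (toℕ i) (suc d) x)) (trans (cong (λ k → iter f k x) d-eq) (sym e)))
    where
    d = toℕ j ∸ suc (toℕ i)
    d-eq : toℕ i + suc d ≡ toℕ j
    d-eq = trans (ℕ.+-suc (toℕ i) d) (ℕ.m+[n∸m]≡n i<j)
    d<M : d < M
    d<M = ℕ.≤-trans (ℕ.≤-trans (ℕ.m≤n+m (suc d) (toℕ i)) (ℕ.≤-reflexive d-eq)) (ℕ.≤-pred (toℕ<n j))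

  orbit-back : ∀ x → Orbit f (f x) x
  orbit-back x with period x
  ... | d , _ , e = d , trans (iter-comm f d x) e

  orbit-sym : ∀ {x y} → Orbit f x y → Orbit f y x
  orbit-sym (zero , refl) = 0 , refl
  orbit-sym {x} (suc k , refl) = orbit-trans (orbit-back (iter f k x)) (orbit-sym (k , refl))

  orbit-bounded : ∀ x k → ∃ λ (i : Fin M) → iter f (toℕ i) x ≡ iter f k x
  orbit-bounded x k with period x
  ... | d , d<M , e = let j , j≤d , e′ = go k in
      fromℕ< (ℕ.≤-<-trans j≤d d<M)
    , trans (cong (λ i → iter f i x) (toℕ-fromℕ< (ℕ.≤-<-trans j≤d d<M))) e′
    where
    go : ∀ k → ∃ λ j → j ≤ d × iter f j x ≡ iter f k x
    go zero = 0 , z≤n , refl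
    go (suc k) with go k
    ... | j , j≤d , e′ with j ℕ.≟ d
    ... | yes refl = 0 , z≤n , trans (sym e) (cong f e′)
    ... | no j≢d = suc j , ℕ.≤∧≢⇒< j≤d j≢d , cong f e′

  orbit? : ∀ x y → Dec (Orbit f x y)
  orbit? x y = map′ (λ (i , e) → toℕ i , e)
    (λ (k , e) → let i , e′ = orbit-bounded x k in i , trans e′ e)
    (any? (λ i → iter f (toℕ i) x ≟ y))

-- A labelling of the classes can be carried along when the permutation changes, whereas cycle
-- minima depend on the order of the points. Cycles are counted by labellings, and `hasCycles`
-- returns to minima at the end.
record Quotient {M} (R : Fin M → Fin M → Set) (n : ℕ) : Set where
  field
    label : Fin M → Fin n
    pick : Fin n → Fin M
    label-pick : ∀ i → label (pick i) ≡ i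
    sound : ∀ {x y} → R x y → label x ≡ label y
    exact : ∀ {x y} → label x ≡ label y → R x y

quotient : ∀ {M} (R : Fin M → Fin M → Set) → (∀ x y → Dec (R x y)) →
           (∀ {x} → R x x) → (∀ {x y} → R x y → R y x) →
           (∀ {x y z} → R x y → R y z → R x z) → ∃ (Quotient R)
quotient {zero} R R? R-refl R-sym R-trans =
  0 , record { label = λ () ; pick = λ () ; label-pick = λ () ; sound = λ { {()} } ; exact = λ { {()} } }
quotient {suc M} R R? R-refl R-sym R-trans
  with quotient (λ x y → R (suc x) (suc y)) (λ x y → R? (suc x) (suc y)) R-refl R-sym R-trans
     | any? (λ y → R? zero (suc y))
... | n , q | yes (y , r) = n , record
  { label = lab ; pick = suc ∘ pick ; label-pick = label-pick
  ; sound = λ {x} {y} → snd x y ; exact = λ {x} {y} → ex x y }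
  where
  open Quotient q
  lab : Fin (suc M) → Fin n
  lab zero = label y
  lab (suc x) = label x
  snd : ∀ x z → R x z → lab x ≡ lab z
  snd zero zero _ = refl
  snd zero (suc z) s = sound (R-trans (R-sym r) s)
  snd (suc x) zero s = sound (R-trans s r)
  snd (suc x) (suc z) s = sound s
  ex : ∀ x z → lab x ≡ lab z → R x z
  ex zero zero _ = R-refl
  ex zero (suc z) e = R-trans r (exact e)
  ex (suc x) zero e = R-trans (exact e) (R-sym r)
  ex (suc x) (suc z) e = exact e
... | n , q | no ¬r = suc n , record
  { label = lab ; pick = pk ; label-pick = lp
  ; sound = λ {x} {y} → snd x y ; exact = λ {x} {y} → ex x y }
  where
  open Quotient q
  lab : Fin (suc M) → Fin (suc n)
  lab zero = zero
  lab (suc x) = suc (label x)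
  pk : Fin (suc n) → Fin (suc M)
  pk zero = zero
  pk (suc i) = suc (pick i)
  lp : ∀ i → lab (pk i) ≡ i
  lp zero = refl
  lp (suc i) = cong suc (label-pick i)
  snd : ∀ x z → R x z → lab x ≡ lab z
  snd zero zero _ = refl
  snd zero (suc z) s = contradiction (z , s) ¬r
  snd (suc x) zero s = contradiction (x , R-sym s) ¬r
  snd (suc x) (suc z) s = cong suc (sound s)
  ex : ∀ x z → lab x ≡ lab z → R x z
  ex zero zero _ = R-refl
  ex zero (suc z) ()
  ex (suc x) zero ()
  ex (suc x) (suc z) e = exact (Fin.suc-injective e)

Cycles : (Fin M → Fin M) → ℕ → Set
Cycles f = Quotient (Orbit f)

cycles-exist : {f : Fin M → Fin M} → Injective f → ∃ (Cycles f)
cycles-exist {f = f} inj = quotient (Orbit f) (orbit? inj) (0 , refl) (orbit-sym inj) orbit-trans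

cycles-≤ : {f g : Fin M → Fin M} → f ≗ g → Cycles f n → Cycles g n′ → n ≤ n′
cycles-≤ {f = f} {g} f≗g q r = injective⇒≤ {f = R.label ∘ Q.pick} λ {i} {j} e →
    trans (sym (Q.label-pick i)) (trans (Q.sound (orbit-≗ (R.exact e))) (Q.label-pick j))
  where
  module Q = Quotient q
  module R = Quotient r
  iter-≗ : ∀ k x → iter f k x ≡ iter g k x
  iter-≗ zero x = refl
  iter-≗ (suc k) x = trans (f≗g _) (cong g (iter-≗ k x))
  orbit-≗ : ∀ {x y} → Orbit g x y → Orbit f x y
  orbit-≗ (k , e) = k , trans (iter-≗ k _) e

cycles-cong : {f g : Fin M → Fin M} → f ≗ g → Cycles f n → Cycles g n′ → n ≡ n′
cycles-cong e q r = ℕ.≤-antisym (cycles-≤ e q r) (cycles-≤ (sym ∘ e) r q)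

orbit-invariant : {f : A → A} (l : A → Fin n) → (∀ x → l (f x) ≡ l x) →
                  ∀ {x y} → Orbit f x y → l x ≡ l y
orbit-invariant l inv (zero , refl) = refl
orbit-invariant {f = f} l inv {x} (suc k , refl) =
  trans (orbit-invariant l inv (k , refl)) (sym (inv (iter f k x)))

cycles-id : Cycles {M} id M
cycles-id = record { label = id ; pick = id ; label-pick = λ _ → refl
  ; sound = orbit-invariant id (λ _ → refl) ; exact = λ { refl → 0 , refl } }

-- `f ∘ s` is the conjugate of `s ∘ f` by the involution `s`, so `s` carries the cycles of one to
-- those of the other.
cycles-conj : (f s : Fin M → Fin M) → (∀ x → s (s x) ≡ x) → Cycles (s ∘ f) n → Cycles (f ∘ s) n
cycles-conj f s inv q = record
  { label = label ∘ s ; pick = s ∘ pick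
  ; label-pick = λ i → trans (cong label (inv _)) (label-pick i)
  ; sound = orbit-invariant (label ∘ s) λ x → sound (invariant x)
  ; exact = λ {x} {y} e → let k , e′ = exact e in
      k , trans (sym (inv _)) (trans (cong s (trans (shift-iter k x) e′)) (inv y)) }
  where
  open Quotient q
  shift-iter : ∀ k x → s (iter (f ∘ s) k x) ≡ iter (s ∘ f) k (s x)
  shift-iter zero x = refl
  shift-iter (suc k) x = cong (s ∘ f) (shift-iter k x)
  invariant : ∀ x → Orbit (s ∘ f) (s (f (s x))) (s x)
  invariant x = exact (sym (sound (1 , refl)))

-- Opaque, since unification loops when it unfolds the with-functions of transpose.
opaque
  swap : Fin M → Fin M → Fin M → Fin M
  swap = transpose

  swapˡ : (a b : Fin M) → swap a b a ≡ b
  swapˡ a b rewrite dec-true (a ≟ a) refl = refl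

  swapʳ : (a b : Fin M) → swap a b b ≡ a
  swapʳ a b with b ≟ a
  ... | yes e = e
  ... | no _ rewrite dec-true (b ≟ b) refl = refl

  swap-other : {a b c : Fin M} → c ≢ a → c ≢ b → swap a b c ≡ c
  swap-other {a = a} {b} {c} p q rewrite dec-false (c ≟ a) p | dec-false (c ≟ b) q = refl

swap-involutive : (a b x : Fin M) → swap a b (swap a b x) ≡ x
swap-involutive a b x with x ≟ a
... | yes refl = trans (cong (swap x b) (swapˡ x b)) (swapʳ x b)
... | no p with x ≟ b
... | yes refl = trans (cong (swap a x) (swapʳ a x)) (swapˡ a x)
... | no q = trans (cong (swap a b) (swap-other p q)) (swap-other p q)

-- Multiplying by (b w) merges the fixed point b into the cycle of w.
cycles-insert : {f : Fin M → Fin M} {b w : Fin M} → Injective f → f b ≡ b → w ≢ b →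
                Cycles (swap b w ∘ f) n → Cycles f (suc n)
cycles-insert {M} {n} {f} {b} {w} inj fb w≢b q = record
  { label = lab ; pick = pk ; label-pick = lp
  ; sound = orbit-invariant lab inv ; exact = λ {x} {y} → ex x y }
  where
  open Quotient q
  g : Fin M → Fin M
  g = swap b w ∘ f
  step : ∀ y → label (g y) ≡ label y
  step y = sym (sound (1 , refl))
  gb : g b ≡ w
  gb = trans (cong (swap b w) fb) (swapˡ b w)
  label-w : label w ≡ label b
  label-w = trans (cong label (sym gb)) (step b)
  f≢b : ∀ {y} → y ≢ b → f y ≢ b
  f≢b p e = p (inj (trans e (sym fb)))
  lab : Fin M → Fin (suc n)
  lab y with y ≟ b
  ... | yes _ = zero
  ... | no _ = suc (label y)
  lab-other : ∀ {y} → y ≢ b → lab y ≡ suc (label y)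
  lab-other {y} p with y ≟ b
  ... | yes e = contradiction e p
  ... | no _ = refl
  lab-b : lab b ≡ zero
  lab-b with b ≟ b
  ... | yes _ = refl
  ... | no p = contradiction refl p
  pk : Fin (suc n) → Fin M
  pk zero = b
  -- The representative of the merged cycle may be `b` itself, which now forms a class of its own;
  -- `w` replaces it.
  pk (suc i) with pick i ≟ b
  ... | yes _ = w
  ... | no _ = pick i
  lp : ∀ i → lab (pk i) ≡ i
  lp zero = lab-b
  lp (suc i) with pick i ≟ b
  ... | yes e = trans (lab-other w≢b) (cong suc (trans label-w (trans (cong label (sym e)) (label-pick i))))
  ... | no p = trans (lab-other p) (cong suc (label-pick i))
  label-f : ∀ {y} → y ≢ b → label (f y) ≡ label y
  label-f {y} p with f y ≟ w
  ... | yes e = trans (cong label e) (trans label-w (trans (cong label (sym (trans (cong (swap b w) e) (swapʳ b w)))) (step y)))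
  ... | no q = trans (cong label (sym (swap-other (f≢b p) q))) (step y)
  inv : ∀ y → lab (f y) ≡ lab y
  inv y with y ≟ b
  ... | yes refl = trans (cong lab fb) lab-b
  ... | no p = trans (lab-other (f≢b p)) (cong suc (label-f p))
  -- A `g`-walk is an `f`-walk with an extra stop at `b` before each visit to `w`; during this stop
  -- the `f`-walk is already at `w`.
  Skip : Fin M → Fin M → Set
  Skip y z = (z ≢ b × Orbit f y z) ⊎ (z ≡ b × Orbit f y w)
  skip : ∀ {y} → y ≢ b → ∀ k → Skip y (iter g k y)
  skip p zero = inj₁ (p , 0 , refl)
  skip p (suc k) with skip p k
  ... | inj₂ (e , o) rewrite e = inj₁ ((λ e′ → w≢b (trans (sym gb) e′)) , subst (Orbit f _) (sym gb) o)
  ... | inj₁ (z≢b , o) with f (iter g k _) ≟ w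
  ... | yes e = inj₂ (trans (cong (swap b w) e) (swapʳ b w) , orbit-trans o (1 , e))
  ... | no q = inj₁ ((λ e → f≢b z≢b (trans (sym same) e)) , orbit-trans o (1 , sym same))
    where same = swap-other (f≢b z≢b) q
  ex : ∀ y z → lab y ≡ lab z → Orbit f y z
  ex y z e with y ≟ b | z ≟ b
  ... | yes refl | yes refl = 0 , refl
  ... | yes refl | no q with () ← e
  ... | no p | yes refl with () ← e
  ... | no p | no q with exact (Fin.suc-injective e)
  ... | k , refl with skip p k
  ... | inj₁ (_ , o) = o
  ... | inj₂ (e′ , _) = contradiction e′ q

cycles-insert-≡ : {f g : Fin M → Fin M} {b w : Fin M} → Injective f → f b ≡ b → w ≢ b →
                  g ≗ swap b w ∘ f → Cycles g n → Cycles f n′ → n′ ≡ suc n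
cycles-insert-≡ {b = b} {w} inj fb w≢b e q r =
  let _ , q′ = cycles-exist (λ {x} {y} h → inj (trans (sym (swap-involutive b w _)) (trans (cong (swap b w) h) (swap-involutive b w _))))
  in trans (cycles-cong (λ _ → refl) r (cycles-insert inj fb w≢b q′))
           (cong suc (cycles-cong (sym ∘ e) q′ q))

module _ {f : Fin M → Fin M} (q : Cycles f n) where
  open Quotient q

  least : ∀ i → ∃ λ x → label x ≡ i × (∀ y → label y ≡ i → toℕ x ≤ toℕ y)
  least i with ¬∀⟶∃¬-smallest M (λ x → label x ≢ i) (λ x → ¬? (label x ≟ i)) (λ h → h (pick i) (label-pick i))
  ... | x , ¬¬e , below with label x ≟ i
  ... | no p = contradiction p ¬¬e
  ... | yes e = x , e , λ y ey → ℕ.≮⇒≥ λ y<x →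
    below (fromℕ< y<x) (trans (cong label (toℕ-injective (trans (Fin.toℕ-inject {i = x} (fromℕ< y<x)) (toℕ-fromℕ< y<x)))) ey)

  cycleMin : Fin n → Fin M
  cycleMin i = proj₁ (least i)

  label-cycleMin : ∀ i → label (cycleMin i) ≡ i
  label-cycleMin i = proj₁ (proj₂ (least i))

  hasCycles : HasCycles f n
  hasCycles = map cycleMin (allFin n)
    , Unique.map⁺ (λ e → trans (sym (label-cycleMin _)) (trans (cong label e) (label-cycleMin _))) (Unique.allFin⁺ n)
    , (λ x → mk⇔ (toMin x) (fromMin x))
    , trans (length-map cycleMin (allFin n)) (length-tabulate id)
    where
    toMin : ∀ x → x ∈ map cycleMin (allFin n) → CycleMin f x
    toMin x x∈ k with ∈-map⁻ cycleMin x∈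
    ... | i , _ , refl = proj₂ (proj₂ (least i)) _ (trans (sym (sound (k , refl))) (label-cycleMin i))
    fromMin : ∀ x → CycleMin f x → x ∈ map cycleMin (allFin n)
    fromMin x min with exact {x} {cycleMin (label x)} (sym (label-cycleMin (label x)))
    ... | k , e = subst (_∈ _) (toℕ-injective (ℕ.≤-antisym (proj₂ (proj₂ (least (label x))) x refl)
                     (ℕ.≤-trans (min k) (ℕ.≤-reflexive (cong toℕ e))))) (∈-map⁺ cycleMin (∈-allFin (label x)))

hasCycles⇒≡ : {f g : Fin M → Fin M} → f ≗ g → HasCycles f n → Cycles g n′ → n ≡ n′
hasCycles⇒≡ {f = f} {g} e h q = HasCard-unique h
  (let xs , u , m , l = hasCycles q in xs , u , (λ x → mk⇔ (λ i k → subst (λ y → toℕ x ≤ toℕ y) (sym (iter-≗ k x)) (to (m x) i k))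
     (λ i → from (m x) λ k → subst (λ y → toℕ x ≤ toℕ y) (iter-≗ k x) (i k))) , l)
  where
  iter-≗ : ∀ k x → iter f k x ≡ iter g k x
  iter-≗ zero x = refl
  iter-≗ (suc k) x = trans (e _) (cong g (iter-≗ k x))

-- Cyclic words and noncrossing matchings

unique-++⁻ : (xs : List A) {ys : List A} → Unique (xs ++ ys) →
             Unique xs × Unique ys × (∀ {x} → x ∈ xs → x ∉ ys)
unique-++⁻ [] u = [] , u , λ ()
unique-++⁻ (x ∷ xs) (p ∷ u) with unique-++⁻ xs u
... | ux , uy , d = All.++⁻ˡ xs p ∷ ux , uy , λ where
  (here refl) i → All.lookup (All.++⁻ʳ xs p) i refl
  (there j) i → d j i

unique-resp-↭ : {xs ys : List A} → xs ↭ ys → Unique xs → Unique ys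
unique-resp-↭ p = Permₛ.Unique-resp-↭ (setoid _) (↭⇒↭ₛ p)

unique-rotate : (xs ys : List A) → Unique (xs ++ ys) → Unique (ys ++ xs)
unique-rotate xs ys = unique-resp-↭ (++-comm xs ys)

∈-rotate : {x : A} (xs ys : List A) → x ∈ xs ++ ys → x ∈ ys ++ xs
∈-rotate xs ys i with ∈-++⁻ xs i
... | inj₁ j = ∈-++⁺ʳ ys j
... | inj₂ j = ∈-++⁺ˡ j

unique-head : {x y : A} {xs : List A} → Unique (x ∷ xs) → y ∈ xs → y ≢ x
unique-head (p ∷ _) i e = All.lookup p i (sym e)

∉-head : {x : A} {xs : List A} → Unique (x ∷ xs) → x ∉ xs
∉-head u i = unique-head u i refl

unique-lookup : {xs : List A} → Unique xs → ∀ i j → List.lookup xs i ≡ List.lookup xs j → i ≡ j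
unique-lookup (p ∷ u) zero zero e = refl
unique-lookup (p ∷ u) zero (suc j) e = contradiction e (All.lookup p (∈-lookup j))
unique-lookup (p ∷ u) (suc i) zero e = contradiction (sym e) (All.lookup p (∈-lookup i))
unique-lookup (p ∷ u) (suc i) (suc j) e = cong suc (unique-lookup u i j e)

unique-length : {xs : List (Fin M)} → Unique xs → length xs ≤ M
unique-length {xs = xs} u = injective⇒≤ {f = List.lookup xs} (unique-lookup u _ _)

unique-map : {f : A → B} (xs : List A) → (∀ {x y} → x ∈ xs → y ∈ xs → f x ≡ f y → x ≡ y) →
             Unique xs → Unique (map f xs)
unique-map [] h [] = []
unique-map (z ∷ zs) h (p ∷ v) = All.map⁺ (All.tabulate λ i e → All.lookup p i (h (here refl) (there i) e))
  ∷ unique-map zs (λ i j → h (there i) (there j)) v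

_∈?_ : (x : Fin M) (xs : List (Fin M)) → Dec (x ∈ xs)
x ∈? xs = x DM.∈? xs
  where import Data.List.Membership.DecPropositional _≟_ as DM

length-filter-¬ : {P : A → Set} (P? : Decidable P) (xs : List A) →
                  length (filter P? xs) + length (filter (¬? ∘ P?) xs) ≡ length xs
length-filter-¬ P? [] = refl
length-filter-¬ P? (x ∷ xs) with P? x
... | yes _ = cong suc (length-filter-¬ P? xs)
... | no _ = trans (ℕ.+-suc _ _) (cong suc (length-filter-¬ P? xs))

swap-comm : (a b c : Fin M) → swap a b c ≡ swap b a c
swap-comm a b c with c ≟ a
... | yes refl = trans (swapˡ c b) (sym (swapʳ b c))
... | no p with c ≟ b
... | yes refl = trans (swapʳ a c) (sym (swapˡ c a))
... | no q = trans (swap-other p q) (sym (swap-other q p))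

swap-injective : (a b : Fin M) → Injective (swap a b)
swap-injective a b e = trans (sym (swap-involutive a b _)) (trans (cong (swap a b) e) (swap-involutive a b _))

-- Both products are the three-cycle `u` to `v` to `w` to `u`. All splitting and merging of cyclic
-- words below rests on this relation.
swap-cycle : {u v w : Fin M} → u ≢ v → u ≢ w → v ≢ w →
                  swap u v ∘ swap v w ≗ swap u w ∘ swap u v
swap-cycle {u = u} {v} {w} uv uw vw z with z ≟ v
... | yes refl = trans (trans (cong (swap u v) (swapˡ v w)) (swap-other (uw ∘ sym) (vw ∘ sym)))
                    (sym (trans (cong (swap u w) (swapʳ u v)) (swapˡ u w)))
... | no zv with z ≟ w
... | yes refl = trans (trans (cong (swap u v) (swapʳ v w)) (swapʳ u v))
                    (sym (trans (cong (swap u w) (swap-other (uw ∘ sym) zv)) (swapʳ u w)))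
... | no zw with z ≟ u
... | yes refl = trans (trans (cong (swap u v) (swap-other uv uw)) (swapˡ u v))
                    (sym (trans (cong (swap u w) (swapˡ u v)) (swap-other (uv ∘ sym) vw)))
... | no zu = trans (trans (cong (swap u v) (swap-other zv zw)) (swap-other zu zv))
                  (sym (trans (cong (swap u w) (swap-other zu zv)) (swap-other zu zw)))

-- For distinct letters this sends each letter to the next and the last to the first. As a product
-- of transpositions it changes by single factors when letters are deleted.
cyc : List (Fin M) → Fin M → Fin M
cyc [] = id
cyc (x ∷ []) = id
cyc (x ∷ y ∷ zs) = swap x y ∘ cyc (y ∷ zs)

cyc-injective : (xs : List (Fin M)) → Injective (cyc xs)
cyc-injective [] e = e
cyc-injective (x ∷ []) e = e
cyc-injective (x ∷ y ∷ zs) e = cyc-injective (y ∷ zs) (swap-injective x y e)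

cyc-∉ : (xs : List (Fin M)) {z : Fin M} → z ∉ xs → cyc xs z ≡ z
cyc-∉ [] p = refl
cyc-∉ (x ∷ []) p = refl
cyc-∉ (x ∷ y ∷ zs) p = trans (cong (swap x y) (cyc-∉ (y ∷ zs) (p ∘ there)))
  (swap-other (p ∘ here) (p ∘ there ∘ here))

swap-∈ : {xs : List (Fin M)} {a b c : Fin M} → a ∈ xs → b ∈ xs → c ∈ xs → swap a b c ∈ xs
swap-∈ {xs = xs} {a} {b} {c} i j k with c ≟ a
... | yes refl = subst (_∈ xs) (sym (swapˡ c b)) j
... | no p with c ≟ b
... | yes refl = subst (_∈ xs) (sym (swapʳ a c)) i
... | no q = subst (_∈ xs) (sym (swap-other p q)) k

cyc-∈ : (xs : List (Fin M)) {z : Fin M} → z ∈ xs → cyc xs z ∈ xs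
cyc-∈ (x ∷ []) i = i
cyc-∈ (x ∷ y ∷ zs) {z} i = step (cyc-∈ (y ∷ zs)) (z ∈? (y ∷ zs))
  where
  step : (∀ {z} → z ∈ y ∷ zs → cyc (y ∷ zs) z ∈ y ∷ zs) → Dec (z ∈ y ∷ zs) → cyc (x ∷ y ∷ zs) z ∈ x ∷ y ∷ zs
  step ih (yes j) = swap-∈ (here refl) (there (here refl)) (there (ih j))
  step ih (no p) = swap-∈ (here refl) (there (here refl)) (subst (_∈ _) (sym (cyc-∉ (y ∷ zs) p)) i)

-- A transposition of two points of one cycle cuts it in two. By induction `swap-cycle` moves the
-- joining transposition one letter to the left at a time.
cyc-++ : (u : Fin M) (us : List (Fin M)) {v : Fin M} {vs : List (Fin M)} → Unique (u ∷ us ++ v ∷ vs) →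
         cyc (u ∷ us ++ v ∷ vs) ≗ swap u v ∘ cyc (u ∷ us) ∘ cyc (v ∷ vs)
cyc-++ u [] _ z = refl
cyc-++ u (u′ ∷ us) {v} {vs} (p ∷ uq) z = trans
  (cong (swap u u′) (cyc-++ u′ us uq z))
  (swap-cycle (All.lookup p (here refl)) (All.lookup p (there (∈-insert us)))
     (unique-head uq (∈-insert us) ∘ sym) _)

cyc-commute : {xs ys : List (Fin M)} → (∀ {z} → z ∈ xs → z ∉ ys) → cyc xs ∘ cyc ys ≗ cyc ys ∘ cyc xs
cyc-commute {xs = xs} {ys} d z with z ∈? xs
... | yes i = trans (cong (cyc xs) (cyc-∉ ys (d i))) (sym (cyc-∉ ys (d (cyc-∈ xs i))))
... | no p = trans (lemma (z ∈? ys)) (cong (cyc ys) (sym (cyc-∉ xs p)))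
  where
  lemma : Dec (z ∈ ys) → cyc xs (cyc ys z) ≡ cyc ys z
  lemma (yes j) = cyc-∉ xs (λ i → d i (cyc-∈ ys j))
  lemma (no q) = trans (cong (cyc xs) (cyc-∉ ys q)) (trans (cyc-∉ xs p) (sym (cyc-∉ ys q)))

-- By `cyc-++` both sides are the transposition of the two heads after the cycles of the two pieces,
-- and disjoint cycles commute.
cyc-rotate : (us vs : List (Fin M)) → Unique (us ++ vs) → cyc (us ++ vs) ≗ cyc (vs ++ us)
cyc-rotate [] vs u z = cong (λ xs → cyc xs z) (sym (++-identityʳ vs))
cyc-rotate (u ∷ us) [] uq z = cong (λ xs → cyc xs z) (++-identityʳ (u ∷ us))
cyc-rotate (u ∷ us) (v ∷ vs) uq z = trans (cyc-++ u us uq z) (trans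
  (trans (swap-comm u v _) (cong (swap v u) (cyc-commute (proj₂ (proj₂ (unique-++⁻ (u ∷ us) uq))) z)))
  (sym (cyc-++ v vs (unique-rotate (u ∷ us) (v ∷ vs) uq) z)))

-- The letters of a word are matched by ι without crossings.
data NC (ι : A → A) : List A → Set where
  []  : NC ι []
  arc : ∀ {x us b vs xs} → xs ≡ us ++ b ∷ vs → ι x ≡ b → ι b ≡ x →
        NC ι us → NC ι vs → NC ι (x ∷ xs)

module _ {ι : A → A} where

  NC-++ : ∀ {us vs} → NC ι us → NC ι vs → NC ι (us ++ vs)
  NC-++ [] q = q
  NC-++ {vs = ws} (arc {us = us} {b} {vs} refl e e′ p p′) q =
    arc (++-assoc us (b ∷ vs) ws) e e′ p (NC-++ p′ q)

  -- When the first letter `x` moves to the end, its arc turns around: the partner `b` now opens it,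
  -- and `vs`, which lay outside, becomes the enclosed word.
  NC-rotate : ∀ us {vs} → NC ι (us ++ vs) → NC ι (vs ++ us)
  NC-rotate [] {vs} p = subst (NC ι) (sym (++-identityʳ vs)) p
  NC-rotate (x ∷ us) {vs} (arc {us = us′} {b} {vs′} eq e e′ p p′) =
    subst (NC ι) (++-assoc vs [ x ] us) (NC-rotate us (subst (NC ι) eq′ (NC-++ p (arc refl e′ e p′ []))))
    where
    eq′ : us′ ++ b ∷ (vs′ ++ [ x ]) ≡ us ++ (vs ++ [ x ])
    eq′ = trans (sym (++-assoc us′ (b ∷ vs′) [ x ])) (trans (cong (_++ [ x ]) (sym eq)) (++-assoc us vs [ x ]))

  NC-closed : ∀ {xs y} → NC ι xs → y ∈ xs → ι y ∈ xs
  NC-closed (arc {us = us} refl e e′ p p′) (here refl) = there (subst (_∈ _) (sym e) (∈-insert us))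
  NC-closed (arc {us = us} refl e e′ p p′) (there i) with ∈-++⁻ us i
  ... | inj₁ j = there (∈-++⁺ˡ (NC-closed p j))
  ... | inj₂ (here refl) = here e′
  ... | inj₂ (there j) = there (∈-++⁺ʳ us (there (NC-closed p′ j)))

  -- Descending into the word enclosed by the first arc ends at an arc that encloses nothing, that
  -- is, at two adjacent partners.
  NC-leaf : ∀ {x xs} → NC ι (x ∷ xs) → ∃₂ λ l a → ∃₂ λ b r →
            x ∷ xs ≡ l ++ a ∷ b ∷ r × ι a ≡ b × ι b ≡ a × NC ι (l ++ r)
  NC-leaf {x} (arc {us = []} refl e e′ p p′) = [] , x , _ , _ , refl , e , e′ , p′
  NC-leaf {x} (arc {us = _ ∷ _} {b} {vs} refl e e′ p p′) with NC-leaf p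
  ... | l , a , b′ , r , eq , f , f′ , q = x ∷ l , a , b′ , r ++ b ∷ vs ,
    cong (x ∷_) (trans (cong (_++ b ∷ vs) eq) (++-assoc l (a ∷ b′ ∷ r) (b ∷ vs))) , f , f′ ,
    arc (sym (++-assoc l r (b ∷ vs))) e e′ q p′

NC-cong : {ι κ : A → A} {xs : List A} → (∀ {y} → y ∈ xs → ι y ≡ κ y) → NC ι xs → NC κ xs
NC-cong h [] = []
NC-cong h (arc {us = us} refl e e′ p p′) =
  arc refl (trans (sym (h (here refl))) e) (trans (sym (h (there (∈-insert us)))) e′)
    (NC-cong (h ∘ there ∘ ∈-++⁺ˡ) p) (NC-cong (h ∘ there ∘ ∈-++⁺ʳ us ∘ there) p′)

-- Matchings and the deletion of edges

record Matching (xs : List (Fin M)) (ι : Fin M → Fin M) : Set where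
  field
    closed     : ∀ {y} → y ∈ xs → ι y ∈ xs
    outside    : ∀ {y} → y ∉ xs → ι y ≡ y
    involutive : ∀ y → ι (ι y) ≡ y
    moves      : ∀ {y} → y ∈ xs → ι y ≢ y

  injective : Injective ι
  injective e = trans (sym (involutive _)) (trans (cong ι e) (involutive _))

  partner : ∀ {x b} → ι x ≡ b → ι b ≡ x
  partner {x} e = trans (cong ι (sym e)) (involutive x)

open Matching

matching-resp : {xs ys : List (Fin M)} {ι : Fin M → Fin M} →
                (∀ {y} → y ∈ xs ⇔ y ∈ ys) → Matching xs ι → Matching ys ι
matching-resp h m = record
  { closed = to h ∘ closed m ∘ from h ; outside = λ p → outside m (p ∘ to h)
  ; involutive = involutive m ; moves = moves m ∘ from h }

matching-rotate : (xs ys : List (Fin M)) {ι : Fin M → Fin M} → Matching (xs ++ ys) ι → Matching (ys ++ xs) ι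
matching-rotate xs ys = matching-resp (mk⇔ (∈-rotate xs ys) (∈-rotate ys xs))

module _ {xs : List (Fin M)} {ι : Fin M → Fin M} {x b : Fin M}
         (m : Matching (x ∷ b ∷ xs) ι) (u : Unique (x ∷ b ∷ xs)) (ιx : ι x ≡ b) where

  private
    ι′ : Fin M → Fin M
    ι′ = ι ∘ swap x b

  remove-x : ι′ x ≡ x
  remove-x = trans (cong ι (swapˡ x b)) (partner m ιx)

  remove-b : ι′ b ≡ b
  remove-b = trans (cong ι (swapʳ x b)) ιx

  remove-other : ∀ {y} → y ≢ x → y ≢ b → ι′ y ≡ ι y
  remove-other p q = cong ι (swap-other p q)

  remove-∈ : ∀ {y} → y ∈ xs → ι′ y ≡ ι y
  remove-∈ i = remove-other (unique-head u (there i)) (unique-head (AllPairs.tail u) i)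

  -- Since `ι` exchanges `x` and `b`, composing with their transposition cancels this edge and keeps
  -- the others.
  matching-remove : Matching xs ι′
  matching-remove = record { closed = cl ; outside = out ; involutive = inv
    ; moves = λ i e → moves m (there (there i)) (trans (sym (remove-∈ i)) e) }
    where
    cl : ∀ {y} → y ∈ xs → ι′ y ∈ xs
    cl {y} i rewrite remove-∈ i with closed m (there (there i))
    ... | here e = contradiction (trans (sym ιx) (partner m e)) (unique-head (AllPairs.tail u) i ∘ sym)
    ... | there (here e) = contradiction (injective m (trans ιx (sym e))) (unique-head u (there i) ∘ sym)
    ... | there (there j) = j
    out : ∀ {y} → y ∉ xs → ι′ y ≡ y
    out {y} p with y ≟ x
    ... | yes refl = remove-x
    ... | no q with y ≟ b
    ... | yes refl = remove-b
    ... | no q′ = trans (remove-other q q′) (outside m λ { (here e) → q e ; (there (here e)) → q′ e ; (there (there i)) → p i })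
    inv : ∀ y → ι′ (ι′ y) ≡ y
    inv y with y ≟ x
    ... | yes refl = trans (cong ι′ remove-x) remove-x
    ... | no p with y ≟ b
    ... | yes refl = trans (cong ι′ remove-b) remove-b
    ... | no q = trans (cong ι′ (remove-other p q))
        (trans (remove-other (λ e → q (trans (sym (involutive m y)) (trans (cong ι e) ιx)))
                          (λ e → p (trans (sym (involutive m y)) (trans (cong ι e) (partner m ιx))))) (involutive m y))

conj-≡ : {f g s : Fin M → Fin M} → (∀ x → s (s x) ≡ x) → Injective f →
         g ≗ s ∘ f ∘ s → Cycles f n → Cycles g n′ → n ≡ n′
conj-≡ {f = f} {g} {s} inv inj e q r =
  let s-inj = λ {x} {y} (h : s x ≡ s y) → trans (sym (inv x)) (trans (cong s h) (inv y))
      c , t = cycles-exist {f = s ∘ (f ∘ s)} (s-inj ∘ inj ∘ s-inj)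
      t′ = cycles-conj (f ∘ s) s inv t
  in trans (cycles-cong (λ x → cong f (sym (inv x))) q t′) (cycles-cong (sym ∘ e) t r)

cycles-insert₂ : {f g : Fin M → Fin M} {p q r s : Fin M} → Injective f → f p ≡ p → f q ≡ q →
                 p ≢ q → s ≢ q → r ≢ p → p ≢ s → g ≗ swap p r ∘ swap q s ∘ f →
                 Cycles g n → Cycles f n′ → n′ ≡ 2 + n
cycles-insert₂ {f = f} {q = q} {s = s} inj fp fq p≢q s≢q r≢p p≢s e c c′ =
  let inj₁ = λ {x} {y} → inj {x} {y} ∘ swap-injective q s
      _ , c₁ = cycles-exist {f = swap q s ∘ f} inj₁
  in trans (cycles-insert-≡ inj fq s≢q (λ _ → refl) c₁ c′)
       (cong suc (cycles-insert-≡ inj₁ (trans (cong (swap q s) fp) (swap-other p≢q p≢s)) r≢p e c c₁))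

-- Removing an edge whose two sides are adjacent in the face.
cycles-leaf : {x b w : Fin M} {ws : List (Fin M)} {ι : Fin M → Fin M} →
  Matching (x ∷ b ∷ w ∷ ws) ι → Unique (x ∷ b ∷ w ∷ ws) → ι x ≡ b →
  Cycles (cyc (x ∷ b ∷ w ∷ ws) ∘ ι) n → Cycles (cyc (w ∷ ws) ∘ ι ∘ swap x b) n′ → n′ ≡ suc n
cycles-leaf {x = x} {b} {w} {ws} {ι} m u@(_ ∷ u′@(_ ∷ _)) ιx q r =
  cycles-insert-≡ (injective (matching-remove m u ιx) ∘ cyc-injective (w ∷ ws))
    (trans (cong (cyc (w ∷ ws)) (remove-b m u ιx)) (cyc-∉ (w ∷ ws) (∉-head u′)))
    (unique-head u′ (here refl)) (λ _ → refl)
    -- The outermost factor `swap x b` of the cyclic word moves to the right end by conjugation.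
    -- What remains is `swap b w` after the smaller permutation, which fixes `b`.
    (cycles-conj _ (swap x b) (swap-involutive x b) q) r

-- Deleting an edge with different faces on its two sides merges these faces.
cycles-merge : {a b : Fin M} (us ws : List (Fin M)) {ι : Fin M → Fin M} →
  Matching (a ∷ b ∷ us ++ ws) ι → Unique (a ∷ b ∷ us ++ ws) → ι a ≡ b → us ++ ws ≢ [] →
  Cycles (cyc (a ∷ us) ∘ cyc (b ∷ ws) ∘ ι) n → Cycles (cyc (us ++ ws) ∘ ι ∘ swap a b) n′ → n′ ≡ 2 + n
cycles-merge {M} {n} {n′} {a} {b} us ws {ι} m uq ιa ne c c′ = case-of us ws refl refl
  where
  s σ σ′ ι′ : Fin M → Fin M
  s = swap a b
  ι′ = ι ∘ s
  σ = cyc (a ∷ us) ∘ cyc (b ∷ ws) ∘ ι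
  σ′ = cyc (us ++ ws) ∘ ι′
  m′ : Matching (us ++ ws) ι′
  m′ = matching-remove m uq ιa
  uq₁ : Unique (b ∷ us ++ ws)
  uq₁ = AllPairs.tail uq
  uq₂ : Unique (us ++ ws)
  uq₂ = AllPairs.tail uq₁
  a≢b : a ≢ b
  a≢b e = unique-head uq (here refl) (sym e)
  σ′-inj : Injective σ′
  σ′-inj = injective m′ ∘ cyc-injective (us ++ ws)
  σ′a : σ′ a ≡ a
  σ′a = trans (cong (cyc (us ++ ws)) (remove-x m uq ιa)) (cyc-∉ (us ++ ws) (∉-head uq ∘ there))
  σ′b : σ′ b ≡ b
  σ′b = trans (cong (cyc (us ++ ws)) (remove-b m uq ιa)) (cyc-∉ (us ++ ws) (∉-head uq₁))
  σ-inj : Injective σ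
  σ-inj = injective m ∘ cyc-injective (b ∷ ws) ∘ cyc-injective (a ∷ us)
  q₀ : ∃ (Cycles (s ∘ σ ∘ s))
  q₀ = cycles-exist (swap-injective a b ∘ σ-inj ∘ swap-injective a b)
  -- Conjugated by `s`, the permutation `σ` arises from `σ′` by inserting the fixed points `a` and
  -- `b` in front of the first letters of `us` and `ws`. If one of these words is empty, its end of
  -- the edge is inserted in front of the other end instead. The two fixed points account for the
  -- summand 2.
  finish : {p q r t : Fin M} → σ′ p ≡ p → σ′ q ≡ q → p ≢ q → t ≢ q → r ≢ p → p ≢ t →
           s ∘ σ ∘ s ≗ swap p r ∘ swap q t ∘ σ′ → n′ ≡ 2 + n
  finish σp σq p≢q t≢q r≢p p≢t e =
    trans (cycles-insert₂ σ′-inj σp σq p≢q t≢q r≢p p≢t e (proj₂ q₀) c′)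
      (cong (2 +_) (sym (conj-≡ {s = s} (swap-involutive a b) σ-inj (λ _ → refl) c (proj₂ q₀))))
  case-of : ∀ us₀ ws₀ → us ≡ us₀ → ws ≡ ws₀ → n′ ≡ 2 + n
  case-of [] [] refl refl = contradiction refl ne
  case-of [] (w ∷ ws) refl refl =
    finish σ′a σ′b a≢b (unique-head uq₁ (here refl)) (a≢b ∘ sym) (unique-head uq (there (here refl)) ∘ sym) λ _ → refl
  case-of (u ∷ us) [] refl refl =
    finish σ′b σ′a (a≢b ∘ sym) (unique-head uq (there (here refl))) a≢b (unique-head uq₁ (here refl) ∘ sym)
      λ z → trans (swap-comm a b _) (cong (λ xs → swap b a (swap a u (cyc xs (ι′ z)))) (sym (++-identityʳ (u ∷ us))))
  case-of (u ∷ us) (w ∷ ws) refl refl =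
    -- The transposition `swap w u`, by which the merged word differs from the two arcs, is carried
    -- to the left through `swap b w` and `swap a u` by `swap-cycle`; there it has become `s` and
    -- cancels.
    finish σ′a σ′b a≢b w≢b u≢a a≢w λ z → let X = σ′ z ; Y = cyc (u ∷ us) (cyc (w ∷ ws) (ι′ z)) in begin
      s (swap a u (cyc (u ∷ us) (cyc (b ∷ w ∷ []) (cyc (w ∷ ws) (ι′ z)))))
        ≡⟨ cong (s ∘ swap a u) (cyc-commute {xs = u ∷ us} {b ∷ w ∷ []} disjoint (cyc (w ∷ ws) (ι′ z))) ⟩
      s (swap a u (swap b w Y))
        ≡⟨ cong (s ∘ swap a u ∘ swap b w) (trans (sym (swap-involutive w u Y))
             (cong (swap w u) (trans (swap-comm w u Y) (sym (cyc-++ u us uq₂ (ι′ z)))))) ⟩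
      s (swap a u (swap b w (swap w u X)))
        ≡⟨ cong (s ∘ swap a u) (trans (swap-cycle (w≢b ∘ sym) (u≢b ∘ sym) w≢u X) (swap-comm b u _)) ⟩
      s (swap a u (swap u b (swap b w X)))
        ≡⟨ cong s (swap-cycle (u≢a ∘ sym) a≢b u≢b (swap b w X)) ⟩
      s (s (swap a u (swap b w X)))
        ≡⟨ swap-involutive a b _ ⟩
      swap a u (swap b w X) ∎
    where
    open ≡-Reasoning
    w∈ : w ∈ u ∷ us ++ w ∷ ws
    w∈ = ∈-insert (u ∷ us)
    w≢b : w ≢ b
    w≢b = unique-head uq₁ w∈
    u≢b : u ≢ b
    u≢b = unique-head uq₁ (here refl)
    u≢a : u ≢ a
    u≢a = unique-head uq (there (here refl))
    a≢w : a ≢ w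
    a≢w = unique-head uq (there w∈) ∘ sym
    w≢u : w ≢ u
    w≢u = unique-head uq₂ (∈-insert us)
    disjoint : ∀ {z} → z ∈ u ∷ us → z ∉ b ∷ w ∷ []
    disjoint i (here refl) = unique-head uq₁ (∈-++⁺ˡ i) refl
    disjoint i (there (here refl)) = proj₂ (proj₂ (unique-++⁻ (u ∷ us) uq₂)) i (here refl)

-- If the points of xs were all moved, the c cycle minima, together with the images of
-- those in xs, would be too many points.
fixed-point : {σ : Fin M → Fin M} {xs : List (Fin M)} {c : ℕ} → Unique xs → length xs ≡ n + n →
              Cycles σ c → M < c + n → ∃ λ y → y ∈ xs × σ y ≡ y
fixed-point {M} {n} {σ} {xs} {c} u len q M<c+n with any? (λ y → (y ∈? xs) ×-dec (σ y ≟ y))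
... | yes r = r
... | no none = contradiction (ℕ.*-cancelˡ-≤ 2 bound) (ℕ.<⇒≱ M<c+n)
  where
  open Quotient q
  mins ins outs : List (Fin M)
  mins = map (cycleMin q) (allFin c)
  ins = filter (_∈? xs) mins
  outs = filter (¬? ∘ (_∈? xs)) mins
  mins-unique : Unique mins
  mins-unique = proj₁ (proj₂ (hasCycles q))
  mins-length : length mins ≡ c
  mins-length = proj₂ (proj₂ (proj₂ (hasCycles q)))
  same-cycle : ∀ {x y} → x ∈ mins → y ∈ mins → label x ≡ label y → x ≡ y
  same-cycle i j e with ∈-map⁻ (cycleMin q) i | ∈-map⁻ (cycleMin q) j
  ... | _ , _ , refl | _ , _ , refl = cong (cycleMin q) (trans (sym (label-cycleMin q _)) (trans e (label-cycleMin q _)))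
  label-σ : ∀ x → label (σ x) ≡ label x
  label-σ x = sym (sound (1 , refl))
  apart : ∀ {x} → x ∈ mins → x ∉ map σ ins
  apart i j with ∈-map⁻ σ j
  ... | y , k , refl with ∈-filter⁻ (_∈? xs) {xs = mins} k
  ... | k′ , y∈ = none (y , y∈ , same-cycle i k′ (label-σ y))
  images-unique : Unique (map σ ins)
  images-unique = unique-map ins (λ i j e → same-cycle
      (proj₁ (∈-filter⁻ (_∈? xs) {xs = mins} i)) (proj₁ (∈-filter⁻ (_∈? xs) {xs = mins} j))
    (trans (sym (label-σ _)) (trans (cong label e) (label-σ _)))) (Unique.filter⁺ (_∈? xs) mins-unique)
  first : c + length ins ≤ M
  first = subst (_≤ M) (trans (length-++ mins) (cong₂ _+_ mins-length (length-map σ ins)))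
    (unique-length (Unique.++⁺ mins-unique images-unique (λ (i , j) → apart i j)))
  -- The minima outside `xs` are distinct from the `n + n` points of `xs`. Together with `first`
  -- this counts each minimum twice and gives `2 * (c + n) ≤ 2 * M`.
  second : length outs + (n + n) ≤ M
  second = subst (_≤ M) (trans (length-++ outs) (cong (length outs +_) len))
    (unique-length (Unique.++⁺ (Unique.filter⁺ (¬? ∘ (_∈? xs)) mins-unique) u
      (λ (i , j) → proj₂ (∈-filter⁻ (¬? ∘ (_∈? xs)) {xs = mins} i) j)))
  bound : 2 ℕ.* (c + n) ≤ 2 ℕ.* M
  bound = ℕ.≤-trans (ℕ.≤-reflexive (trans (cong (λ k → 2 ℕ.* (k + n)) (sym ins+outs))
      (trans (solve 3 (λ i o n → con 2 :* ((i :+ o) :+ n) := ((i :+ o) :+ i) :+ (o :+ (n :+ n))) refl (length ins)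
          (length outs) n)
             (cong (λ k → (k + length ins) + (length outs + (n + n))) ins+outs))))
    (ℕ.≤-trans (ℕ.+-mono-≤ first second) (ℕ.≤-reflexive (cong (M +_) (sym (ℕ.+-identityʳ M)))))
    where
    open +-*-Solver
    ins+outs : length ins + length outs ≡ c
    ins+outs = trans (length-filter-¬ (_∈? xs) mins) mins-length

-- Planarity as a noncrossing condition

σ-exists : {xs ys : List (Fin M)} {ι : Fin M → Fin M} → Matching ys ι → ∃ (Cycles (cyc xs ∘ ι))
σ-exists {xs = xs} m = cycles-exist (Matching.injective m ∘ cyc-injective xs)

-- A fixed point in the word is a side that directly follows its partner. Rotated to the front and
-- deleted, this edge raises the number of cycles by one and lowers the number of edges by one, so
-- `c + n` is preserved and the induction goes on.
cycles⇒NC : ∀ n {c} {xs : List (Fin M)} {ι : Fin M → Fin M} → Matching xs ι → Unique xs → length xs ≡ n + n →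
            Cycles (cyc xs ∘ ι) c → c + n ≡ suc M → NC ι xs
cycles⇒NC zero {xs = []} m u len q e = []
cycles⇒NC {M} (suc n) {c} {xs} {ι} m u len q e with fixed-point u len q (ℕ.≤-reflexive (sym e))
... | y , y∈ , fix with ∈-∃++ (Matching.closed m y∈)
... | l , r , refl = NC-rotate (x ∷ r) (go (r ++ l) refl (matching-rotate l (x ∷ r) m) (unique-rotate l (x ∷ r) u)
      (trans (length-++-comm (x ∷ r) l) len) (trans (sym (cyc-rotate l (x ∷ r) u x)) fix)
      (λ q′ → cycles-cong (λ z → cyc-rotate l (x ∷ r) u (ι z)) q q′))
  where
  x = ι y
  go : ∀ zs {ws} → ws ≡ x ∷ zs → Matching ws ι → Unique ws → length ws ≡ suc n + suc n → cyc ws x ≡ y →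
       (∀ {c′} → Cycles (cyc ws ∘ ι) c′ → c ≡ c′) → NC ι ws
  go [] refl m′ u′ len′ fix′ same = contradiction (trans len′ (cong suc (ℕ.+-suc n n))) λ ()
  go (b ∷ []) refl m′ u′ len′ fix′ same = arc {us = []} refl ιx (Matching.partner m′ ιx) [] []
    where
    ιx : ι x ≡ b
    ιx = trans (Matching.involutive m′ y) (trans (sym fix′) (swapˡ x b))
  go (b ∷ w ∷ ws) refl m′ u′ len′ fix′ same =
    arc {us = []} refl ιx (Matching.partner m′ ιx) [] (NC-cong (remove-∈ m′ u′ ιx)
      (cycles⇒NC n m″ (AllPairs.tail (AllPairs.tail u′)) (ℕ.suc-injective (ℕ.suc-injective (trans len′ (cong suc (ℕ.+-suc n n)))))
        (proj₂ q″) count))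
    where
    ιx : ι x ≡ b
    ιx = trans (Matching.involutive m′ y) (trans (sym fix′)
      (trans (cong (swap x b) (cyc-∉ (b ∷ w ∷ ws) (∉-head u′))) (swapˡ x b)))
    m″ : Matching (w ∷ ws) (ι ∘ swap x b)
    m″ = matching-remove m′ u′ ιx
    q″ : ∃ (Cycles (cyc (w ∷ ws) ∘ ι ∘ swap x b))
    q″ = σ-exists {xs = w ∷ ws} m″
    q′ : ∃ (Cycles (cyc (x ∷ b ∷ w ∷ ws) ∘ ι))
    q′ = σ-exists {xs = x ∷ b ∷ w ∷ ws} m′
    count : proj₁ q″ + n ≡ suc M
    count = trans (cong (_+ n) (trans (cycles-leaf m′ u′ ιx (proj₂ q′) (proj₂ q″)) (cong suc (sym (same (proj₂ q′))))))
                  (trans (sym (ℕ.+-suc c n)) e)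

-- Adjacent partners from `NC-leaf` are deleted until one edge is left, where the permutation is the
-- identity with `M` cycles. The empty word has to be excluded: it gives `M` cycles as well, one
-- fewer than the formula demands.
NC⇒cycles : ∀ n {c} {xs : List (Fin M)} {ι : Fin M → Fin M} → Matching xs ι → Unique xs → length xs ≡ suc n + suc n →
            NC ι xs → Cycles (cyc xs ∘ ι) c → c + suc n ≡ suc M
NC⇒cycles {M} n {c} {xs = x ∷ xs} {ι} m u len nc q with NC-leaf nc
... | l , a , b , r , eq , ιa , ιb , nc′ = go n (r ++ l) refl (rot m) (unique-rotate l (a ∷ b ∷ r) u₁)
      (trans (length-++-comm (a ∷ b ∷ r) l) (trans (cong length (sym eq)) len)) (NC-rotate l nc′)
      (λ q′ → cycles-cong (λ z → trans (cong (λ zs → cyc zs (ι z)) eq) (cyc-rotate l (a ∷ b ∷ r) u₁ (ι z))) q q′)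
  where
  u₁ : Unique (l ++ a ∷ b ∷ r)
  u₁ = subst Unique eq u
  rot : Matching (x ∷ xs) ι → Matching (a ∷ b ∷ r ++ l) ι
  rot m = matching-rotate l (a ∷ b ∷ r) (subst (λ zs → Matching zs ι) eq m)
  go : ∀ n zs {ws} → ws ≡ a ∷ b ∷ zs → Matching ws ι → Unique ws → length ws ≡ suc n + suc n → NC ι zs →
       (∀ {c′} → Cycles (cyc ws ∘ ι) c′ → c ≡ c′) → c + suc n ≡ suc M
  go zero [] refl m′ u′ len′ nc″ same = trans (ℕ.+-suc c 0) (cong suc (trans (ℕ.+-identityʳ c)
    (trans (same (proj₂ q′)) (cycles-cong id≗ (proj₂ q′) cycles-id))))
    where
    q′ : ∃ (Cycles (cyc (a ∷ b ∷ []) ∘ ι))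
    q′ = σ-exists {xs = a ∷ b ∷ []} m′
    id≗ : swap a b ∘ ι ≗ id
    id≗ z with z ≟ a
    ... | yes refl = trans (cong (swap z b) ιa) (swapʳ z b)
    ... | no p with z ≟ b
    ... | yes refl = trans (cong (swap a z) ιb) (swapˡ a z)
    ... | no p′ = let fz = Matching.outside m′ λ { (here e) → p e ; (there (here e)) → p′ e } in
      trans (cong (swap a b) fz) (swap-other p p′)
  go (suc n) [] refl m′ u′ len′ nc″ same = contradiction (trans len′ (cong (2 +_) (ℕ.+-suc n (suc n)))) λ ()
  go zero (w ∷ ws) refl m′ u′ () nc″ same
  go (suc n) (w ∷ ws) refl m′ u′ len′ nc″ same = trans (ℕ.+-suc c (suc n))
    (trans (cong (λ k → k + suc n) (sym (trans (cycles-leaf m′ u′ ιa (proj₂ q′) (proj₂ q″)) (cong suc (sym (same (proj₂ q′)))))))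
      (NC⇒cycles n m″ (AllPairs.tail (AllPairs.tail u′))
          (ℕ.suc-injective (ℕ.suc-injective (trans len′ (cong suc (ℕ.+-suc (suc n) (suc n))))))
        (NC-cong (sym ∘ remove-∈ m′ u′ ιa) nc″) (proj₂ q″)))
    where
    m″ : Matching (w ∷ ws) (ι ∘ swap a b)
    m″ = matching-remove m′ u′ ιa
    q″ : ∃ (Cycles (cyc (w ∷ ws) ∘ ι ∘ swap a b))
    q″ = σ-exists {xs = w ∷ ws} m″
    q′ : ∃ (Cycles (cyc (a ∷ b ∷ w ∷ ws) ∘ ι))
    q′ = σ-exists {xs = a ∷ b ∷ w ∷ ws} m′

cut-↭ : (p r : List A) {q s : List A} {a b : A} → (p ++ a ∷ q) ++ (r ++ b ∷ s) ↭ a ∷ b ∷ (q ++ p) ++ (s ++ r)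
cut-↭ p r {q} {s} {a} {b} = ↭-trans (++⁺ (++-comm p (a ∷ q)) (++-comm r (b ∷ s))) (prep a (shift b (q ++ p) (s ++ r)))

module _ {N c : ℕ} {p q r s : List (Fin M)} {a b : Fin M} {ι : Fin M → Fin M} where

  -- Genus 0 with two faces means `c ≡ N`. Cutting the edge leaves N - 1 edges on the merged face
  -- and, by `cycles-merge`, c + 2 cycles; the criterion (c + 2) + (N - 1) = M + 1 with M = 2N says
  -- exactly c = N.
  planar⇔NC : Matching ((p ++ a ∷ q) ++ (r ++ b ∷ s)) ι → Unique ((p ++ a ∷ q) ++ (r ++ b ∷ s)) → ι a ≡ b →
    length ((p ++ a ∷ q) ++ (r ++ b ∷ s)) ≡ N + N → M ≡ N + N →
    Cycles (cyc (p ++ a ∷ q) ∘ cyc (r ++ b ∷ s) ∘ ι) c → c ≡ N ⇔ NC ι ((q ++ p) ++ (s ++ r))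
  planar⇔NC m u ιa len M≡ C = go N ((q ++ p) ++ (s ++ r)) refl len′ M≡
    where
    m′ : Matching (a ∷ b ∷ (q ++ p) ++ (s ++ r)) ι
    m′ = matching-resp (mk⇔ (∈-resp-↭ (cut-↭ p r)) (∈-resp-↭ (↭-sym (cut-↭ p r)))) m
    u′ : Unique (a ∷ b ∷ (q ++ p) ++ (s ++ r))
    u′ = unique-resp-↭ (cut-↭ p r) u
    len′ : 2 + length ((q ++ p) ++ (s ++ r)) ≡ N + N
    len′ = trans (sym (↭-length (cut-↭ p r))) len
    u₁ = unique-++⁻ (p ++ a ∷ q) u
    rotated : cyc (p ++ a ∷ q) ∘ cyc (r ++ b ∷ s) ∘ ι ≗ cyc (a ∷ q ++ p) ∘ cyc (b ∷ s ++ r) ∘ ι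
    rotated z = trans (cyc-rotate p (a ∷ q) (proj₁ u₁) _)
        (cong (cyc (a ∷ q ++ p)) (cyc-rotate r (b ∷ s) (proj₁ (proj₂ u₁)) (ι z)))
    C₁ : ∃ (Cycles (cyc (a ∷ q ++ p) ∘ cyc (b ∷ s ++ r) ∘ ι))
    C₁ = cycles-exist (Matching.injective m ∘ cyc-injective (b ∷ s ++ r) ∘ cyc-injective (a ∷ q ++ p))
    c≡ : c ≡ proj₁ C₁
    c≡ = cycles-cong rotated C (proj₂ C₁)
    m″ : Matching ((q ++ p) ++ (s ++ r)) (ι ∘ swap a b)
    m″ = matching-remove m′ u′ ιa
    uq : Unique ((q ++ p) ++ (s ++ r))
    uq = AllPairs.tail (AllPairs.tail u′)
    C₂ : ∃ (Cycles (cyc ((q ++ p) ++ (s ++ r)) ∘ ι ∘ swap a b))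
    C₂ = σ-exists {xs = (q ++ p) ++ (s ++ r)} m″
    c₂≡ : (q ++ p) ++ (s ++ r) ≢ [] → proj₁ C₂ ≡ 2 + c
    c₂≡ ne = trans (cycles-merge (q ++ p) (s ++ r) m′ u′ ιa ne (proj₂ C₁) (proj₂ C₂)) (cong (2 +_) (sym c≡))
    shifted : ∀ n → M ≡ suc n + suc n → (c ≡ suc n) ⇔ (2 + c + n ≡ suc M)
    shifted n refl = mk⇔
      (λ { refl → cong (2 +_) (sym (ℕ.+-suc n n)) })
      (λ e → ℕ.+-cancelʳ-≡ n c (suc n) (trans (ℕ.suc-injective (ℕ.suc-injective e)) (ℕ.+-suc n n)))
    go : ∀ N zs → (q ++ p) ++ (s ++ r) ≡ zs → 2 + length ((q ++ p) ++ (s ++ r)) ≡ N + N → M ≡ N + N → c ≡ N ⇔ NC ι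
        ((q ++ p) ++ (s ++ r))
    go zero zs eq () M≡
    go (suc n) (w ∷ ws) eq l M≡ = mk⇔
      (λ e → NC-cong (remove-∈ m′ u′ ιa) (cycles⇒NC n m″ uq l′ (proj₂ C₂) (trans (cong (_+ n) (c₂≡ ne)) (to (shifted n M≡) e))))
      (λ nc → from (shifted n M≡) (trans (cong (_+ n) (sym (c₂≡ ne))) (sound n l′ (NC-cong (sym ∘ remove-∈ m′ u′ ιa) nc))))
      where
      ne : (q ++ p) ++ (s ++ r) ≢ []
      ne e with () ← trans (sym eq) e
      l′ : length ((q ++ p) ++ (s ++ r)) ≡ n + n
      l′ = ℕ.suc-injective (ℕ.suc-injective (trans l (cong suc (ℕ.+-suc n n))))
      sound : ∀ n → length ((q ++ p) ++ (s ++ r)) ≡ n + n → NC (ι ∘ swap a b) ((q ++ p) ++ (s ++ r)) → proj₁ C₂ + n ≡ suc M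
      sound zero e nc = contradiction (trans (cong length (sym eq)) e) λ ()
      sound (suc n) e nc = NC⇒cycles n m″ uq e nc (proj₂ C₂)
    -- Both faces have a single side, so there is no merged face to which `cycles-merge` applies.
    -- Here `ι` is `swap a b`, and `c` is computed from the identity by one insertion.
    go (suc n) [] eq l M≡ = mk⇔ (λ _ → subst (NC ι) (sym eq) []) (λ _ → ℕ.suc-injective (trans 1+c≡M (trans M≡ (cong suc N≡))))
      where
      N≡ : n + suc n ≡ suc n
      N≡ = trans (sym (ℕ.suc-injective (trans (cong (λ zs → 2 + length zs) (sym eq)) l)))
        (cong suc (sym (ℕ.m+n≡0⇒m≡0 n (sym
            (ℕ.suc-injective (ℕ.suc-injective
                (trans (trans (cong (λ zs → 2 + length zs) (sym eq)) l) (cong suc (ℕ.+-suc n n)))))))))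
      ι≗ : cyc (p ++ a ∷ q) ∘ cyc (r ++ b ∷ s) ∘ ι ≗ swap a b ∘ id
      ι≗ z = trans (rotated z) (trans (cong₂ (λ us ws → cyc (a ∷ us) (cyc (b ∷ ws) (ι z)))
               (++-conicalˡ (q ++ p) (s ++ r) eq) (++-conicalʳ (q ++ p) (s ++ r) eq)) (only z))
        where
        only : ι ≗ swap a b
        only z with z ≟ a
        ... | yes refl = trans ιa (sym (swapˡ z b))
        ... | no h with z ≟ b
        ... | yes refl = trans (Matching.partner m ιa) (sym (swapʳ a z))
        ... | no h′ = trans (Matching.outside m′ λ { (here e) → h e ; (there (here e)) → h′ e
                               ; (there (there i)) → case subst (z ∈_) eq i of λ () }) (sym (swap-other h h′))
      1+c≡M : suc c ≡ M
      1+c≡M = sym (cycles-insert-≡ id refl (unique-head u′ (here refl)) ι≗ C cycles-id)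

-- Cardinalities

card-⇔ : (∀ a → P a ⇔ Q a) → HasCard P n → HasCard Q n
card-⇔ h (xs , u , e , l) = xs , u , (λ a → mk⇔ (to (h a) ∘ to (e a)) (from (e a) ∘ from (h a))) , l

card-∅ : (∀ a → ¬ P a) → HasCard P 0
card-∅ h = [] , [] , (λ a → mk⇔ (λ ()) (λ p → contradiction p (h a))) , refl

card-singleton : (a : A) → HasCard (_≡ a) 1
card-singleton a = [ a ] , [] ∷ [] , (λ b → mk⇔ (λ { (here e) → e }) here) , refl

card-⊎ : (∀ a → P a → ¬ Q a) → HasCard P m → HasCard Q n → HasCard (λ a → P a ⊎ Q a) (m + n)
card-⊎ d (xs , u , e , refl) (ys , v , f , refl) = xs ++ ys
  , Unique.++⁺ u v (λ (i , j) → d _ (to (e _) i) (to (f _) j))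
  , (λ a → mk⇔ (λ i → case ∈-++⁻ xs i of λ { (inj₁ j) → inj₁ (to (e a) j) ; (inj₂ j) → inj₂ (to (f a) j) })
               λ { (inj₁ p) → ∈-++⁺ˡ (from (e a) p) ; (inj₂ q) → ∈-++⁺ʳ xs (from (f a) q) })
  , length-++ xs

length-cartesianProduct : (xs : List A) (ys : List B) → length (cartesianProduct xs ys) ≡ length xs ℕ.* length ys
length-cartesianProduct [] ys = refl
length-cartesianProduct (x ∷ xs) ys = trans (length-++ (map (x ,_) ys))
  (cong₂ _+_ (length-map (x ,_) ys) (length-cartesianProduct xs ys))

-- The second count may use a witness of the first: the rest of a coloured face is known to
-- alternate only because the part cut off is matched without crossings. Without a witness the
-- product is zero anyway.
card-× : {C : Set} {P : A → Set} {Q : B → Set} {R : C → Set} (g : A → B → C) (fst : C → A) (snd : C → B) →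
         (∀ {a b} → P a → Q b → R (g a b) × fst (g a b) ≡ a × snd (g a b) ≡ b) →
         (∀ {c} → R c → P (fst c) × Q (snd c) × g (fst c) (snd c) ≡ c) →
         HasCard P m → (∃ P → HasCard Q n) → HasCard R (m ℕ.* n)
card-× {A = A} {B} {n = n} {P = P} {Q} {R} g fst snd intro elim (xs , u , e , refl) card-Q = go xs u e
  where
  go : ∀ xs → Unique xs → (∀ a → (a ∈ xs) ⇔ P a) → HasCard R (length xs ℕ.* n)
  go [] u e = card-∅ λ c r → case from (e _) (proj₁ (elim r)) of λ ()
  go xs@(x ∷ _) u e with card-Q (x , to (e x) (here refl))
  ... | ys , v , f , refl = map g′ zs
    , unique-map zs (λ i j h → pair-inj (introᵣ i) (introᵣ j) h) (Unique.cartesianProduct⁺ u v)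
    , (λ c → mk⇔ (toR c) (fromR c)) , trans (length-map g′ zs) (length-cartesianProduct xs ys)
    where
    g′ : A × B → _
    g′ (a , b) = g a b
    zs : List (A × B)
    zs = cartesianProduct xs ys
    introᵣ : ∀ {p} → p ∈ zs → R (g′ p) × fst (g′ p) ≡ proj₁ p × snd (g′ p) ≡ proj₂ p
    introᵣ i = let j , k = ∈-cartesianProduct⁻ xs ys i in intro (to (e _) j) (to (f _) k)
    pair-inj : ∀ {p q} → R (g′ p) × fst (g′ p) ≡ proj₁ p × snd (g′ p) ≡ proj₂ p →
               R (g′ q) × fst (g′ q) ≡ proj₁ q × snd (g′ q) ≡ proj₂ q → g′ p ≡ g′ q → p ≡ q
    pair-inj (_ , i , j) (_ , k , l) h = cong₂ _,_ (trans (sym i) (trans (cong fst h) k)) (trans (sym j) (trans (cong snd h) l))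
    toR : ∀ c → c ∈ map g′ zs → R c
    toR c i with ∈-map⁻ g′ i
    ... | p , j , refl = proj₁ (introᵣ j)
    fromR : ∀ c → R c → c ∈ map g′ zs
    fromR c r = let p , q , h = elim r in
      subst (_∈ map g′ zs) h (∈-map⁺ g′ (∈-cartesianProduct⁺ (from (e _) p) (from (f _) q)))

Split : (List A → A → List A → B → Set) → List A → B → Set
Split Q xs v = ∃₂ λ us b → ∃ λ vs → xs ≡ us ++ b ∷ vs × Q us b vs v

sumSplits : (List A → A → List A → ℕ) → List A → ℕ
sumSplits f [] = 0
sumSplits f (b ∷ vs) = f [] b vs + sumSplits (λ us → f (b ∷ us)) vs

-- `key` recovers the letter at which the word is split. As the letters are distinct, different
-- splits contribute disjoint sets.
card-splits : {Q : List A → A → List A → B → Set} {f : List A → A → List A → ℕ} (xs : List A) (key : B → A) →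
  (∀ {us b vs v} → Q us b vs v → key v ≡ b) → Unique xs →
  (∀ us b vs → xs ≡ us ++ b ∷ vs → HasCard (Q us b vs) (f us b vs)) → HasCard (Split Q xs) (sumSplits f xs)
card-splits [] key k u h = card-∅ λ { v ([] , _ , _ , () , _) ; v (_ ∷ _ , _ , _ , () , _) }
card-splits {Q = Q} (b ∷ bs) key k u h = card-⇔ (λ v → mk⇔ (join v) (part v))
  (card-⊎ disjoint (h [] b bs refl)
    (card-splits {Q = λ us → Q (b ∷ us)} bs key k (AllPairs.tail u) (λ us c vs e → h (b ∷ us) c vs (cong (b ∷_) e))))
  where
  disjoint : ∀ v → Q [] b bs v → ¬ Split (λ us → Q (b ∷ us)) bs v
  disjoint v q (us , c , vs , refl , q′) = unique-head u (∈-insert us) (trans (sym (k q′)) (k q))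
  join : ∀ v → Q [] b bs v ⊎ Split (λ us → Q (b ∷ us)) bs v → Split Q (b ∷ bs) v
  join v (inj₁ q) = [] , b , bs , refl , q
  join v (inj₂ (us , c , vs , e , q)) = b ∷ us , c , vs , cong (b ∷_) e , q
  part : ∀ v → Split Q (b ∷ bs) v → Q [] b bs v ⊎ Split (λ us → Q (b ∷ us)) bs v
  part v ([] , _ , _ , refl , q) = inj₁ q
  part v (_ ∷ us , c , vs , refl , q) = inj₂ (us , c , vs , refl , q)

-- Tables assembled from independent pieces

Table : ℕ → Set
Table M = Vec (Fin M) M

-- Being the identity off `D`, the table is determined by its values on `D`; counting such tables
-- counts partial gluings of the sides in `D`.
On : List (Fin M) → ((Fin M → Fin M) → Set) → Table M → Set
On D P v = P (lookup v) × (∀ y → y ∉ D → lookup v y ≡ y)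

On-⇔ : {D : List (Fin M)} (P Q : (Fin M → Fin M) → Set) → (∀ f → P f ⇔ Q f) → ∀ v → On D P v ⇔ On D Q v
On-⇔ P Q h v = mk⇔ (λ (p , o) → to (h _) p , o) (λ (q , o) → from (h _) q , o)

-- These two properties allow a table to be cut into its restrictions to disjoint sets and to be
-- reassembled from them.
record Local (D : List (Fin M)) (P : (Fin M → Fin M) → Set) : Set where
  field
    localised : ∀ {f g} → (∀ {y} → y ∈ D → f y ≡ g y) → P f → P g
    stable    : ∀ {f y} → P f → y ∈ D → f y ∈ D

table-≡ : {v w : Table M} → lookup v ≗ lookup w → v ≡ w
table-≡ {v = v} {w} h = trans (sym (tabulate∘lookup v)) (trans (tabulate-cong h) (tabulate∘lookup w))

restrict : List (Fin M) → (Fin M → Fin M) → Fin M → Fin M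
restrict D f y with y ∈? D
... | yes _ = f y
... | no _ = y

restrict-∈ : {D : List (Fin M)} {f : Fin M → Fin M} {y : Fin M} → y ∈ D → restrict D f y ≡ f y
restrict-∈ {D = D} {y = y} i with y ∈? D
... | yes _ = refl
... | no p = contradiction i p

restrict-∉ : {D : List (Fin M)} {f : Fin M → Fin M} {y : Fin M} → y ∉ D → restrict D f y ≡ y
restrict-∉ {D = D} {y = y} p with y ∈? D
... | yes i = contradiction i p
... | no _ = refl

-- The composite of the two pieces and the transposition has disjoint supports, so each piece
-- survives on its own set; restricting to `D₁` and `D₂` is the inverse.
card-glue : {D D₁ D₂ : List (Fin M)} {x b : Fin M} {P₁ P₂ : (Fin M → Fin M) → Set} →
  D ↭ x ∷ b ∷ D₁ ++ D₂ → Unique D → Local D₁ P₁ → Local D₂ P₂ →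
  HasCard (On D₁ P₁) m → (∃ (On D₁ P₁) → HasCard (On D₂ P₂) n) →
  HasCard (On D (λ f → f x ≡ b × f b ≡ x × P₁ f × P₂ f)) (m ℕ.* n)
card-glue {M} {D = D} {D₁} {D₂} {x} {b} {P₁} {P₂} perm uD loc₁ loc₂ =
  card-× (λ v w → tabulate (glue (lookup v) (lookup w))) (tabulate ∘ restrict D₁ ∘ lookup)
      (tabulate ∘ restrict D₂ ∘ lookup) intro elim
  where
  module L₁ = Local loc₁
  module L₂ = Local loc₂
  u : Unique (x ∷ b ∷ D₁ ++ D₂)
  u = unique-resp-↭ perm uD
  u″ = unique-++⁻ D₁ (AllPairs.tail (AllPairs.tail u))
  disj : ∀ {y} → y ∈ D₁ → y ∉ D₂
  disj = proj₂ (proj₂ u″)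
  ∉D : ∀ {y} → y ≢ x → y ≢ b → y ∉ D₁ → y ∉ D₂ → y ∉ D
  ∉D p q r s i with ∈-resp-↭ perm i
  ... | here e = p e
  ... | there (here e) = q e
  ... | there (there j) with ∈-++⁻ D₁ j
  ... | inj₁ k = r k
  ... | inj₂ k = s k
  D₁⊆ : ∀ {y} → y ∈ D₁ → y ∈ b ∷ D₁ ++ D₂
  D₁⊆ = there ∘ ∈-++⁺ˡ
  D₂⊆ : ∀ {y} → y ∈ D₂ → y ∈ b ∷ D₁ ++ D₂
  D₂⊆ = there ∘ ∈-++⁺ʳ D₁
  glue : (Fin M → Fin M) → (Fin M → Fin M) → Fin M → Fin M
  glue f g = swap x b ∘ f ∘ g
  fixes : ∀ {y} → y ∈ D₁ ++ D₂ → swap x b y ≡ y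
  fixes i = swap-other (unique-head u (there i)) (unique-head (AllPairs.tail u) i)
  x∉₁ : x ∉ D₁
  x∉₁ = ∉-head u ∘ D₁⊆
  x∉₂ : x ∉ D₂
  x∉₂ = ∉-head u ∘ D₂⊆
  b∉₁ : b ∉ D₁
  b∉₁ = ∉-head (AllPairs.tail u) ∘ ∈-++⁺ˡ
  b∉₂ : b ∉ D₂
  b∉₂ = ∉-head (AllPairs.tail u) ∘ ∈-++⁺ʳ D₁

  module Glued {f g : Fin M → Fin M}
               (st₁ : {y : Fin M} → y ∈ D₁ → f y ∈ D₁) (out₁ : (y : Fin M) → y ∉ D₁ → f y ≡ y)
               (st₂ : {y : Fin M} → y ∈ D₂ → g y ∈ D₂) (out₂ : (y : Fin M) → y ∉ D₂ → g y ≡ y) where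
    at-∉ : ∀ {y} → y ∉ D₁ → y ∉ D₂ → glue f g y ≡ swap x b y
    at-∉ p q = cong (swap x b) (trans (cong f (out₂ _ q)) (out₁ _ p))
    at-x : glue f g x ≡ b
    at-x = trans (at-∉ x∉₁ x∉₂) (swapˡ x b)
    at-b : glue f g b ≡ x
    at-b = trans (at-∉ b∉₁ b∉₂) (swapʳ x b)
    at-₁ : ∀ {y} → y ∈ D₁ → glue f g y ≡ f y
    at-₁ i = trans (cong (swap x b ∘ f) (out₂ _ (disj i))) (fixes (∈-++⁺ˡ (st₁ i)))
    at-₂ : ∀ {y} → y ∈ D₂ → glue f g y ≡ g y
    at-₂ i = trans (cong (swap x b) (out₁ _ (λ j → disj j (st₂ i)))) (fixes (∈-++⁺ʳ D₁ (st₂ i)))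

  intro : ∀ {v w} → On D₁ P₁ v → On D₂ P₂ w →
    On D (λ f → f x ≡ b × f b ≡ x × P₁ f × P₂ f) (tabulate (glue (lookup v) (lookup w)))
    × tabulate (restrict D₁ (lookup (tabulate (glue (lookup v) (lookup w))))) ≡ v
    × tabulate (restrict D₂ (lookup (tabulate (glue (lookup v) (lookup w))))) ≡ w
  intro {v} {w} (p₁ , out₁) (p₂ , out₂) =
    ( (trans (lt x) at-x , trans (lt b) at-b , L₁.localised (λ i → sym (trans (lt _) (at-₁ i))) p₁
      , L₂.localised (λ i → sym (trans (lt _) (at-₂ i))) p₂)
    , λ y p → let y≢x = λ { refl → p (back (here refl)) } ; y≢b = λ { refl → p (back (there (here refl))) } in
        trans (lt y) (trans (at-∉ (p ∘ back ∘ there ∘ D₁⊆) (p ∘ back ∘ there ∘ D₂⊆)) (swap-other y≢x y≢b)))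
    , table-≡ (λ y → trans (lookup∘tabulate _ y) (r₁ y (y ∈? D₁)))
    , table-≡ (λ y → trans (lookup∘tabulate _ y) (r₂ y (y ∈? D₂)))
    where
    open Glued (L₁.stable p₁) out₁ (L₂.stable p₂) out₂
    h = glue (lookup v) (lookup w)
    lt : ∀ y → lookup (tabulate h) y ≡ h y
    lt = lookup∘tabulate h
    back : ∀ {y} → y ∈ x ∷ b ∷ D₁ ++ D₂ → y ∈ D
    back = ∈-resp-↭ (↭-sym perm)
    r₁ : ∀ y → Dec (y ∈ D₁) → restrict D₁ (lookup (tabulate h)) y ≡ lookup v y
    r₁ y (yes i) = trans (restrict-∈ i) (trans (lt y) (at-₁ i))
    r₁ y (no p) = trans (restrict-∉ p) (sym (out₁ y p))
    r₂ : ∀ y → Dec (y ∈ D₂) → restrict D₂ (lookup (tabulate h)) y ≡ lookup w y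
    r₂ y (yes i) = trans (restrict-∈ i) (trans (lt y) (at-₂ i))
    r₂ y (no p) = trans (restrict-∉ p) (sym (out₂ y p))

  elim : ∀ {c} → On D (λ f → f x ≡ b × f b ≡ x × P₁ f × P₂ f) c →
    On D₁ P₁ (tabulate (restrict D₁ (lookup c))) × On D₂ P₂ (tabulate (restrict D₂ (lookup c)))
    × tabulate (glue (lookup (tabulate (restrict D₁ (lookup c)))) (lookup (tabulate (restrict D₂ (lookup c))))) ≡ c
  elim {c} ((cx , cb , p₁ , p₂) , out) = on₁ , on₂
    , table-≡ λ y → trans (lookup∘tabulate _ y) (same y (y ≟ x) (y ≟ b) (y ∈? D₁) (y ∈? D₂))
    where
    on₁ : On D₁ P₁ (tabulate (restrict D₁ (lookup c)))
    on₁ = L₁.localised (λ {y} i → sym (trans (lookup∘tabulate (restrict D₁ (lookup c)) y) (restrict-∈ i))) p₁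
        , λ y p → trans (lookup∘tabulate (restrict D₁ (lookup c)) y) (restrict-∉ p)
    on₂ : On D₂ P₂ (tabulate (restrict D₂ (lookup c)))
    on₂ = L₂.localised (λ {y} i → sym (trans (lookup∘tabulate (restrict D₂ (lookup c)) y) (restrict-∈ i))) p₂
        , λ y p → trans (lookup∘tabulate (restrict D₂ (lookup c)) y) (restrict-∉ p)
    f₁ = lookup (tabulate (restrict D₁ (lookup c)))
    f₂ = lookup (tabulate (restrict D₂ (lookup c)))
    open Glued {f₁} {f₂} (L₁.stable (proj₁ on₁)) (proj₂ on₁) (L₂.stable (proj₁ on₂)) (proj₂ on₂)
    same : ∀ y → Dec (y ≡ x) → Dec (y ≡ b) → Dec (y ∈ D₁) → Dec (y ∈ D₂) → glue f₁ f₂ y ≡ lookup c y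
    same y (yes refl) _ _ _ = trans at-x (sym cx)
    same y _ (yes refl) _ _ = trans at-b (sym cb)
    same y _ _ (yes i) _ = trans (at-₁ i) (trans (lookup∘tabulate _ y) (restrict-∈ i))
    same y _ _ _ (yes i) = trans (at-₂ i) (trans (lookup∘tabulate _ y) (restrict-∈ i))
    same y (no p) (no q) (no r) (no s) = trans (at-∉ r s) (trans (swap-other p q) (sym (out y (∉D p q r s))))

-- The numbers of matchings

module Counting where
  open import Data.Nat.Properties
  open +-*-Solver using (solve; _:=_; _:+_; _:*_; con)
  open ≡-Reasoning

  -- Recursion by fuel: `k` bounds the depth. A step at `n` that reads only smaller arguments never
  -- meets the default value 0 when the fuel exceeds `n`.
  unroll : (ℕ → (ℕ → ℕ) → ℕ) → ℕ → ℕ → ℕ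
  unroll step zero n = 0
  unroll step (suc k) n = step n (unroll step k)

  courseOfValues : (ℕ → (ℕ → ℕ) → ℕ) → ℕ → ℕ
  courseOfValues step n = unroll step (suc n) n

  module _ (step : ℕ → (ℕ → ℕ) → ℕ)
           (ext : (n : ℕ) {f g : ℕ → ℕ} → ((i : ℕ) → i < n → f i ≡ g i) → step n f ≡ step n g) where

    unroll-stable : ∀ k l n → n < k → n < l → unroll step k n ≡ unroll step l n
    unroll-stable (suc k) (suc l) n (s≤s n≤k) (s≤s n≤l) =
      ext n λ i i<n → unroll-stable k l i (≤-trans i<n n≤k) (≤-trans i<n n≤l)

    courseOfValues-unfold : ∀ n → courseOfValues step n ≡ step n (courseOfValues step)
    courseOfValues-unfold n = ext n λ i i<n → unroll-stable n (suc i) i i<n ≤-refl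

  -- Σ₂ F m sums F i j over i + j + 1 = m.
  Σ₂ : (ℕ → ℕ → ℕ) → ℕ → ℕ
  Σ₂ F zero = 0
  Σ₂ F (suc m) = F 0 m + Σ₂ (F ∘ suc) m

  conv : (ℕ → ℕ) → (ℕ → ℕ) → ℕ → ℕ
  conv f g = Σ₂ λ i j → f i * g j

  Σ₂-cong : ∀ {F G} m → (∀ i j → suc (i + j) ≡ m → F i j ≡ G i j) → Σ₂ F m ≡ Σ₂ G m
  Σ₂-cong zero h = refl
  Σ₂-cong (suc m) h = cong₂ _+_ (h 0 m refl) (Σ₂-cong m λ i j e → h (suc i) j (cong suc e))

  Σ₂-+ : ∀ F G m → Σ₂ (λ i j → F i j + G i j) m ≡ Σ₂ F m + Σ₂ G m
  Σ₂-+ F G zero = refl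
  Σ₂-+ F G (suc m) = trans (cong (F 0 m + G 0 m +_) (Σ₂-+ (F ∘ suc) (G ∘ suc) m))
    (solve 4 (λ a b c d → (a :+ b) :+ (c :+ d) := (a :+ c) :+ (b :+ d)) refl (F 0 m) (G 0 m) (Σ₂ (F ∘ suc) m) (Σ₂ (G ∘ suc) m))

  Σ₂-* : ∀ c F m → Σ₂ (λ i j → c * F i j) m ≡ c * Σ₂ F m
  Σ₂-* c F zero = sym (*-zeroʳ c)
  Σ₂-* c F (suc m) = trans (cong (c * F 0 m +_) (Σ₂-* c (F ∘ suc) m)) (sym (*-distribˡ-+ c _ _))

  Σ₂-split : ∀ {H} F G m → (∀ i j → H i j ≡ F i j + G i j) → Σ₂ H m ≡ Σ₂ F m + Σ₂ G m
  Σ₂-split F G m h = trans (Σ₂-cong m λ i j _ → h i j) (Σ₂-+ F G m)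

  Σ₂-scale : ∀ {H} c F m → (∀ i j → H i j ≡ c * F i j) → Σ₂ H m ≡ c * Σ₂ F m
  Σ₂-scale c F m h = trans (Σ₂-cong m λ i j _ → h i j) (Σ₂-* c F m)

  Σ₂-last : ∀ F m → Σ₂ F (suc m) ≡ Σ₂ (λ i j → F i (suc j)) m + F m 0
  Σ₂-last F zero = +-identityʳ (F 0 0)
  Σ₂-last F (suc m) = trans (cong (F 0 (suc m) +_) (Σ₂-last (F ∘ suc) m)) (sym (+-assoc (F 0 (suc m)) _ _))

  Σ₂-flip : ∀ F m → Σ₂ F m ≡ Σ₂ (λ i j → F j i) m
  Σ₂-flip F zero = refl
  Σ₂-flip F (suc m) = trans (cong (F 0 m +_) (Σ₂-flip (F ∘ suc) m))
    (trans (+-comm (F 0 m) _) (sym (Σ₂-last (λ i j → F j i) m)))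

  -- Both sides sum over a + b + j + 2 = m. Since `G` may depend on `b` and `j` jointly, this lets a
  -- convolution in the size of one face be summed over the size of the other.
  Σ₂-assoc : ∀ (f : ℕ → ℕ) G m → Σ₂ (λ i j → Σ₂ (λ a b → f a * G b j) i) m ≡ Σ₂ (λ a l → f a * Σ₂ G l) m
  Σ₂-assoc f G zero = refl
  Σ₂-assoc f G (suc m) = begin
    Σ₂ (λ i j → f 0 * G i j + Σ₂ (λ a b → f (suc a) * G b j) i) m
      ≡⟨ Σ₂-+ _ _ m ⟩
    Σ₂ (λ i j → f 0 * G i j) m + Σ₂ (λ i j → Σ₂ (λ a b → f (suc a) * G b j) i) m
      ≡⟨ cong₂ _+_ (Σ₂-* (f 0) G m) (Σ₂-assoc (f ∘ suc) G m) ⟩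
    f 0 * Σ₂ G m + Σ₂ (λ a l → f (suc a) * Σ₂ G l) m ∎

  conv-congʳ : ∀ f {g h} m → (∀ i → i < m → g i ≡ h i) → conv f g m ≡ conv f h m
  conv-congʳ f m e = Σ₂-cong m λ { i j refl → cong (f i *_) (e j (s≤s (m≤n+m j i))) }

  conv-congˡ : ∀ {f g} h m → (∀ i → i < m → f i ≡ g i) → conv f h m ≡ conv g h m
  conv-congˡ h m e = Σ₂-cong m λ { i j refl → cong (_* h j) (e i (s≤s (m≤m+n i j))) }

  conv-comm : ∀ f g m → conv f g m ≡ conv g f m
  conv-comm f g m = trans (Σ₂-flip (λ i j → f i * g j) m) (Σ₂-cong m λ i j _ → *-comm (f j) (g i))

  -- In every term i + j + 1 = m, so the weights i, j and 1 add up to m. This is the product rule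
  -- for generating functions.
  conv-weighted : ∀ f g m → conv (λ i → i * f i) g m + conv f (λ j → j * g j) m + conv f g m ≡ m * conv f g m
  conv-weighted f g zero = refl
  conv-weighted f g (suc m) = begin
    conv (λ i → f (suc i) + i * f (suc i)) g m + (f 0 * (m * g m) + conv f′ (λ j → j * g j) m) + (f 0 * g m + conv f′ g m)
      ≡⟨ cong (λ k → k + (f 0 * (m * g m) + conv f′ (λ j → j * g j) m) + (f 0 * g m + conv f′ g m))
           (Σ₂-split (λ i j → f′ i * g j) (λ i j → (i * f′ i) * g j) m λ i j → *-distribʳ-+ (g j) (f (suc i)) (i * f (suc i))) ⟩
    (conv f′ g m + conv (λ i → i * f′ i) g m) + (f 0 * (m * g m) + conv f′ (λ j → j * g j) m) + (f 0 * g m + conv f′ g m)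
      ≡⟨ solve 6 (λ s w w′ a m b → (s :+ w) :+ (a :* (m :* b) :+ w′) :+ (a :* b :+ s)
            := (a :* b :+ m :* (a :* b) :+ s) :+ (w :+ w′ :+ s)) refl (conv f′ g m) (conv (λ i → i * f′ i) g m)
                (conv f′ (λ j → j * g j) m) (f 0) m (g m) ⟩
    (f 0 * g m + m * (f 0 * g m) + conv f′ g m) + (conv (λ i → i * f′ i) g m + conv f′ (λ j → j * g j) m + conv f′ g m)
      ≡⟨ cong (f 0 * g m + m * (f 0 * g m) + conv f′ g m +_) (conv-weighted f′ g m) ⟩
    (f 0 * g m + m * (f 0 * g m) + conv f′ g m) + m * conv f′ g m
      ≡⟨ solve 3 (λ p m s → p :+ m :* p :+ s :+ m :* s := p :+ s :+ m :* (p :+ s)) refl (f 0 * g m) m (conv f′ g m) ⟩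
    suc m * (f 0 * g m + conv f′ g m) ∎
    where f′ = f ∘ suc

  -- The number of noncrossing matchings of m points, hence zero for odd m.
  catalan-step : ℕ → (ℕ → ℕ) → ℕ
  catalan-step zero r = 1
  catalan-step (suc m) r = conv r r m

  catalan : ℕ → ℕ
  catalan = courseOfValues catalan-step

  catalan-suc : ∀ m → catalan (suc m) ≡ conv catalan catalan m
  catalan-suc m = courseOfValues-unfold catalan-step ext (suc m)
    where
    ext : ∀ n {f g} → (∀ i → i < n → f i ≡ g i) → catalan-step n f ≡ catalan-step n g
    ext zero e = refl
    ext (suc n) {f} {g} e = trans (conv-congˡ f n (λ i i<n → e i (m<n⇒m<1+n i<n))) (conv-congʳ g n (λ i i<n → e i (m<n⇒m<1+n i<n)))

  -- For a second face with n sides, `k` is κ(n) and `e` is n - 1, so `m + e` sides are left when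
  -- the first of `suc m` sides is glued across. Otherwise the first side meets its own face, and
  -- the second face may lie on either side of that chord, whence the two convolutions.
  annularCount-step : ℕ → ℕ → ℕ → (ℕ → ℕ) → ℕ
  annularCount-step k e zero r = 0
  annularCount-step k e (suc m) r = k * catalan (m + e) + (conv catalan r m + conv catalan r m)

  annularCount : ℕ → ℕ → ℕ → ℕ
  annularCount k e = courseOfValues (annularCount-step k e)

  annularCount-suc : ∀ k e m → annularCount k e (suc m) ≡ k * catalan (m + e) +
      (conv catalan (annularCount k e) m + conv catalan (annularCount k e) m)
  annularCount-suc k e m = courseOfValues-unfold (annularCount-step k e) ext (suc m)
    where
    ext : ∀ n {f g} → (∀ i → i < n → f i ≡ g i) → annularCount-step k e n f ≡ annularCount-step k e n g
    ext zero h = refl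
    ext (suc n) h = cong (λ s → k * catalan (n + e) + (s + s)) (conv-congʳ catalan n (λ i i<n → h i (m<n⇒m<1+n i<n)))

  catalan-weighted : ∀ M → 2 * conv (λ i → i * catalan i) catalan M + conv catalan catalan M ≡ M * conv catalan catalan M
  catalan-weighted M = trans (cong (_+ conv catalan catalan M)
      (trans (cong (conv (λ i → i * catalan i) catalan M +_) (+-identityʳ _))
      (cong (conv (λ i → i * catalan i) catalan M +_) (conv-comm (λ i → i * catalan i) catalan M))))
    (conv-weighted catalan catalan M)

  private
    -- By symmetry of the convolution the factor `k + 6` is distributed as weights `2 + i` on one
    -- factor. The induction hypothesis lowers the weighted factor by two sides, and
    -- `catalan-weighted` collects the weights again.
    catalan-rec-step : ∀ k → (∀ i → i < 2 + k → (i + 4) * catalan (2 + i) ≡ 4 * (suc i * catalan i)) →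
                 (k + 6) * catalan (4 + k) ≡ 4 * ((3 + k) * catalan (2 + k))
    catalan-rec-step k ih = begin
      (k + 6) * catalan (4 + k)
        ≡⟨ cong ((k + 6) *_) (catalan-suc (3 + k)) ⟩
      (k + 6) * s
        ≡⟨ solve 2 (λ k s → (k :+ con 6) :* s := (con 3 :+ k) :* s :+ con 3 :* s) refl k s ⟩
      (3 + k) * s + 3 * s
        ≡⟨ cong (_+ 3 * s) (sym (catalan-weighted (3 + k))) ⟩
      2 * conv (λ i → i * catalan i) catalan (3 + k) + s + 3 * s
        ≡⟨ solve 2 (λ w s → con 2 :* w :+ s :+ con 3 :* s := con 2 :* (w :+ con 2 :* s)) refl
            (conv (λ i → i * catalan i) catalan (3 + k)) s ⟩
      2 * (conv (λ i → i * catalan i) catalan (3 + k) + 2 * s)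
        ≡⟨ cong (2 *_) (sym h-split) ⟩
      2 * conv h catalan (3 + k)
        -- `h` is 2 at 0 and 0 at 1, which leaves the separate term `2 * catalan (2 + k)`; from 2 on
        -- the induction hypothesis applies.
        ≡⟨ cong (λ t → 2 * (2 * catalan (2 + k) + t)) (conv-congˡ catalan (suc k) (λ i i<k →
             trans (cong (_* catalan (2 + i)) (+-comm 4 i)) (ih i (m<n⇒m<1+n i<k)))) ⟩
      2 * (2 * catalan (2 + k) + conv (λ i → 4 * (suc i * catalan i)) catalan (suc k))
        ≡⟨ cong (λ t → 2 * (2 * catalan (2 + k) + t))
            (Σ₂-scale 4 (λ i j → (catalan i + i * catalan i) * catalan j) (suc k) λ i j → *-assoc 4
                (suc i * catalan i) (catalan j)) ⟩
      2 * (2 * catalan (2 + k) + 4 * conv (λ i → catalan i + i * catalan i) catalan (suc k))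
        ≡⟨ cong (λ t → 2 * (2 * catalan (2 + k) + 4 * t))
            (Σ₂-split (λ i j → catalan i * catalan j) (λ i j → (i * catalan i) * catalan j)
                (suc k) λ i j → *-distribʳ-+ (catalan j) (catalan i) (i * catalan i)) ⟩
      2 * (2 * catalan (2 + k) + 4 * (s′ + w))
        ≡⟨ cong (λ t → 2 * (2 * t + 4 * (s′ + w))) (catalan-suc (suc k)) ⟩
      2 * (2 * s′ + 4 * (s′ + w))
        ≡⟨ solve 2 (λ s w → con 2 :* (con 2 :* s :+ con 4 :* (s :+ w)) := con 4 :* (con 2 :* w :+ s :+ con 2 :* s)) refl s′ w ⟩
      4 * (2 * w + s′ + 2 * s′)
        ≡⟨ cong (λ t → 4 * (t + 2 * s′)) (catalan-weighted (suc k)) ⟩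
      4 * (suc k * s′ + 2 * s′)
        ≡⟨ solve 2 (λ k s → con 4 :* ((con 1 :+ k) :* s :+ con 2 :* s) := con 4 :* ((con 3 :+ k) :* s)) refl k s′ ⟩
      4 * ((3 + k) * s′)
        ≡⟨ cong (λ t → 4 * ((3 + k) * t)) (sym (catalan-suc (suc k))) ⟩
      4 * ((3 + k) * catalan (2 + k)) ∎
      where
      s = conv catalan catalan (3 + k)
      s′ = conv catalan catalan (suc k)
      w = conv (λ i → i * catalan i) catalan (suc k)
      h : ℕ → ℕ
      h i = (2 + i) * catalan i
      h-split : conv h catalan (3 + k) ≡ conv (λ i → i * catalan i) catalan (3 + k) + 2 * s
      h-split = trans (Σ₂-split (λ i j → (i * catalan i) * catalan j) (λ i j → 2 * (catalan i * catalan j))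
          (3 + k) λ i j → solve 3 (λ i a b → ((con 2 :+ i) :* a) :* b := (i :* a) :* b :+ con 2 :* (a :* b)) refl i
              (catalan i) (catalan j))
        (cong (conv (λ i → i * catalan i) catalan (3 + k) +_) (Σ₂-* 2 (λ i j → catalan i * catalan j) (3 + k)))

  -- With m = 2n this is (n + 2) c(n + 1) = 2 (2n + 1) c(n) for the ordinary Catalan numbers c.
  -- Stepping by two, it covers odd arguments as well.
  catalan-rec : ∀ m → (m + 4) * catalan (2 + m) ≡ 4 * (suc m * catalan m)
  catalan-rec = <-rec _ λ where
    zero ih → refl
    (suc zero) ih → refl
    (suc (suc k)) ih → trans (cong (_* catalan (4 + k)) (solve 1 (λ k → con 2 :+ k :+ con 4 := k :+ con 6) refl k))
        (catalan-rec-step k λ i i<k → ih i<k)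

  -- The following sequences are indexed by the number of sides and vanish at odd arguments.
  pow : ℕ → ℕ
  pow 0 = 1
  pow 1 = 0
  pow (suc (suc n)) = 4 * pow n

  -- The guessed solution, with generating function z²/(1 - 4z²)²; `pow` has 1/(1 - 4z²), hence the
  -- recursion.
  gluings : ℕ → ℕ
  gluings 0 = 0
  gluings 1 = 0
  gluings (suc (suc n)) = 4 * gluings n + pow n

  conv-last₂ : ∀ f g m → conv f g (2 + m) ≡ conv f (λ j → g (2 + j)) m + f m * g 1 + f (suc m) * g 0
  conv-last₂ f g m = trans (Σ₂-last (λ i j → f i * g j) (suc m)) (cong (_+ f (suc m) * g 0) (Σ₂-last (λ i j → f i * g (suc j)) m))

  -- The shifted argument `suc n` makes these ordinary Cauchy products over i + j = n. `convPow` is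
  -- needed because the recursion of `gluings` produces it.
  convPow convGluings : ℕ → ℕ
  convPow n = conv catalan pow (suc n)
  convGluings n = conv catalan gluings (suc n)

  convPow-rec : ∀ n → convPow (2 + n) ≡ 4 * convPow n + catalan (2 + n)
  convPow-rec n = begin
    convPow (2 + n)
      ≡⟨ conv-last₂ catalan pow (suc n) ⟩
    conv catalan (λ j → 4 * pow j) (suc n) + catalan (suc n) * 0 + catalan (2 + n) * 1
      ≡⟨ cong (λ t → t + catalan (suc n) * 0 + catalan (2 + n) * 1) (Σ₂-scale 4 (λ i j → catalan i * pow j) (suc n) λ i j →
           solve 2 (λ a b → a :* (con 4 :* b) := con 4 :* (a :* b)) refl (catalan i) (pow j)) ⟩
    4 * convPow n + catalan (suc n) * 0 + catalan (2 + n) * 1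
      ≡⟨ solve 3 (λ a b c → con 4 :* a :+ b :* con 0 :+ c :* con 1 := con 4 :* a :+ c) refl (convPow n)
          (catalan (suc n)) (catalan (2 + n)) ⟩
    4 * convPow n + catalan (2 + n) ∎

  convGluings-rec : ∀ n → convGluings (2 + n) ≡ 4 * convGluings n + convPow n
  convGluings-rec n = begin
    convGluings (2 + n)
      ≡⟨ conv-last₂ catalan gluings (suc n) ⟩
    conv catalan (λ j → 4 * gluings j + pow j) (suc n) + catalan (suc n) * 0 + catalan (2 + n) * 0
      ≡⟨ cong (λ t → t + catalan (suc n) * 0 + catalan (2 + n) * 0)
          (trans (Σ₂-split (λ i j → 4 * (catalan i * gluings j)) (λ i j → catalan i * pow j) (suc n) λ i j →
           solve 3 (λ a b c → a :* (con 4 :* b :+ c) := con 4 :* (a :* b) :+ a :* c) refl (catalan i) (gluings j) (pow j))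
           (cong (_+ convPow n) (Σ₂-* 4 (λ i j → catalan i * gluings j) (suc n)))) ⟩
    4 * convGluings n + convPow n + catalan (suc n) * 0 + catalan (2 + n) * 0
      ≡⟨ solve 3 (λ a b c → a :+ b :* con 0 :+ c :* con 0 := a) refl (4 * convGluings n + convPow n) (catalan (suc n))
          (catalan (2 + n)) ⟩
    4 * convGluings n + convPow n ∎

  -- At even n, `(n + 4) * catalan (2 + n)` is twice a central binomial coefficient; it stands on
  -- the left to avoid a subtraction. By `catalan-rec` either side is multiplied by 4 when n grows
  -- by 2.
  convPow-closed : ∀ n → 4 * convPow n + (n + 4) * catalan (2 + n) ≡ 8 * pow n
  convPow-closed 0 = refl
  convPow-closed 1 = refl
  convPow-closed (suc (suc n)) = begin
    4 * convPow (2 + n) + (2 + n + 4) * catalan (4 + n)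
      ≡⟨ cong₂ _+_ (cong (4 *_) (convPow-rec n)) (catalan-rec (2 + n)) ⟩
    4 * (4 * convPow n + c) + 4 * ((3 + n) * c)
      ≡⟨ solve 3 (λ y c n → con 4 :* (con 4 :* y :+ c) :+ con 4 :* ((con 3 :+ n) :* c) := con 4 :*
          (con 4 :* y :+ (n :+ con 4) :* c)) refl (convPow n) c n ⟩
    4 * (4 * convPow n + (n + 4) * c)
      ≡⟨ cong (4 *_) (convPow-closed n) ⟩
    4 * (8 * pow n)
      ≡⟨ solve 1 (λ p → con 4 :* (con 8 :* p) := con 8 :* (con 4 :* p)) refl (pow n) ⟩
    8 * pow (2 + n) ∎
    where c = catalan (2 + n)

  -- The same induction in steps of two; the extra `convPow n` of the recursion is absorbed by
  -- `convPow-closed`, and its `8 * pow n` raises the factor `n + 2` to `n + 4`.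
  convGluings-closed : ∀ n → 4 * convGluings n + (n + 2) * (suc n * catalan n) ≡ (n + 2) * pow n
  convGluings-closed 0 = refl
  convGluings-closed 1 = refl
  convGluings-closed (suc (suc n)) = begin
    4 * convGluings (2 + n) + (2 + n + 2) * ((3 + n) * c)
      ≡⟨ cong (λ t → 4 * t + (2 + n + 2) * ((3 + n) * c)) (convGluings-rec n) ⟩
    4 * (4 * convGluings n + convPow n) + (2 + n + 2) * ((3 + n) * c)
      ≡⟨ solve 4 (λ z y n c → con 4 :* (con 4 :* z :+ y) :+ (con 2 :+ n :+ con 2) :* ((con 3 :+ n) :* c)
           := (con 4 :* (con 4 :* z) :+ (n :+ con 2) :* ((n :+ con 4) :* c)) :+
               (con 4 :* y :+ (n :+ con 4) :* c)) refl (convGluings n) (convPow n) n c ⟩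
    (4 * (4 * convGluings n) + (n + 2) * ((n + 4) * c)) + (4 * convPow n + (n + 4) * c)
      ≡⟨ cong₂ _+_ (cong (λ t → 4 * (4 * convGluings n) + (n + 2) * t) (catalan-rec n)) (convPow-closed n) ⟩
    (4 * (4 * convGluings n) + (n + 2) * (4 * (suc n * catalan n))) + 8 * pow n
      ≡⟨ solve 4 (λ z n c p → con 4 :* (con 4 :* z) :+ (n :+ con 2) :* (con 4 :* c) :+ con 8 :* p
           := con 4 :* (con 4 :* z :+ (n :+ con 2) :* c) :+ con 8 :* p) refl (convGluings n) n (suc n * catalan n) (pow n) ⟩
    4 * (4 * convGluings n + (n + 2) * (suc n * catalan n)) + 8 * pow n
      ≡⟨ cong (λ t → 4 * t + 8 * pow n) (convGluings-closed n) ⟩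
    4 * ((n + 2) * pow n) + 8 * pow n
      ≡⟨ solve 2 (λ n p → con 4 :* ((n :+ con 2) :* p) :+ con 8 :* p := (con 2 :+ n :+ con 2) :* (con 4 :* p)) refl n (pow n) ⟩
    (2 + n + 2) * pow (2 + n) ∎
    where c = catalan (2 + n)

  gluings-closed : ∀ n → 2 * gluings (2 + n) ≡ (n + 2) * pow n
  gluings-closed 0 = refl
  gluings-closed 1 = refl
  gluings-closed (suc (suc n)) = begin
    2 * (4 * gluings (2 + n) + 4 * pow n)
      ≡⟨ solve 2 (λ u p → con 2 :* (con 4 :* u :+ con 4 :* p) := con 4 :* (con 2 :* u) :+ con 8 :* p) refl
          (gluings (2 + n)) (pow n) ⟩
    4 * (2 * gluings (2 + n)) + 8 * pow n
      ≡⟨ cong (λ t → 4 * t + 8 * pow n) (gluings-closed n) ⟩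
    4 * ((n + 2) * pow n) + 8 * pow n
      ≡⟨ solve 2 (λ n p → con 4 :* ((n :+ con 2) :* p) :+ con 8 :* p := (con 2 :+ n :+ con 2) :* (con 4 :* p)) refl n (pow n) ⟩
    (2 + n + 2) * pow (2 + n) ∎

  -- This is twice the recursion `T-rec` for κ = `id`, where `K (suc n)` is (n + 1)(n + 2)/2;
  -- doubling avoids the division.
  gluings-rec : ∀ n → 2 * gluings (2 + n) ≡ 4 * convGluings n + (n + 2) * (suc n * catalan n)
  gluings-rec n = trans (gluings-closed n) (sym (convGluings-closed n))

  gluings-even : ∀ N → gluings (2 * N) ≡ N * 4 ^ (N ∸ 1)
  gluings-even zero = refl
  gluings-even (suc N) = trans (cong gluings (*-suc 2 N)) (*-cancelˡ-≡ _ _ 2 (trans (gluings-closed (2 * N))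
    (trans (cong₂ (λ a b → a * b) (solve 1 (λ n → con 2 :* n :+ con 2 := con 2 :* (con 1 :+ n)) refl N) (pow-even N))
        (*-assoc 2 (suc N) (4 ^ N)))))
    where
    pow-even : ∀ N → pow (2 * N) ≡ 4 ^ N
    pow-even zero = refl
    pow-even (suc N) = trans (cong pow (*-suc 2 N)) (cong (4 *_) (pow-even N))

  -- κ j is the number of sides of a j-gon to which the first side of the other face may be glued.
  module Total (κ : ℕ → ℕ) where

    -- The faces have `b` and `suc j` sides, so the shift in `Σ₂` makes the argument of `T` the
    -- total number of sides. The term `b = 0` vanishes.
    G : ℕ → ℕ → ℕ
    G b j = annularCount (κ (suc j)) j b

    T : ℕ → ℕ
    T = Σ₂ G

    K : ℕ → ℕ
    K = Σ₂ (λ i j → κ (suc j))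

    -- The Catalan number depends on the total alone, so the factors κ add up to `K` separately. The
    -- convolutions involve only the first face and pass through the sum over the second by
    -- `Σ₂-assoc`.
    T-rec : ∀ n → T (2 + n) ≡ K (suc n) * catalan n + (conv catalan T (suc n) + conv catalan T (suc n))
    T-rec n = begin
      Σ₂ (G ∘ suc) (suc n)
        ≡⟨ Σ₂-cong (suc n) (λ i j e → trans (annularCount-suc (κ (suc j)) j i)
            (cong (λ t → κ (suc j) * catalan t + (conv catalan (λ b → G b j) i + conv catalan (λ b → G b j) i))
                (suc-injective e))) ⟩
      Σ₂ (λ i j → κ (suc j) * catalan n + (conv catalan (λ b → G b j) i + conv catalan (λ b → G b j) i)) (suc n)
        ≡⟨ Σ₂-+ (λ i j → κ (suc j) * catalan n) (λ i j → conv catalan (λ b → G b j) i + conv catalan (λ b → G b j) i) (suc n) ⟩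
      Σ₂ (λ i j → κ (suc j) * catalan n) (suc n) + Σ₂
          (λ i j → conv catalan (λ b → G b j) i + conv catalan (λ b → G b j) i) (suc n)
        ≡⟨ cong₂ _+_ (trans (Σ₂-scale (catalan n) (λ i j → κ (suc j)) (suc n) λ i j → *-comm (κ (suc j)) (catalan n))
            (*-comm (catalan n) (K (suc n))))
             (trans (Σ₂-+ (λ i j → conv catalan (λ b → G b j) i) (λ i j → conv catalan (λ b → G b j) i) (suc n))
                 (cong₂ _+_ (Σ₂-assoc catalan G (suc n)) (Σ₂-assoc catalan G (suc n)))) ⟩
      K (suc n) * catalan n + (conv catalan T (suc n) + conv catalan T (suc n)) ∎

    T-unique : (v : ℕ → ℕ) → v 0 ≡ 0 → v 1 ≡ 0 →
      (∀ n → v (2 + n) ≡ K (suc n) * catalan n + (conv catalan v (suc n) + conv catalan v (suc n))) → ∀ n → T n ≡ v n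
    T-unique v v0 v1 v-rec = <-rec _ λ where
      zero ih → sym v0
      (suc zero) ih → sym v1
      (suc (suc n)) ih → trans (T-rec n) (trans (cong (λ t → K (suc n) * catalan n + (t + t))
        (conv-congʳ catalan (suc n) (λ i i<n → ih (m<n⇒m<1+n i<n)))) (sym (v-rec n)))

  T-id : ∀ n → Total.T id n ≡ gluings n
  T-id = T-unique gluings refl refl λ n → *-cancelˡ-≡ _ _ 2 (trans (gluings-rec n) (trans
      (cong (4 * convGluings n +_) (trans (sym (*-assoc (n + 2) (suc n) (catalan n))) (cong (_* catalan n) (sym (2K n)))))
      (solve 3 (λ z k c → con 4 :* z :+ (con 2 :* k) :* c := con 2 :* (k :* c :+ (z :+ z))) refl (convGluings n)
          (K (suc n)) (catalan n))))
    where
    open Total id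
    -- For κ = `id` the sum `K (suc n)` is 1 + 2 + ... + (n + 1).
    2K : ∀ n → 2 * K (suc n) ≡ (n + 2) * suc n
    2K zero = refl
    2K (suc n) = trans (*-distribˡ-+ 2 (2 + n) (K (suc n))) (trans (cong (2 * (2 + n) +_) (2K n))
      (solve 1 (λ n → con 2 :* (con 2 :+ n) :+ (n :+ con 2) :* (con 1 :+ n) := (con 1 :+ n :+ con 2) :* (con 2 :+ n)) refl n))

  evenIndicator : ℕ → ℕ
  evenIndicator 0 = 1
  evenIndicator 1 = 0
  evenIndicator (suc (suc n)) = evenIndicator n

  -- n/2 at even n, but 0 at odd n, where the sides of a face cannot alternate in colour. Adding the
  -- indicator instead of 1 keeps the odd values at 0.
  half : ℕ → ℕ
  half 0 = 0
  half 1 = 0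
  half (suc (suc n)) = evenIndicator n + half n

  even⊎odd : ∀ n → ∃ λ k → n ≡ 2 * k ⊎ n ≡ suc (2 * k)
  even⊎odd zero = 0 , inj₁ refl
  even⊎odd (suc n) with even⊎odd n
  ... | k , inj₁ e = k , inj₂ (cong suc e)
  ... | k , inj₂ e = suc k , inj₁ (trans (cong suc e) (sym (*-suc 2 k)))

  catalan-odd : ∀ k → catalan (suc (2 * k)) ≡ 0
  catalan-odd zero = refl
  catalan-odd (suc k) = trans (cong (catalan ∘ suc) (*-suc 2 k))
      (m*n≡0⇒m≡0 _ (suc (2 * k) + 4) (trans (*-comm _ (suc (2 * k) + 4))
    (trans (catalan-rec (suc (2 * k)))
        (trans (cong (λ t → 4 * (suc (suc (2 * k)) * t)) (catalan-odd k))
            (trans (cong (4 *_) (*-zeroʳ (suc (suc (2 * k))))) refl)))))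

  even-2* : ∀ k → evenIndicator (2 * k) ≡ 1
  even-2* zero = refl
  even-2* (suc k) = trans (cong evenIndicator (*-suc 2 k)) (even-2* k)
  even-odd : ∀ k → evenIndicator (suc (2 * k)) ≡ 0
  even-odd zero = refl
  even-odd (suc k) = trans (cong (evenIndicator ∘ suc) (*-suc 2 k)) (even-odd k)
  half-2* : ∀ k → half (2 * k) ≡ k
  half-2* zero = refl
  half-2* (suc k) = trans (cong half (*-suc 2 k)) (cong₂ _+_ (even-2* k) (half-2* k))
  half-odd : ∀ k → half (suc (2 * k)) ≡ 0
  half-odd zero = refl
  half-odd (suc k) = trans (cong (half ∘ suc) (*-suc 2 k)) (cong₂ _+_ (even-odd k) (half-odd k))

  conv-zero : ∀ f m → conv f (λ _ → 0) m ≡ 0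
  conv-zero f m = Σ₂-scale 0 (λ i j → f i) m λ i j → *-comm (f i) 0

  annularCount-zero : ∀ e m → annularCount 0 e m ≡ 0
  annularCount-zero e = <-rec _ λ where
    zero ih → refl
    (suc m) ih → trans (annularCount-suc 0 e m) (cong (λ t → t + t)
      (trans (conv-congʳ catalan m λ i i<m → ih (m<n⇒m<1+n i<m)) (conv-zero catalan m)))

  -- The shift by two sides is the shift by one edge between the two counts. The shifted sequence
  -- `v` starts with two zeros, so its convolution is `convGluings`, and `key` matches the remaining
  -- terms.
  T-half : ∀ n → Total.T half (2 + n) ≡ gluings n
  T-half n = T-unique v refl refl v-rec (2 + n)
    where
    open Total half
    v : ℕ → ℕ
    v 0 = 0
    v 1 = 0
    v (suc (suc n)) = gluings n
    2K : ∀ k → 2 * K (suc (2 * k)) ≡ k * suc k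
    2K zero = refl
    2K (suc k) = trans (cong (λ t → 2 * K (suc t)) (*-suc 2 k)) (begin
      2 * (half (3 + 2 * k) + (half (2 + 2 * k) + K (suc (2 * k))))
        ≡⟨ cong₂ (λ a b → 2 * (a + (b + K (suc (2 * k))))) (cong₂ _+_ (even-odd k) (half-odd k))
            (cong₂ _+_ (even-2* k) (half-2* k)) ⟩
      2 * (suc k + K (suc (2 * k)))
        ≡⟨ *-distribˡ-+ 2 (suc k) _ ⟩
      2 * suc k + 2 * K (suc (2 * k))
        ≡⟨ cong (2 * suc k +_) (2K k) ⟩
      2 * suc k + k * suc k
        ≡⟨ solve 1 (λ k → con 2 :* (con 1 :+ k) :+ k :* (con 1 :+ k) := (con 1 :+ k) :* (con 2 :+ k)) refl k ⟩
      suc k * suc (suc k) ∎)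
    -- For n = 2k the left sum is `K (3 + n)` = (k + 1)(k + 2)/2, and `catalan-rec` trades its
    -- factor k + 2 for the step from `catalan (2 + n)` down to `catalan n`. For odd n both sides
    -- vanish.
    key : ∀ n → 2 * (K (3 + n) * catalan (2 + n)) ≡ (n + 2) * (suc n * catalan n)
    key n with even⊎odd n
    ... | k , inj₂ refl = trans (cong (λ t → 2 * (K (3 + suc (2 * k)) * t))
        (trans (cong (catalan ∘ suc) (sym (*-suc 2 k))) (catalan-odd (suc k))))
      (trans (cong (2 *_) (*-zeroʳ (K (3 + suc (2 * k)))))
          (sym (trans (cong (λ t → (suc (2 * k) + 2) * (suc (suc (2 * k)) * t)) (catalan-odd k))
        (trans (cong ((suc (2 * k) + 2) *_) (*-zeroʳ (suc (suc (2 * k))))) (*-zeroʳ (suc (2 * k) + 2))))))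
    ... | k , inj₁ refl = *-cancelˡ-≡ _ _ 2 (begin
      2 * (2 * (K (3 + 2 * k) * c))
        ≡⟨ solve 2 (λ a c → con 2 :* (con 2 :* (a :* c)) := con 2 :* ((con 2 :* a) :* c)) refl (K (3 + 2 * k)) c ⟩
      2 * ((2 * K (3 + 2 * k)) * c)
        ≡⟨ cong (λ t → 2 * (t * c)) (trans (cong (λ t → 2 * K (suc t)) (sym (*-suc 2 k))) (2K (suc k))) ⟩
      2 * ((suc k * suc (suc k)) * c)
        ≡⟨ solve 2 (λ k c → con 2 :* (((con 1 :+ k) :* (con 2 :+ k)) :* c) := (con 1 :+ k) :*
            ((con 2 :* k :+ con 4) :* c)) refl k c ⟩
      suc k * ((2 * k + 4) * c)
        ≡⟨ cong (suc k *_) (catalan-rec (2 * k)) ⟩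
      suc k * (4 * (suc (2 * k) * catalan (2 * k)))
        ≡⟨ solve 2 (λ k d → (con 1 :+ k) :* (con 4 :* d) := con 2 :* ((con 2 :* k :+ con 2) :* d)) refl k
            (suc (2 * k) * catalan (2 * k)) ⟩
      2 * ((2 * k + 2) * (suc (2 * k) * catalan (2 * k))) ∎)
      where c = catalan (2 + 2 * k)
    v-rec : ∀ n → v (2 + n) ≡ K (suc n) * catalan n + (conv catalan v (suc n) + conv catalan v (suc n))
    v-rec 0 = refl
    v-rec 1 = refl
    v-rec (suc (suc n)) = *-cancelˡ-≡ _ _ 2 (begin
      2 * gluings (2 + n)
        ≡⟨ gluings-rec n ⟩
      4 * convGluings n + (n + 2) * (suc n * catalan n)
        ≡⟨ cong (4 * convGluings n +_) (sym (key n)) ⟩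
      4 * convGluings n + 2 * (K (3 + n) * catalan (2 + n))
        ≡⟨ cong (λ t → 4 * t + 2 * (K (3 + n) * catalan (2 + n))) (sym Sv) ⟩
      4 * t + 2 * (K (3 + n) * catalan (2 + n))
        ≡⟨ solve 2 (λ t k → con 4 :* t :+ con 2 :* k := con 2 :* (k :+ (t :+ t))) refl t (K (3 + n) * catalan (2 + n)) ⟩
      2 * (K (3 + n) * catalan (2 + n) + (t + t)) ∎)
      where
      t = conv catalan v (3 + n)
      Sv : t ≡ convGluings n
      Sv = trans (conv-last₂ catalan v (suc n))
        (solve 3 (λ a b c → a :+ b :* con 0 :+ c :* con 0 := a) refl (convGluings n) (catalan (suc n)) (catalan (2 + n)))

open Counting

-- Planar gluings of two faces

sumSplits-length : (F : ℕ → ℕ → ℕ) (xs : List A) → sumSplits (λ us _ vs → F (length us) (length vs)) xs ≡ Σ₂ F (length xs)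
sumSplits-length F [] = refl
sumSplits-length F (x ∷ xs) = cong (F 0 (length xs) +_) (sumSplits-length (F ∘ suc) xs)

split-++ : (xs : List A) {ys us vs : List A} {b : A} → xs ++ ys ≡ us ++ b ∷ vs →
           (∃ λ w → xs ≡ us ++ b ∷ w × vs ≡ w ++ ys) ⊎ (∃ λ w → us ≡ xs ++ w × ys ≡ w ++ b ∷ vs)
split-++ [] {us = us} e = inj₂ (us , refl , e)
split-++ (x ∷ xs) {us = []} refl = inj₁ (xs , refl , refl)
split-++ (x ∷ xs) {us = u ∷ us} e with split-++ xs {us = us} (∷-injectiveʳ e)
... | inj₁ (w , e₁ , e₂) = inj₁ (w , cong₂ _∷_ (∷-injectiveˡ e) e₁ , e₂)
... | inj₂ (w , e₁ , e₂) = inj₂ (w , cong₂ _∷_ (sym (∷-injectiveˡ e)) e₁ , e₂)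

private
  regroup₁ : {X : Set} (p q r s w a b : List X) → (q ++ ((s ++ r) ++ b ++ w)) ++ p ≡ (q ++ (s ++ r)) ++ b ++ (w ++ p)
  regroup₁ {X} p q r s w a b = MonoidSolver.solve (++-monoid X)

  regroup₂ : {X : Set} (p q r s w a b : List X) →
    p ++ a ++ (q ++ ((s ++ r) ++ b ++ w)) ≡ (p ++ a ++ q) ++ (s ++ (r ++ b ++ w))
  regroup₂ {X} p q r s w a b = MonoidSolver.solve (++-monoid X)

  regroup₃ : {X : Set} (p q s w v a b : List X) → (q ++ ((w ++ b ++ s) ++ v)) ++ p ≡ (q ++ w) ++ b ++ ((s ++ v) ++ p)
  regroup₃ {X} p q s w v a b = MonoidSolver.solve (++-monoid X)

  regroup₄ : {X : Set} (p q s w v a b : List X) →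
    p ++ a ++ (q ++ ((w ++ b ++ s) ++ v)) ≡ (p ++ a ++ q) ++ ((w ++ b ++ s) ++ v)
  regroup₄ {X} p q s w v a b = MonoidSolver.solve (++-monoid X)

-- Connected planar gluings of two faces: after cutting along one edge a–b between the faces,
-- the remaining sides are matched without crossings around the merged face.
record Annular (ok : A → A → Set) (xs ys : List A) (ι : A → A) : Set where
  constructor annular
  field
    {p q r s} : List A
    {a b}     : A
    xs≡       : xs ≡ p ++ a ∷ q
    ys≡       : ys ≡ r ++ b ∷ s
    ιa        : ι a ≡ b
    ιb        : ι b ≡ a
    ok-ab     : ok a b
    nc        : NC ι ((q ++ p) ++ (s ++ r))

FirstAcross : (A → A → Set) → A → List A → List A → A → List A → (A → A) → Set
FirstAcross ok x xs r b s ι = ok x b × ι x ≡ b × ι b ≡ x × NC ι (xs ++ (s ++ r))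

-- The chord from `x` to `b` cuts the first face into `us` and `vs`. All edges to the other face
-- leave from one of the two; the other is matched within itself.
FirstInside : (A → A → Set) → A → List A → List A → A → List A → (A → A) → Set
FirstInside ok x ys us b vs ι = (ι x ≡ b × ι b ≡ x × NC ι us × Annular ok vs ys ι)
                              ⊎ (ι x ≡ b × ι b ≡ x × NC ι vs × Annular ok us ys ι)

module _ {ok : A → A → Set} {x : A} {xs ys : List A} {ι : A → A} where

  -- The words below are equal up to a rotation.
  annular⁺ : Split (FirstAcross ok x xs) ys ι ⊎ Split (FirstInside ok x ys) xs ι → Annular ok (x ∷ xs) ys ι
  annular⁺ (inj₁ (r , b , s , e , o , ιx , ιb , nc)) =
    annular {p = []} refl e ιx ιb o (subst (λ zs → NC ι (zs ++ (s ++ r))) (sym (++-identityʳ xs)) nc)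
  annular⁺ (inj₂ (us , b , vs , refl , inj₁ (ιx , ιb , nc , annular {p} {q} {r} {s} {a} {c} refl ys≡ ιa ιc o nc′))) =
    annular {p = x ∷ us ++ b ∷ p} {q = q} (cong (x ∷_) (sym (++-assoc us (b ∷ p) (a ∷ q)))) ys≡ ιa ιc o
      (subst (NC ι) e₂ (NC-rotate (x ∷ us ++ b ∷ (p ++ t))
        (arc e₁ ιx ιb nc (NC-rotate q (subst (NC ι) (++-assoc q p t) nc′)))))
    where
    t = s ++ r
    e₁ : (us ++ b ∷ (p ++ t)) ++ q ≡ us ++ b ∷ ((p ++ t) ++ q)
    e₁ = ++-assoc us (b ∷ (p ++ t)) q
    e₂ : q ++ (x ∷ us ++ b ∷ (p ++ t)) ≡ (q ++ (x ∷ us ++ b ∷ p)) ++ t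
    e₂ = trans (cong (λ zs → q ++ x ∷ zs) (sym (++-assoc us (b ∷ p) t))) (sym (++-assoc q (x ∷ us ++ b ∷ p) t))
  annular⁺ (inj₂ (us , b , vs , refl , inj₂ (ιx , ιb , nc , annular {p} {q} {r} {s} {a} {c} refl ys≡ ιa ιc o nc′))) =
    annular {p = x ∷ p} {q = q ++ b ∷ vs} (cong (x ∷_) (++-assoc p (a ∷ q) (b ∷ vs))) ys≡ ιa ιc o
      (subst (NC ι) e₂ (NC-rotate (x ∷ p ++ t)
        (arc e₁ ιx ιb (NC-rotate q (subst (NC ι) (++-assoc q p t) nc′)) nc)))
    where
    t = s ++ r
    e₁ : (p ++ t) ++ (q ++ b ∷ vs) ≡ ((p ++ t) ++ q) ++ b ∷ vs
    e₁ = sym (++-assoc (p ++ t) q (b ∷ vs))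
    e₂ : (q ++ b ∷ vs) ++ (x ∷ p ++ t) ≡ ((q ++ b ∷ vs) ++ x ∷ p) ++ t
    e₂ = sym (++-assoc (q ++ b ∷ vs) (x ∷ p) t)

  -- After rotation the merged word reads `x`, `p`, `s`, `r`, `q`. A partner of `x` in `p` or `q` is
  -- a chord of the first face; one in `s` or `r` lies in the second face, and `x` takes over as an
  -- end of the cutting edge.
  annular⁻ : (ι x ∈ ys → ok x (ι x)) → Annular ok (x ∷ xs) ys ι →
             Split (FirstAcross ok x xs) ys ι ⊎ Split (FirstInside ok x ys) xs ι
  annular⁻ h (annular {p = []} {q} {r} {s} refl refl ιa ιb o nc) =
    inj₁ (r , _ , s , refl , o , ιa , ιb , subst (λ zs → NC ι (zs ++ (s ++ r))) (++-identityʳ q) nc)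
  annular⁻ h (annular {p = _ ∷ p} {q} {r} {s} {a} {b} refl refl ιa ιb o nc)
    with NC-rotate q (subst (NC ι) (++-assoc q (x ∷ p) (s ++ r)) nc)
  ... | arc {us = us} {c} {vs} e ιx ιc nc₁ nc₂ with split-++ (p ++ (s ++ r)) {us = us} e
  ... | inj₂ (w , refl , refl) = inj₂ (p ++ a ∷ w , c , vs , sym (++-assoc p (a ∷ w) (c ∷ vs))
      , inj₂ (ιx , ιc , nc₂ , annular {p = p} {q = w} refl refl ιa ιb o
          (subst (NC ι) (sym (++-assoc w p (s ++ r))) (NC-rotate (p ++ (s ++ r)) nc₁))))
  ... | inj₁ (w , e′ , refl) with split-++ p {us = us} e′
  ... | inj₁ (w′ , refl , refl) = inj₂ (us , c , w′ ++ a ∷ q , ++-assoc us (c ∷ w′) (a ∷ q)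
      , inj₁ (ιx , ιc , nc₁ , annular {p = w′} {q = q} refl refl ιa ιb o
          (subst (NC ι) (sym (++-assoc q w′ (s ++ r))) (NC-rotate (w′ ++ (s ++ r)) nc₂))))
  ... | inj₂ (w′ , refl , e″) with split-++ s {us = w′} e″
  ... | inj₁ (s′ , refl , refl) = inj₁ (r ++ b ∷ w′ , c , s′ , ys≡
      , subst (ok x) ιx (h (subst (_∈ r ++ b ∷ w′ ++ c ∷ s′) (sym ιx) (∈-++⁺ʳ r (there (∈-insert w′))))) , ιx , ιc
      -- The cutting edges are exchanged: `a` and `b` return to the word as an arc, and the two
      -- pieces into which the old arc at `x` divided the word become, rotated, its inside and its
      -- outside.
      , subst (NC ι) e₂ (NC-rotate (a ∷ (q ++ ((s′ ++ r) ++ b ∷ w′)))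
          (arc e₁ ιa ιb (NC-rotate (s′ ++ r) nc₂) (NC-rotate p nc₁))))
    where
    ys≡ : r ++ b ∷ (w′ ++ c ∷ s′) ≡ (r ++ b ∷ w′) ++ c ∷ s′
    ys≡ = sym (++-assoc r (b ∷ w′) (c ∷ s′))
    e₁ : (q ++ ((s′ ++ r) ++ [ b ] ++ w′)) ++ p ≡ (q ++ (s′ ++ r)) ++ [ b ] ++ (w′ ++ p)
    e₁ = regroup₁ p q r s′ w′ [ a ] [ b ]
    e₂ : p ++ [ a ] ++ (q ++ ((s′ ++ r) ++ [ b ] ++ w′)) ≡ (p ++ [ a ] ++ q) ++ (s′ ++ (r ++ [ b ] ++ w′))
    e₂ = regroup₂ p q r s′ w′ [ a ] [ b ]
  ... | inj₂ (w″ , refl , refl) = inj₁ (w″ , c , w ++ b ∷ s , ys≡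
      , subst (ok x) ιx (h (subst (_∈ (w″ ++ c ∷ w) ++ b ∷ s) (sym ιx) (∈-++⁺ˡ (∈-insert w″)))) , ιx , ιc
      , subst (NC ι) e₂ (NC-rotate (a ∷ (q ++ ((w ++ b ∷ s) ++ w″)))
          (arc e₁ ιa ιb (NC-rotate w nc₂) (NC-rotate p nc₁))))
    where
    ys≡ : (w″ ++ c ∷ w) ++ b ∷ s ≡ w″ ++ c ∷ (w ++ b ∷ s)
    ys≡ = ++-assoc w″ (c ∷ w) (b ∷ s)
    e₁ : (q ++ ((w ++ [ b ] ++ s) ++ w″)) ++ p ≡ (q ++ w) ++ [ b ] ++ ((s ++ w″) ++ p)
    e₁ = regroup₃ p q s w w″ [ a ] [ b ]
    e₂ : p ++ [ a ] ++ (q ++ ((w ++ [ b ] ++ s) ++ w″)) ≡ (p ++ [ a ] ++ q) ++ ((w ++ [ b ] ++ s) ++ w″)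
    e₂ = regroup₄ p q s w w″ [ a ] [ b ]

-- What the recursion needs from a colouring. `Adm` is an invariant of the pair of words, and
-- `weight` says that κ counts the sides of the second face to which a given side may be glued. The
-- shrinking laws receive the matching of the part cut off, since it controls the colours at the
-- seam.
record Colouring {M : ℕ} (ok : Fin M → Fin M → Set) (κ : ℕ → ℕ) : Set₁ where
  field
    ok?     : ∀ a b → Dec (ok a b)
    Adm     : List (Fin M) → List (Fin M) → Set
    across  : ∀ {xs ys ι x} → Adm xs ys → Annular ok xs ys ι → x ∈ xs → ι x ∈ ys → ok x (ι x)
    shrinkʳ : ∀ {x us b vs ys ι} → Adm (x ∷ us ++ b ∷ vs) ys → NC ι us → Adm vs ys
    shrinkˡ : ∀ {x us b vs ys ι} → Adm (x ∷ us ++ b ∷ vs) ys → NC ι vs → Adm us ys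
    weight  : ∀ {x xs ys} → Adm (x ∷ xs) ys → ∀ K →
              sumSplits (λ _ b _ → if does (ok? x b) then K else 0) ys ≡ κ (length ys) * K

NC-local : {xs : List (Fin M)} → Local xs (λ ι → NC ι xs)
NC-local = record { localised = NC-cong ; stable = NC-closed }

⊤-local : Local {M} [] (λ _ → ⊤)
⊤-local = record { localised = λ _ _ → tt ; stable = λ _ () }

Annular-local : {ok : Fin M → Fin M → Set} {xs ys : List (Fin M)} → Local (xs ++ ys) (Annular ok xs ys)
Annular-local {xs = xs} {ys} = record { localised = loc ; stable = st }
  where
  loc : ∀ {f g} → (∀ {y} → y ∈ xs ++ ys → f y ≡ g y) → Annular _ xs ys f → Annular _ xs ys g
  loc h (annular {p} {q} {r} {s} {a} {b} refl refl ιa ιb o nc) = annular {p = p} {q} {r} {s} refl refl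
    (trans (sym (h (back (here refl)))) ιa) (trans (sym (h (back (there (here refl))))) ιb) o
    (NC-cong (h ∘ back ∘ there ∘ there) nc)
    where
    back : ∀ {y} → y ∈ a ∷ b ∷ (q ++ p) ++ (s ++ r) → y ∈ (p ++ a ∷ q) ++ (r ++ b ∷ s)
    back = ∈-resp-↭ (↭-sym (cut-↭ p r))
  st : ∀ {f y} → Annular _ xs ys f → y ∈ xs ++ ys → f y ∈ xs ++ ys
  st {f} {y} (annular {p} {q} {r} {s} {a} {b} refl refl ιa ιb o nc) i = ∈-resp-↭ (↭-sym (cut-↭ p r)) (go (∈-resp-↭ (cut-↭ p r) i))
    where
    go : y ∈ a ∷ b ∷ (q ++ p) ++ (s ++ r) → f y ∈ a ∷ b ∷ (q ++ p) ++ (s ++ r)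
    go (here refl) = there (here ιa)
    go (there (here refl)) = here ιb
    go (there (there j)) = there (there (NC-closed nc j))

card-On-[] : HasCard (On {M} [] (λ _ → ⊤)) 1
card-On-[] = card-⇔ (λ v → mk⇔ (λ { refl → tt , λ y _ → lookup∘tabulate id y })
  (λ (_ , out) → table-≡ (λ y → trans (out y λ ()) (sym (lookup∘tabulate id y))))) (card-singleton (tabulate id))

NC⇔Split : {x : A} {xs : List A} {ι : A → A} →
           NC ι (x ∷ xs) ⇔ Split (λ us b vs ι → ι x ≡ b × ι b ≡ x × NC ι us × NC ι vs) xs ι
NC⇔Split = mk⇔ (λ { (arc {us = us} {b} {vs} e ιx ιb p q) → us , b , vs , e , ιx , ιb , p , q })
               (λ { (us , b , vs , e , ιx , ιb , p , q) → arc e ιx ιb p q })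

On-Split : {D : List (Fin M)} (Q : List A → A → List A → (Fin M → Fin M) → Set) {xs : List A} →
           ∀ v → On D (Split Q xs) v ⇔ Split (λ us b vs → On D (Q us b vs)) xs v
On-Split Q v = mk⇔ (λ { ((us , b , vs , e , q) , out) → us , b , vs , e , q , out })
                 (λ { (us , b , vs , e , q , out) → (us , b , vs , e , q) , out })

On-⊎ : {D : List (Fin M)} (P Q : (Fin M → Fin M) → Set) →
       ∀ v → On D (λ f → P f ⊎ Q f) v ⇔ (On D P v ⊎ On D Q v)
On-⊎ P Q v = mk⇔ (λ { (inj₁ p , out) → inj₁ (p , out) ; (inj₂ q , out) → inj₂ (q , out) })
             (λ { (inj₁ (p , out)) → inj₁ p , out ; (inj₂ (q , out)) → inj₂ q , out })

-- The partner of the first letter splits the word into two independent ones, the Catalan recursion.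
-- The bound `k` serves the termination, as the parts of a split are not subterms.
card-NC : ∀ k (xs : List (Fin M)) → length xs ≤ k → Unique xs → HasCard (On xs (λ ι → NC ι xs)) (catalan (length xs))
card-NC k [] le u = card-⇔ (On-⇔ (λ _ → ⊤) (λ ι → NC ι []) λ f → mk⇔ (λ _ → []) (λ _ → tt)) card-On-[]
card-NC (suc k) (x ∷ xs) (ℕ.s≤s le) u = subst (HasCard (On (x ∷ xs) (λ ι → NC ι (x ∷ xs))))
  (trans (sumSplits-length (λ i j → catalan i * catalan j) xs) (sym (catalan-suc (length xs))))
  (card-⇔ (λ v → mk⇔ (λ q → let q′ , out = from (On-Split Pieces v) q in from NC⇔Split q′ , out)
                      (λ (p , out) → to (On-Split Pieces v) (to NC⇔Split p , out)))
    (card-splits xs (λ v → lookup v x) (proj₁ ∘ proj₁) (AllPairs.tail u) piece))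
  where
  Pieces : List (Fin _) → Fin _ → List (Fin _) → (Fin _ → Fin _) → Set
  Pieces us b vs f = f x ≡ b × f b ≡ x × NC f us × NC f vs
  piece : ∀ us b vs → xs ≡ us ++ b ∷ vs →
          HasCard (On (x ∷ xs) (Pieces us b vs)) (catalan (length us) * catalan (length vs))
  piece us b vs refl = card-glue (prep x (shift b us vs)) u NC-local NC-local
    (card-NC k us (ℕ.≤-trans (ℕ.m≤m+n _ _) len) (proj₁ uu))
    (λ _ → card-NC k vs (ℕ.≤-trans (ℕ.≤-trans (ℕ.n≤1+n _) (ℕ.m≤n+m _ (length us))) len) (AllPairs.tail (proj₁ (proj₂ uu))))
    where
    len : length us + suc (length vs) ≤ k
    len = subst (_≤ k) (length-++ us) le
    uu = unique-++⁻ us (AllPairs.tail u)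

module _ {ok : Fin M → Fin M → Set} {κ : ℕ → ℕ} (colouring : Colouring ok κ) where
  open Colouring colouring

  -- Tutte's recursion on the partner of the first side. Only `xs` gets shorter, so `ys` enters
  -- through its length alone.
  card-Annular : ∀ k (xs ys : List (Fin M)) → length xs ≤ k → Unique (xs ++ ys) → Adm xs ys →
    HasCard (On (xs ++ ys) (Annular ok xs ys)) (annularCount (κ (length ys)) (pred (length ys)) (length xs))
  card-Annular k [] ys le u adm = card-∅ λ { v (annular {p = []} () _ _ _ _ _ , _) ; v (annular {p = _ ∷ _} () _ _ _ _ _ , _) }
  card-Annular (suc k) (x ∷ xs) ys (ℕ.s≤s le) u adm = subst (HasCard (On D (Annular ok (x ∷ xs) ys))) count
    (card-⇔ recursion (card-⊎ disjoint
      (card-splits ys (λ v → lookup v x) (proj₁ ∘ proj₂ ∘ proj₁) (proj₁ (proj₂ (unique-++⁻ (x ∷ xs) u))) across-piece)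
      (card-splits xs (λ v → lookup v x)
          (λ {_} {_} {_} {v} → inside-key {v = v}) (AllPairs.tail (proj₁ (unique-++⁻ (x ∷ xs) u))) inside-piece)))
    where
    D : List (Fin M)
    D = x ∷ xs ++ ys
    Q₁ Q₂ : List (Fin M) → Fin M → List (Fin M) → (Fin M → Fin M) → Set
    Q₁ = FirstAcross ok x xs
    Q₂ = FirstInside ok x ys
    a : ℕ → ℕ
    a = annularCount (κ (length ys)) (pred (length ys))
    -- The factor 1 counts the empty second piece, since `card-glue` always glues two.
    K : ℕ
    K = catalan (length xs + pred (length ys)) * 1
    inside-key : ∀ {us b vs v} → On D (FirstInside ok x ys us b vs) v → lookup v x ≡ b
    inside-key (inj₁ (e , _) , _) = e
    inside-key (inj₂ (e , _) , _) = e
    recursion : ∀ v → (Split (λ r b s → On D (FirstAcross ok x xs r b s)) ys v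
                       ⊎ Split (λ us b vs → On D (FirstInside ok x ys us b vs)) xs v) ⇔ On D (Annular ok (x ∷ xs) ys) v
    recursion v = mk⇔
      (λ { (inj₁ q) → let q′ , out = from (On-Split Q₁ v) q in annular⁺ (inj₁ q′) , out
         ; (inj₂ q) → let q′ , out = from (On-Split Q₂ v) q in annular⁺ (inj₂ q′) , out })
      (λ (n , out) → case annular⁻ (across adm n (here refl)) n of λ
         { (inj₁ q) → inj₁ (to (On-Split Q₁ v) (q , out)) ; (inj₂ q) → inj₂ (to (On-Split Q₂ v) (q , out)) })
    disjoint : ∀ v → Split (λ r b s → On D (FirstAcross ok x xs r b s)) ys v
                   → ¬ Split (λ us b vs → On D (FirstInside ok x ys us b vs)) xs v
    disjoint v (r , b , s , refl , (_ , e , _) , _) (us , c , vs , refl , q) =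
      proj₂ (proj₂ (unique-++⁻ (x ∷ us ++ c ∷ vs) u)) (there (∈-insert us))
        (subst (_∈ r ++ b ∷ s) (trans (sym e) (inside-key {v = v} q)) (∈-insert r))
    count : sumSplits (λ _ b _ → if does (ok? x b) then K else 0) ys
            + sumSplits (λ us _ vs → catalan (length us) * a (length vs) + catalan (length vs) * a (length us)) xs
            ≡ a (suc (length xs))
    count = trans (cong₂ _+_ (trans (weight adm K) (cong (κ (length ys) *_) (ℕ.*-identityʳ _)))
        (trans (sumSplits-length (λ i j → catalan i * a j + catalan j * a i) xs)
        (trans (Σ₂-split (λ i j → catalan i * a j) (λ i j → a i * catalan j) (length xs)
            (λ i j → cong (catalan i * a j +_) (ℕ.*-comm (catalan j) (a i))))
          (cong (conv catalan a (length xs) +_) (conv-comm a catalan (length xs))))))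
      (sym (annularCount-suc (κ (length ys)) (pred (length ys)) (length xs)))
    across-piece : ∀ r b s → ys ≡ r ++ b ∷ s →
      HasCard (On D (FirstAcross ok x xs r b s)) (if does (ok? x b) then K else 0)
    across-piece r b s refl with ok? x b
    ... | no ¬o = card-∅ λ v q → ¬o (proj₁ (proj₁ q))
    ... | yes o = subst (λ l → HasCard (On D (FirstAcross ok x xs r b s)) (catalan l * 1)) len
      (card-⇔ (On-⇔ (λ f → f x ≡ b × f b ≡ x × NC f (xs ++ (s ++ r)) × ⊤) (Q₁ r b s) λ f → mk⇔
          (λ (e , e′ , n , _) → o , e , e′ , n) (λ (_ , e , e′ , n) → e , e′ , n , tt))
        (card-glue perm u NC-local ⊤-local
          (card-NC _ (xs ++ (s ++ r)) ℕ.≤-refl uniq) (λ _ → card-On-[])))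
      where
      perm : D ↭ x ∷ b ∷ (xs ++ (s ++ r)) ++ []
      perm = prep x (↭-trans (++⁺ˡ xs (++-comm r (b ∷ s))) (↭-trans (shift b xs (s ++ r))
        (↭-reflexive (cong (b ∷_) (sym (++-identityʳ (xs ++ (s ++ r))))))))
      uniq : Unique (xs ++ (s ++ r))
      uniq = subst Unique (++-identityʳ (xs ++ (s ++ r))) (AllPairs.tail (AllPairs.tail (unique-resp-↭ perm u)))
      len : length (xs ++ (s ++ r)) ≡ length xs + pred (length (r ++ b ∷ s))
      len = trans (length-++ xs) (cong (length xs +_) (cong pred (length-++-comm (b ∷ s) r)))
    inside-piece : ∀ us b vs → xs ≡ us ++ b ∷ vs → HasCard (On D (FirstInside ok x ys us b vs))
      (catalan (length us) * a (length vs) + catalan (length vs) * a (length us))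
    inside-piece us b vs refl = card-⇔ (λ v → let e = On-⊎ {D = D} L R v in mk⇔ (from e) (to e)) (card-⊎ apart
      (card-glue (prep x perm₁) u NC-local Annular-local (card-NC k us us≤ (proj₁ u₁))
        (λ (_ , nc , _) → card-Annular k vs ys vs≤ (proj₁ (proj₂ u₁)) (shrinkʳ adm nc)))
      (card-glue (prep x perm₂) u NC-local Annular-local (card-NC k vs vs≤ (proj₁ u₂))
        (λ (_ , nc , _) → card-Annular k us ys us≤ (proj₁ (proj₂ u₂)) (shrinkˡ adm nc))))
      where
      L R : (Fin M → Fin M) → Set
      L f = f x ≡ b × f b ≡ x × NC f us × Annular ok vs ys f
      R f = f x ≡ b × f b ≡ x × NC f vs × Annular ok us ys f
      len : length us + suc (length vs) ≤ k
      len = subst (_≤ k) (length-++ us) le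
      us≤ : length us ≤ k
      us≤ = ℕ.≤-trans (ℕ.m≤m+n _ _) len
      vs≤ : length vs ≤ k
      vs≤ = ℕ.≤-trans (ℕ.≤-trans (ℕ.n≤1+n _) (ℕ.m≤n+m _ (length us))) len
      perm₁ : (us ++ b ∷ vs) ++ ys ↭ b ∷ us ++ (vs ++ ys)
      perm₁ = ↭-trans (↭-reflexive (++-assoc us (b ∷ vs) ys)) (shift b us (vs ++ ys))
      perm₂ : (us ++ b ∷ vs) ++ ys ↭ b ∷ vs ++ (us ++ ys)
      perm₂ = ↭-trans perm₁ (prep b (shifts us vs))
      u₁ = unique-++⁻ us (AllPairs.tail (unique-resp-↭ perm₁ (AllPairs.tail u)))
      u₂ = unique-++⁻ vs (AllPairs.tail (unique-resp-↭ perm₂ (AllPairs.tail u)))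
      -- On one side the cutting edge leads from `vs` to `ys`; on the other a matching of `vs`
      -- within itself would keep its end in `vs`.
      apart : ∀ v → On D L v → ¬ On D R v
      apart v ((_ , _ , _ , annular {p} {r = r} refl refl ιa _ _ _) , _) ((_ , _ , nc , _) , _) =
        proj₂ (proj₂ (unique-++⁻ (p ++ _) (proj₁ (proj₂ u₁))))
          (NC-closed nc (∈-insert p)) (subst (_∈ r ++ _) (sym ιa) (∈-insert r))

-- Colourings

length-splits : (K : ℕ) (xs : List A) → sumSplits (λ _ _ _ → K) xs ≡ length xs * K
length-splits K [] = refl
length-splits K (x ∷ xs) = cong (K +_) (length-splits K xs)

unrestricted : Colouring {M} (λ _ _ → ⊤) id
unrestricted = record
  { ok? = λ _ _ → yes tt ; Adm = λ _ _ → ⊤ ; across = λ _ _ _ _ → tt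
  ; shrinkʳ = λ _ _ → tt ; shrinkˡ = λ _ _ → tt ; weight = λ {_} {_} {ys} _ K → length-splits K ys }

module _ {M : ℕ} (colour : Fin M → Bool) where

  Opposite : Fin M → Fin M → Set
  Opposite a b = colour b ≡ not (colour a)

  opposite-sym : ∀ {a b} → Opposite a b → Opposite b a
  opposite-sym e = sym (trans (cong not e) (not-involutive _))

  -- The colours alternate; c is the first one and d is the one that would come next.
  data Alternating : Bool → Bool → List (Fin M) → Set where
    []  : ∀ {c} → Alternating c c []
    _∷_ : ∀ {c d x xs} → colour x ≡ c → Alternating (not c) d xs → Alternating c d (x ∷ xs)

  alt-++ : ∀ {c d e xs ys} → Alternating c d xs → Alternating d e ys → Alternating c e (xs ++ ys)
  alt-++ [] q = q
  alt-++ (e ∷ p) q = e ∷ alt-++ p q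

  alt-split : ∀ {c e} xs {ys} → Alternating c e (xs ++ ys) → ∃ λ d → Alternating c d xs × Alternating d e ys
  alt-split [] p = _ , [] , p
  alt-split (x ∷ xs) (e ∷ p) = let d , q , r = alt-split xs p in d , e ∷ q , r

  alt-next : ∀ {c c′ d xs} → c ≡ c′ → Alternating c d xs → Alternating c′ d xs
  alt-next refl p = p

  -- By induction the word enclosed by an arc ends with the colour phase with which it began, so the
  -- closing letter has the colour opposite to the opening one.
  NC-opposite : ∀ {ι c d xs} → NC ι xs → Alternating c d xs → d ≡ c × (∀ {y} → y ∈ xs → Opposite y (ι y))
  NC-opposite [] [] = refl , λ ()
  NC-opposite {ι} {c} (arc {x} {us} {b} {vs} refl ιx ιb p q) (cx ∷ alt) with alt-split us alt
  ... | d , alt-us , cb ∷ alt-vs with NC-opposite p alt-us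
  ... | refl , opp-us with NC-opposite q alt-vs
  ... | e , opp-vs = trans e (not-involutive c) , opp
    where
    xb : Opposite x b
    xb = trans cb (cong not (sym cx))
    opp : ∀ {y} → y ∈ x ∷ us ++ b ∷ vs → Opposite y (ι y)
    opp (here refl) = subst (Opposite x) (sym ιx) xb
    opp (there i) with ∈-++⁻ us i
    ... | inj₁ j = opp-us j
    ... | inj₂ (here refl) = subst (Opposite b) (sym ιb) (opposite-sym xb)
    ... | inj₂ (there j) = opp-vs j

  Balanced : List (Fin M) → List (Fin M) → Set
  Balanced xs ys = ∃₂ λ c d → Alternating c c xs × Alternating d d ys

  -- If the cutting edge joins opposite colours, then the merged word alternates across both seams,
  -- and `NC-opposite` settles all other edges. One condition on one edge thus controls the whole
  -- gluing.
  annular-opposite : ∀ {ι xs ys} → Balanced xs ys → Annular Opposite xs ys ι → ∀ {y} → y ∈ xs ++ ys → Opposite y (ι y)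
  annular-opposite {ι} (c , d , alt-xs , alt-ys) (annular {p} {q} {r} {s} {a} {b} refl refl ιa ιb o nc) {y} i
    with alt-split p alt-xs | alt-split r alt-ys
  ... | e , alt-p , refl ∷ alt-q | f , alt-r , refl ∷ alt-s = opp (∈-resp-↭ (cut-↭ p r) i)
    where
    merged : Alternating (not (colour a)) (colour b) ((q ++ p) ++ (s ++ r))
    merged = alt-++ (alt-++ alt-q alt-p) (alt-++ (alt-next (sym (opposite-sym o)) alt-s) alt-r)
    opp : y ∈ a ∷ b ∷ (q ++ p) ++ (s ++ r) → Opposite y (ι y)
    opp (here refl) = subst (Opposite a) (sym ιa) o
    opp (there (here refl)) = subst (Opposite b) (sym ιb) (opposite-sym o)
    opp (there (there j)) = proj₂ (NC-opposite nc merged) j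

  private
    -- Of two consecutive sides exactly one has the colour opposite to `x`. The evenness of the
    -- length is carried along because `half` grows by `evenIndicator`.
    weighted : ∀ x {d ys} → Alternating d d ys → ∀ K →
      sumSplits (λ _ b _ → if does (colour b Bool.≟ not (colour x)) then K else 0) ys ≡ half (length ys) * K
      × evenIndicator (length ys) ≡ 1
    weighted x [] K = refl , refl
    weighted x {d} {y ∷ []} (e ∷ alt) K with d | alt
    ... | true | ()
    ... | false | ()
    weighted x {d} {y ∷ y′ ∷ ys} (e ∷ e′ ∷ alt) K with weighted x (alt-next (not-involutive d) alt) K
    ... | ih , ev = trans (trans (cong₂ (λ s t → s + (t + rest)) (cong (λ c → test c (colour x)) e)
        (cong (λ c → test c (colour x)) e′)) (pair d (colour x))) (trans (cong (K +_) ih)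
          (cong (λ t → (t + half (length ys)) * K) (sym ev))) , ev
      where
      rest = sumSplits (λ _ b _ → if does (colour b Bool.≟ not (colour x)) then K else 0) ys
      test : Bool → Bool → ℕ
      test c c′ = if does (c Bool.≟ not c′) then K else 0
      pair : ∀ c c′ → test c c′ + (test (not c) c′ + rest) ≡ K + rest
      pair true true = refl
      pair true false = refl
      pair false true = refl
      pair false false = refl

  bicolouring : Colouring Opposite half
  bicolouring = record
    { ok? = λ a b → colour b Bool.≟ not (colour a)
    ; Adm = Balanced
    ; across = λ bal ann i _ → annular-opposite bal ann (∈-++⁺ˡ i)
    ; shrinkʳ = λ { {us = us} (c , d , cx ∷ alt , alt-ys) nc → right us alt nc alt-ys }
    ; shrinkˡ = λ { {us = us} (c , d , cx ∷ alt , alt-ys) nc → left us alt nc alt-ys }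
    ; weight = λ { {x} (c , d , _ , alt-ys) K → proj₁ (weighted x alt-ys K) }
    }
    where
    right : ∀ {c d ι b vs ys} us → Alternating (not c) c (us ++ b ∷ vs) → NC ι us → Alternating d d ys → Balanced vs ys
    right {c} us alt nc alt-ys with alt-split us alt
    ... | e , alt-us , cb ∷ alt-vs with NC-opposite nc alt-us
    ... | refl , _ = c , _ , alt-next (not-involutive c) alt-vs , alt-ys
    left : ∀ {c d ι b vs ys} us → Alternating (not c) c (us ++ b ∷ vs) → NC ι vs → Alternating d d ys → Balanced us ys
    left {c} us alt nc alt-ys with alt-split us alt
    ... | e , alt-us , cb ∷ alt-vs with NC-opposite nc alt-vs
    ... | refl , _ = e , _ , alt-next (not-involutive e) alt-us , alt-ys

-- Positions in the two faces

data Range {M : ℕ} : ℕ → List (Fin M) → Set where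
  []  : ∀ {s} → Range s []
  _∷_ : ∀ {s x xs} → toℕ x ≡ s → Range (suc s) xs → Range s (x ∷ xs)

range-++⁻ : ∀ {s} (xs : List (Fin M)) {ys} → Range s (xs ++ ys) → Range s xs × Range (s + length xs) ys
range-++⁻ {s = s} [] {ys} r = [] , subst (λ t → Range t ys) (sym (ℕ.+-identityʳ s)) r
range-++⁻ {s = s} (x ∷ xs) {ys} (e ∷ r) with range-++⁻ xs r
... | r₁ , r₂ = e ∷ r₁ , subst (λ t → Range t ys) (sym (ℕ.+-suc s (length xs))) r₂

range-tabulate : ∀ {s} (f : Fin n → Fin M) → (∀ i → toℕ (f i) ≡ s + toℕ i) → Range s (List.tabulate f)
range-tabulate {zero} f h = []
range-tabulate {suc n} {s = s} f h = trans (h zero) (ℕ.+-identityʳ s)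
  ∷ range-tabulate (f ∘ suc) (λ i → trans (h (suc i)) (ℕ.+-suc s (toℕ i)))

range-bounds : ∀ {s} {xs : List (Fin M)} {z} → Range s xs → z ∈ xs → s ≤ toℕ z × toℕ z < s + length xs
range-bounds {s = s} (refl ∷ r) (here refl) = ℕ.≤-refl , ℕ.m<m+n s (s≤s z≤n)
range-bounds {s = s} {_ ∷ xs} (e ∷ r) (there i) with range-bounds r i
... | l , u = ℕ.≤-trans (ℕ.n≤1+n s) l , ℕ.<-≤-trans u (ℕ.≤-reflexive (sym (ℕ.+-suc s (length xs))))

-- The behaviour common to `τ` on a block and to `cyc` on the positions of that block. It determines
-- a map on the block, which is how the two are identified.
record Steps (f : Fin M → Fin M) (s e : ℕ) : Set where
  field
    next : ∀ {z} → s ≤ toℕ z → suc (toℕ z) < e → toℕ (f z) ≡ suc (toℕ z)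
    wrap : ∀ {z} → s ≤ toℕ z → suc (toℕ z) ≡ e → toℕ (f z) ≡ s

steps-≡ : ∀ {f g : Fin M → Fin M} {s e z} → Steps f s e → Steps g s e → s ≤ toℕ z → toℕ z < e → f z ≡ g z
steps-≡ {e = e} {z} p q l u with suc (toℕ z) ℕ.≟ e
... | yes eq = toℕ-injective (trans (Steps.wrap p l eq) (sym (Steps.wrap q l eq)))
... | no ne = toℕ-injective (trans (Steps.next p l (ℕ.≤∧≢⇒< u ne)) (sym (Steps.next q l (ℕ.≤∧≢⇒< u ne))))

steps-orbit : ∀ {f : Fin M → Fin M} {s e x z} → Steps f s e → toℕ x ≡ s → s ≤ toℕ z → toℕ z < e → Orbit f x z
steps-orbit {f = f} {s} {e} {x} {z} p ex l u = toℕ z ∸ s ,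
  toℕ-injective (trans (go (toℕ z ∸ s) (subst (_< e) (sym (ℕ.m+[n∸m]≡n l)) u)) (ℕ.m+[n∸m]≡n l))
  where
  go : ∀ k → s + k < e → toℕ (iter f k x) ≡ s + k
  go zero lt = trans ex (sym (ℕ.+-identityʳ s))
  go (suc k) lt = trans (Steps.next p (subst (s ≤_) (sym ih) (ℕ.m≤m+n s k)) (subst (λ t → suc t < e) (sym ih) lt′))
                        (trans (cong suc ih) (sym (ℕ.+-suc s k)))
    where
    lt′ : suc (s + k) < e
    lt′ = subst (_< e) (ℕ.+-suc s k) lt
    ih : toℕ (iter f k x) ≡ s + k
    ih = go k (ℕ.<-trans (ℕ.n<1+n _) lt′)

cyc-steps-∷ : ∀ {s} {x y : Fin M} {zs} → Range s (x ∷ y ∷ zs) → Steps (cyc (y ∷ zs)) (suc s) (suc s + length (y ∷ zs)) →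
              Steps (cyc (x ∷ y ∷ zs)) s (s + length (x ∷ y ∷ zs))
cyc-steps-∷ {s = s} {x} {y} {zs} (ex ∷ ey ∷ r) ih = record { next = nx ; wrap = wr }
  where
  end : s + length (x ∷ y ∷ zs) ≡ suc s + length (y ∷ zs)
  end = ℕ.+-suc s (length (y ∷ zs))
  x∉ : x ∉ y ∷ zs
  x∉ i = ℕ.<-irrefl (sym ex) (proj₁ (range-bounds (ey ∷ r) i))
  nx : ∀ {z} → s ≤ toℕ z → suc (toℕ z) < s + length (x ∷ y ∷ zs) → toℕ (swap x y (cyc (y ∷ zs) z)) ≡ suc (toℕ z)
  nx {z} l u with z ≟ x
  ... | yes refl = trans (cong toℕ (trans (cong (swap z y) (cyc-∉ (y ∷ zs) x∉)) (swapˡ z y))) (trans ey (cong suc (sym ex)))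
  ... | no ne = trans (cong toℕ (swap-other
          (λ e → ℕ.<⇒≢ (ℕ.m<n⇒m<1+n l′) (trans (sym ex) (trans (cong toℕ (sym e)) step)))
          (λ e → ℕ.<⇒≢ (s≤s l′) (trans (sym ey) (trans (cong toℕ (sym e)) step))))) step
    where
    l′ : suc s ≤ toℕ z
    l′ = ℕ.≤∧≢⇒< l (λ e → ne (toℕ-injective (trans (sym e) (sym ex))))
    step : toℕ (cyc (y ∷ zs) z) ≡ suc (toℕ z)
    step = Steps.next ih l′ (ℕ.<-≤-trans u (ℕ.≤-reflexive end))
  wr : ∀ {z} → s ≤ toℕ z → suc (toℕ z) ≡ s + length (x ∷ y ∷ zs) → toℕ (swap x y (cyc (y ∷ zs) z)) ≡ s
  wr {z} l e with ℕ.suc-injective (trans e end)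
  ... | e′ = trans (cong toℕ (trans
      (cong (swap x y) (toℕ-injective (trans (Steps.wrap ih l′ (trans e end)) (sym ey)))) (swapʳ x y))) ex
    where
    l′ : suc s ≤ toℕ z
    l′ = subst (suc s ≤_) (sym (trans e′ (ℕ.+-suc s (length zs)))) (s≤s (ℕ.m≤m+n s (length zs)))

cyc-steps : ∀ {s} {xs : List (Fin M)} → Range s xs → Steps (cyc xs) s (s + length xs)
cyc-steps {s = s} [] = record
  { next = λ l u → contradiction l (ℕ.<⇒≱ (ℕ.<-trans (ℕ.n<1+n _) (ℕ.<-≤-trans u (ℕ.≤-reflexive (ℕ.+-identityʳ s)))))
  ; wrap = λ l e → contradiction l (ℕ.<⇒≱ (ℕ.≤-reflexive (trans e (ℕ.+-identityʳ s)))) }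
cyc-steps {s = s} (e ∷ []) = record
  { next = λ l u → contradiction l (ℕ.<⇒≱ (ℕ.≤-pred (ℕ.<-≤-trans u (ℕ.≤-reflexive (ℕ.+-comm s 1)))))
  ; wrap = λ l e′ → ℕ.suc-injective (trans e′ (ℕ.+-comm s 1)) }
cyc-steps (e ∷ r@(_ ∷ _)) = cyc-steps-∷ (e ∷ r) (cyc-steps r)

NC-matches : {ι : A → A} {xs : List A} {y : A} → Unique xs → NC ι xs → y ∈ xs → ι (ι y) ≡ y × ι y ≢ y
NC-matches {ι = ι} u (arc {x} {us} {b} {vs} refl ιx ιb p q) i = go i
  where
  x≢b : x ≢ b
  x≢b e = unique-head u (∈-insert us) (sym e)
  uu = unique-++⁻ us (AllPairs.tail u)
  go : ∀ {y} → y ∈ x ∷ us ++ b ∷ vs → ι (ι y) ≡ y × ι y ≢ y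
  go (here refl) = trans (cong ι ιx) ιb , λ e → x≢b (trans (sym e) ιx)
  go (there j) with ∈-++⁻ us j
  ... | inj₁ k = NC-matches (proj₁ uu) p k
  ... | inj₂ (here refl) = trans (cong ι ιb) ιx , λ e → x≢b (trans (sym ιb) e)
  ... | inj₂ (there k) = NC-matches (AllPairs.tail (proj₁ (proj₂ uu))) q k

annular-matches : {ok : A → A → Set} {ι : A → A} {xs ys : List A} {y : A} → Unique (xs ++ ys) → Annular ok xs ys ι →
                  y ∈ xs ++ ys → ι (ι y) ≡ y × ι y ≢ y
annular-matches {ι = ι} {y = y} u (annular {p} {q} {r} {s} {a} {b} refl refl ιa ιb o nc) i = go (∈-resp-↭ (cut-↭ p r) i)
  where
  u′ = unique-resp-↭ (cut-↭ p r) u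
  b≢a : b ≢ a
  b≢a = unique-head u′ (here refl)
  go : y ∈ a ∷ b ∷ (q ++ p) ++ (s ++ r) → ι (ι y) ≡ y × ι y ≢ y
  go (here refl) = trans (cong ι ιa) ιb , λ e → b≢a (trans (sym ιa) e)
  go (there (here refl)) = trans (cong ι ιb) ιa , λ e → b≢a (trans (sym e) ιb)
  go (there (there j)) = NC-matches (AllPairs.tail (AllPairs.tail u′)) nc j

annular-map : {ok ok′ : A → A → Set} {ι : A → A} {xs ys : List A} →
              (∀ {a} → a ∈ xs ++ ys → ok a (ι a) → ok′ a (ι a)) → Annular ok xs ys ι → Annular ok′ xs ys ι
annular-map {ok = ok} {ok′} h (annular {p} {q} {r} {s} {a} {b} refl refl ιa ιb o nc) =
  annular {p = p} {q} {r} {s} refl refl ιa ιb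
    (subst (ok′ a) ιa (h (∈-++⁺ˡ (∈-insert p)) (subst (ok a) (sym ιa) o))) nc

<ᵇ-true : ∀ {m n} → m < n → (m <ᵇ n) ≡ true
<ᵇ-true {m} {n} lt = dec-true (m <? n) lt

<ᵇ-false : ∀ {m n} → n ≤ m → (m <ᵇ n) ≡ false
<ᵇ-false {m} {n} le = dec-false (m <? n) (ℕ.≤⇒≯ le)

reach-trans : {ι τ′ : Fin M → Fin M} {x y z : Fin M} → Reach ι τ′ x y → Reach ι τ′ y z → Reach ι τ′ x z
reach-trans r here = r
reach-trans r (stepι s) = stepι (reach-trans r s)
reach-trans r (stepτ s) = stepτ (reach-trans r s)

orbit-reach : {ι τ′ : Fin M → Fin M} {x y : Fin M} → Orbit τ′ x y → Reach ι τ′ x y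
orbit-reach (zero , refl) = here
orbit-reach (suc k , refl) = stepτ (orbit-reach (k , refl))

τℕ-locate : ∀ {K} (ms : Vec ℕ K) {p s e} → locate (toList ms) 0 p ≡ (s , e) → τℕ ms p ≡ (if suc p <ᵇ e then suc p else s)
τℕ-locate ms {p} loc with locate (toList ms) 0 p | loc
... | _ | refl = refl

toℕ-τ : ∀ {K} (ms : Vec ℕ K) (x : Fin M) → τℕ ms (toℕ x) < M → toℕ (τ ms x) ≡ τℕ ms (toℕ x)
toℕ-τ {M} ms x lt with τℕ ms (toℕ x) <? M
... | yes lt′ = toℕ-fromℕ< lt′
... | no ≮ = contradiction lt ≮

-- Gluing data with two faces as pairs of words

module TwoFaces (N i j : ℕ) (sum≡ : suc i + suc j ≡ 2 * N) where

  M₀ : ℕ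
  M₀ = 2 * N

  ms : Vec ℕ 2
  ms = suc i ∷ suc j ∷ []

  face₁ face₂ : List (Fin M₀)
  face₁ = take (suc i) (allFin M₀)
  face₂ = drop (suc i) (allFin M₀)

  faces : face₁ ++ face₂ ≡ allFin M₀
  faces = take++drop≡id (suc i) (allFin M₀)

  length₁ : length face₁ ≡ suc i
  length₁ = trans (length-take (suc i) (allFin M₀)) (ℕ.m≤n⇒m⊓n≡m
    (subst (suc i ≤_) (trans sum≡ (sym (length-tabulate id))) (ℕ.m≤m+n (suc i) (suc j))))

  length₂ : length face₂ ≡ suc j
  length₂ = trans (length-drop (suc i) (allFin M₀))
      (trans (cong (_∸ suc i) (trans (length-tabulate id) (sym sum≡))) (ℕ.m+n∸m≡n (suc i) (suc j)))

  faces-unique : Unique (face₁ ++ face₂)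
  faces-unique = subst Unique (sym faces) (Unique.allFin⁺ M₀)

  everywhere : ∀ y → y ∈ face₁ ++ face₂
  everywhere y = subst (y ∈_) (sym faces) (∈-allFin y)

  disjoint : ∀ {y} → y ∈ face₁ → y ∉ face₂
  disjoint = proj₂ (proj₂ (unique-++⁻ face₁ faces-unique))

  ranges : Range 0 face₁ × Range (length face₁) face₂
  ranges = range-++⁻ face₁ (subst (Range 0) (sym faces) (range-tabulate id λ _ → refl))

  range₁ : Range 0 face₁
  range₁ = proj₁ ranges

  range₂ : Range (suc i) face₂
  range₂ = subst (λ t → Range t face₂) length₁ (proj₂ ranges)

  bounds₁ : ∀ {y} → y ∈ face₁ → toℕ y < suc i
  bounds₁ k = subst (toℕ _ <_) length₁ (proj₂ (range-bounds range₁ k))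

  bounds₂ : ∀ {y} → y ∈ face₂ → suc i ≤ toℕ y × toℕ y < suc i + suc j
  bounds₂ k = let l , u = range-bounds range₂ k in l , subst (λ t → toℕ _ < suc i + t) length₂ u

  steps₁ : Steps (cyc face₁) 0 (suc i)
  steps₁ = subst (Steps (cyc face₁) 0) length₁ (cyc-steps range₁)

  steps₂ : Steps (cyc face₂) (suc i) (suc i + suc j)
  steps₂ = subst (λ t → Steps (cyc face₂) (suc i) (suc i + t)) length₂ (cyc-steps range₂)

  locate₁ : ∀ {p} → p < suc i → locate (toList ms) 0 p ≡ (0 , suc i)
  locate₁ lt rewrite <ᵇ-true lt = refl

  locate₂ : ∀ {p} → suc i ≤ p → p < suc i + suc j → locate (toList ms) 0 p ≡ (suc i , suc i + suc j)
  locate₂ le lt rewrite <ᵇ-false le | <ᵇ-true lt = refl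

  τ-toℕ : ∀ {s e} x → locate (toList ms) 0 (toℕ x) ≡ (s , e) → ∀ {t} → (if suc (toℕ x) <ᵇ e then suc (toℕ x) else s) ≡ t →
          t < M₀ → toℕ (τ ms x) ≡ t
  τ-toℕ x loc eq lt = let τℕ≡ = trans (τℕ-locate ms loc) eq in
    trans (toℕ-τ ms x (subst (_< M₀) (sym τℕ≡) lt)) τℕ≡

  τ-steps : ∀ {s e} → (∀ x → s ≤ toℕ x → toℕ x < e → locate (toList ms) 0 (toℕ x) ≡ (s , e)) → s < e → e ≤ M₀ → Steps (τ ms) s e
  τ-steps {s} {e} loc s<e e≤M = record
    { next = λ {z} l u → τ-toℕ z (loc z l (ℕ.<-trans (ℕ.n<1+n _) u))
        (cong (λ t → if t then suc (toℕ z) else s) (<ᵇ-true u)) (ℕ.<-≤-trans u e≤M)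
    ; wrap = λ {z} l eq → τ-toℕ z (loc z l (ℕ.≤-reflexive eq))
        (cong (λ t → if t then suc (toℕ z) else s) (<ᵇ-false (ℕ.≤-reflexive (sym eq)))) (ℕ.<-≤-trans s<e e≤M) }

  τ-steps₁ : Steps (τ ms) 0 (suc i)
  τ-steps₁ = τ-steps (λ x _ → locate₁) (s≤s z≤n) (ℕ.≤-trans (ℕ.m≤m+n (suc i) (suc j)) (ℕ.≤-reflexive sum≡))

  τ-steps₂ : Steps (τ ms) (suc i) (suc i + suc j)
  τ-steps₂ = τ-steps (λ x → locate₂) (ℕ.m<m+n (suc i) (s≤s z≤n)) (ℕ.≤-reflexive sum≡)

  τ≗cyc : τ ms ≗ cyc face₁ ∘ cyc face₂
  τ≗cyc z with ∈-++⁻ face₁ (everywhere z)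
  ... | inj₁ k = trans (steps-≡ τ-steps₁ steps₁ z≤n (bounds₁ k)) (cong (cyc face₁) (sym (cyc-∉ face₂ (disjoint k))))
  ... | inj₂ k = trans (steps-≡ τ-steps₂ steps₂ (proj₁ (bounds₂ k)) (proj₂ (bounds₂ k)))
    (sym (cyc-∉ face₁ λ k′ → disjoint k′ (cyc-∈ face₂ k)))

  τ-injective : Injective (τ ms)
  τ-injective e = cyc-injective face₂ (cyc-injective face₁ (trans (sym (τ≗cyc _)) (trans e (τ≗cyc _))))

  face-orbit : ∀ {s e y z} → Steps (τ ms) s e → e ≤ M₀ → s ≤ toℕ y → toℕ y < e → s ≤ toℕ z → toℕ z < e → Orbit (τ ms) y z
  face-orbit {s} {e} st e≤M l u l′ u′ =
    let s<M = ℕ.≤-<-trans l (ℕ.<-≤-trans u e≤M) ; x≡ = toℕ-fromℕ< s<M in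
    orbit-trans (orbit-sym τ-injective (steps-orbit st x≡ l u)) (steps-orbit st x≡ l′ u′)

  orbit₁ : ∀ {y z} → y ∈ face₁ → z ∈ face₁ → Orbit (τ ms) y z
  orbit₁ k k′ = face-orbit τ-steps₁ (ℕ.≤-trans (ℕ.m≤m+n (suc i) (suc j)) (ℕ.≤-reflexive sum≡)) z≤n (bounds₁ k) z≤n (bounds₁ k′)

  orbit₂ : ∀ {y z} → y ∈ face₂ → z ∈ face₂ → Orbit (τ ms) y z
  orbit₂ k k′ = face-orbit τ-steps₂ (ℕ.≤-reflexive sum≡) (proj₁ (bounds₂ k)) (proj₂ (bounds₂ k)) (proj₁ (bounds₂ k′))
      (proj₂ (bounds₂ k′))

  length-faces : length (face₁ ++ face₂) ≡ N + N
  length-faces = trans (length-++ face₁) (trans (cong₂ _+_ length₁ length₂) (trans sum≡ (cong (N +_) (ℕ.+-identityʳ N))))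

  module _ {ι : Fin M₀ → Fin M₀} where

    joined⇒transitive : ∀ {a b} → ι a ≡ b → ι b ≡ a → a ∈ face₁ → b ∈ face₂ → Transitive ι (τ ms)
    joined⇒transitive {a} {b} ιa ιb a∈ b∈ x y = reach-trans (reach-sym x) (reach y)
      where
      a→b : Reach ι (τ ms) a b
      a→b = subst (Reach ι (τ ms) a) ιa (stepι here)
      b→a : Reach ι (τ ms) b a
      b→a = subst (Reach ι (τ ms) b) ιb (stepι here)
      reach : ∀ y → Reach ι (τ ms) a y
      reach y with ∈-++⁻ face₁ (everywhere y)
      ... | inj₁ k = orbit-reach (orbit₁ a∈ k)
      ... | inj₂ k = reach-trans a→b (orbit-reach (orbit₂ b∈ k))
      reach-sym : ∀ x → Reach ι (τ ms) x a
      reach-sym x with ∈-++⁻ face₁ (everywhere x)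
      ... | inj₁ k = orbit-reach (orbit₁ k a∈)
      ... | inj₂ k = reach-trans (orbit-reach (orbit₂ k b∈)) b→a

    -- If no edge joined the faces, then `face₁` would be closed under `ι` and `τ`, and no point of
    -- `face₂` could be reached from it.
    transitive⇒joined : Transitive ι (τ ms) → ∃ λ a → a ∈ face₁ × ι a ∈ face₂
    transitive⇒joined tr with any? (λ a → (a ∈? face₁) ×-dec (ι a ∈? face₂))
    ... | yes r = r
    ... | no none = contradiction end (λ k → disjoint k start₂)
      where
      pick : ∀ (xs : List (Fin M₀)) {n} → length xs ≡ suc n → ∃ (_∈ xs)
      pick (x ∷ _) _ = x , here refl
      start₁ = proj₂ (pick face₁ length₁)
      start₂ = proj₂ (pick face₂ length₂)
      stays : ∀ {x y} → Reach ι (τ ms) x y → x ∈ face₁ → y ∈ face₁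
      stays here k = k
      stays (stepι {y} r) k with ∈-++⁻ face₁ (everywhere (ι y))
      ... | inj₁ l = l
      ... | inj₂ l = contradiction (y , stays r k , l) none
      stays (stepτ {y} r) k = let l = stays r k in
        subst (_∈ face₁) (sym (trans (τ≗cyc y) (cong (cyc face₁) (cyc-∉ face₂ (disjoint l))))) (cyc-∈ face₁ l)
      end = stays (tr (proj₁ (pick face₁ length₁)) (proj₁ (pick face₂ length₂))) start₁

    matching : IsFPFInvolution ι → Matching (face₁ ++ face₂) ι
    matching inv = record
      { closed = λ _ → everywhere _ ; outside = λ p → contradiction (everywhere _) p
      ; involutive = proj₁ ∘ inv ; moves = λ _ → proj₂ (inv _) }

    vertices : Matching (face₁ ++ face₂) ι → ∃ (Cycles (cyc face₁ ∘ cyc face₂ ∘ ι))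
    vertices m = cycles-exist (Matching.injective m ∘ cyc-injective face₂ ∘ cyc-injective face₁)

    planar⇔annular : ∀ {p q r s a b} → face₁ ≡ p ++ a ∷ q → face₂ ≡ r ++ b ∷ s →
      (m : Matching (face₁ ++ face₂) ι) → ι a ≡ b → proj₁ (vertices m) ≡ N ⇔ NC ι ((q ++ p) ++ (s ++ r))
    planar⇔annular {p} {q} {r} {s} {a} {b} e₁ e₂ m ιa =
      go face₁ face₂ e₁ e₂ m faces-unique length-faces (proj₂ (vertices m))
      where
      go : ∀ xs ys {c} → xs ≡ p ++ a ∷ q → ys ≡ r ++ b ∷ s → Matching (xs ++ ys) ι → Unique (xs ++ ys) →
           length (xs ++ ys) ≡ N + N → Cycles (cyc xs ∘ cyc ys ∘ ι) c → c ≡ N ⇔ NC ι ((q ++ p) ++ (s ++ r))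
      -- The faces, which are computed lists, are generalised to variables so that their
      -- decompositions can be substituted.
      go _ _ refl refl m u len catalan = planar⇔NC {p = p} {q} {r} {s} m u ιa len (cong (N +_) (ℕ.+-identityʳ N)) catalan

  -- With two faces, genus 0 means `c ≡ N`. Connectedness provides an edge to cut, and conversely
  -- any such edge connects the two orbits of `τ`.
  connected⇔annular : ∀ v → ConnectedGenus 0 N 2 (ms , v) ⇔ On (face₁ ++ face₂) (Annular (λ _ _ → ⊤) face₁ face₂) v
  connected⇔annular v = mk⇔ fwd bwd
    where
    ι : Fin M₀ → Fin M₀
    ι = lookup v
    fwd : ConnectedGenus 0 N 2 (ms , v) → On (face₁ ++ face₂) (Annular (λ _ _ → ⊤) face₁ face₂) v
    fwd (_ , inv , tr , c , hc , c≡) = ann , λ y p → contradiction (everywhere y) p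
      where
      matched = matching inv
      c≡N : c ≡ N
      c≡N = ℕ.+-cancelʳ-≡ 2 c N (trans (cong (_+ 2) (sym (ℕ.+-identityʳ c))) c≡)
      ann : Annular (λ _ _ → ⊤) face₁ face₂ ι
      ann with transitive⇒joined tr
      ... | a , a∈ , b∈ with ∈-∃++ a∈ | ∈-∃++ b∈
      ... | p , q , e₁ | r , s , e₂ = annular {p = p} {q} {r} {s} e₁ e₂ refl (Matching.partner matched refl) tt
        (to (planar⇔annular e₁ e₂ matched refl) (trans (sym (hasCycles⇒≡ (λ x → τ≗cyc (ι x)) hc (proj₂ (vertices matched)))) c≡N))
    bwd : On (face₁ ++ face₂) (Annular (λ _ _ → ⊤) face₁ face₂) v → ConnectedGenus 0 N 2 (ms , v)
    bwd (ann@(annular {p} {q} {r} {s} {a} {b} e₁ e₂ ιa ιb _ nc) , _) =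
      ((s≤s z≤n VecAll.∷ s≤s z≤n VecAll.∷ VecAll.[]) , trans (cong (suc i +_) (ℕ.+-identityʳ (suc j))) sum≡)
      , inv , joined⇒transitive ιa ιb (subst (a ∈_) (sym e₁) (∈-insert p)) (subst (b ∈_) (sym e₂) (∈-insert r))
      , N , subst (HasCycles _) c≡N (hasCycles (proj₂ cycles-τ)) , cong (_+ 2) (ℕ.+-identityʳ N)
      where
      inv : IsFPFInvolution ι
      inv x = annular-matches faces-unique ann (everywhere x)
      matched = matching inv
      cycles-τ : ∃ (Cycles (τ ms ∘ ι))
      cycles-τ = cycles-exist (Matching.injective matched ∘ τ-injective)
      c≡N : proj₁ cycles-τ ≡ N
      c≡N = trans (cycles-cong (λ x → τ≗cyc (ι x)) (proj₂ cycles-τ) (proj₂ (vertices matched)))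
        (from (planar⇔annular e₁ e₂ matched ιa) nc)

-- Bicoloured data with two faces

parity : ℕ → Bool
parity zero = true
parity (suc n) = not (parity n)

parity-+ : ∀ {m} n → Even m → parity (m + n) ≡ parity n
parity-+ n (divides q refl) = go q
  where
  go : ∀ q → parity (q * 2 + n) ≡ parity n
  go zero = refl
  go (suc q) = trans (not-involutive _) (go q)

even⇒parity : ∀ {m} → Even m → parity m ≡ true
even⇒parity {m} ev = trans (cong parity (sym (ℕ.+-identityʳ m))) (parity-+ 0 ev)

parity⇒even : ∀ {m} → parity m ≡ true → Even m
parity⇒even {m} e with even⊎odd m
... | k , inj₁ refl = divides k (ℕ.*-comm 2 k)
... | k , inj₂ refl with () ← trans (sym (cong not (even⇒parity {2 * k} (divides k (ℕ.*-comm 2 k))))) e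

range-alternating : ∀ {s} {xs : List (Fin M)} → Range s xs → Alternating (parity ∘ toℕ) (parity s) (parity (s + length xs)) xs
range-alternating {M} {s = s} [] = subst (λ t → Alternating {M} (parity ∘ toℕ) (parity s) (parity t) []) (sym (ℕ.+-identityʳ s)) []
range-alternating {s = s} {x ∷ xs} (e ∷ r) = cong parity e ∷
  subst (λ t → Alternating (parity ∘ toℕ) (parity (suc s)) (parity t) xs) (sym (ℕ.+-suc s (length xs))) (range-alternating r)

module _ (colour : Fin M → Bool) where

  true? : ∀ x → Dec (colour x ≡ true)
  true? x = colour x Bool.≟ true

  length-true : ∀ {c xs} → Alternating colour c c xs → length (filter true? xs) + length (filter true? xs) ≡ length xs
  length-true [] = refl
  length-true {true} {x ∷ []} (_ ∷ ())
  length-true {false} {x ∷ []} (_ ∷ ())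
  length-true {true} {x ∷ y ∷ xs} (ex ∷ ey ∷ alt)
    rewrite filter-accept true? {xs = y ∷ xs} ex | filter-reject true? {xs = xs} (λ e → case trans (sym e) ey of λ ())
    = cong suc (trans (ℕ.+-suc _ _) (cong suc (length-true alt)))
  length-true {false} {x ∷ y ∷ xs} (ex ∷ ey ∷ alt)
    rewrite filter-reject true? {xs = y ∷ xs} (λ e → case trans (sym e) ex of λ ()) | filter-accept true? {xs = xs} ey
    = cong suc (trans (ℕ.+-suc _ _) (cong suc (length-true alt)))

  -- There are as many points of either colour, so an injection of the first class into
  -- the second one is onto.
  opposite-everywhere : ∀ {c ι} → Alternating colour c c (allFin M) → Injective ι →
    (∀ x → colour x ≡ true → colour (ι x) ≢ true) → ∀ x → Opposite colour x (ι x)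
  opposite-everywhere {ι = ι} alt inj h x with colour x in cx | colour (ι x) in cι
  ... | true | true = contradiction cι (h x cx)
  ... | true | false = refl
  ... | false | true = refl
  ... | false | false = contradiction (unique-length too-many) (ℕ.<⇒≱ (s≤s (ℕ.≤-reflexive (sym count))))
    where
    E : List (Fin M)
    E = filter true? (allFin M)
    E-true : ∀ {y} → y ∈ E → colour y ≡ true
    E-true i = proj₂ (∈-filter⁻ true? {xs = allFin M} i)
    E-unique : Unique E
    E-unique = Unique.filter⁺ true? (Unique.allFin⁺ M)
    fresh : ι x ∉ map ι E ++ E
    fresh i with ∈-++⁻ (map ι E) i
    ... | inj₂ k with () ← trans (sym cι) (E-true k)
    ... | inj₁ k with ∈-map⁻ ι k
    ... | y , k′ , e with () ← trans (sym cx) (trans (cong colour (inj e)) (E-true k′))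
    apart : ∀ {z} → z ∈ map ι E → z ∉ E
    apart k k′ with ∈-map⁻ ι k
    ... | y , l , refl = h y (E-true l) (E-true k′)
    -- If `x` and `ι x` both had colour `false`, then `ι x` would lie neither in `E` nor in its
    -- image. Since `E` and its image already have `M` points together, there would be `M + 1`.
    too-many : Unique (ι x ∷ map ι E ++ E)
    too-many = All.tabulate (λ { i refl → fresh i }) ∷ Unique.++⁺ (Unique.map⁺ inj E-unique) E-unique λ (k , k′) → apart k k′
    count : length (map ι E ++ E) ≡ M
    count = trans (length-++ (map ι E))
        (trans (cong (_+ length E) (length-map ι E)) (trans (length-true alt) (length-tabulate id)))

module Bicolored₂ (N i j : ℕ) (sum≡ : suc i + suc j ≡ 2 * N) (ev₁ : Even (suc i)) (ev₂ : Even (suc j)) where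
  open TwoFaces N i j sum≡

  colour : Fin M₀ → Bool
  colour = parity ∘ toℕ

  balanced : Balanced colour face₁ face₂
  balanced = true , parity (suc i)
    , subst (λ c → Alternating colour true c face₁) (trans (cong parity length₁) (even⇒parity ev₁)) (range-alternating range₁)
    , subst (λ c → Alternating colour (parity (suc i)) c face₂) (trans (cong (λ t → parity (suc i + t)) length₂)
        (trans (parity-+ (suc j) ev₁) (trans (even⇒parity ev₂) (sym (even⇒parity ev₁))))) (range-alternating range₂)

  all-balanced : Alternating colour true true (allFin M₀)
  all-balanced = subst (λ c → Alternating colour true c (allFin M₀))
    (trans (cong parity (length-tabulate {n = M₀} id)) (even⇒parity {2 * N} (divides N (ℕ.*-comm 2 N)))) (range-alternating (range-tabulate id λ _ → refl))

  -- The first face has an even number of sides, so positions and offsets have the same parity in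
  -- the second face too; one colouring by position serves both.
  parity-offset : ∀ x → parity (offset ms (toℕ x)) ≡ colour x
  parity-offset x with ∈-++⁻ face₁ (everywhere x)
  ... | inj₁ k = cong (λ l → parity (toℕ x ∸ proj₁ l)) (locate₁ (bounds₁ k))
  ... | inj₂ k = let l , u = bounds₂ k in trans (cong (λ l → parity (toℕ x ∸ proj₁ l)) (locate₂ l u))
    (trans (sym (parity-+ (toℕ x ∸ suc i) ev₁)) (cong parity (ℕ.m+[n∸m]≡n l)))

  -- The colour condition in `Annular` concerns the cutting edge only. It follows from
  -- `opposite-everywhere`, and `annular-opposite` spreads it back to all edges.
  bicolored⇔annular : ∀ v → (ConnectedGenus 0 N 2 (ms , v) × Bicolored N 2 (ms , v)) ⇔
                            On (face₁ ++ face₂) (Annular (Opposite colour) face₁ face₂) v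
  bicolored⇔annular v = mk⇔ fwd bwd
    where
    fwd : ConnectedGenus 0 N 2 (ms , v) × Bicolored N 2 (ms , v) → On (face₁ ++ face₂) (Annular (Opposite colour) face₁ face₂) v
    fwd (con@(_ , inv , _) , _ , bi) = let ann , out = to (connected⇔annular v) con in
        annular-map (λ {a} _ _ → opposite-everywhere colour all-balanced (Matching.injective (matching inv)) flips a) ann , out
      where
      flips : ∀ x → colour x ≡ true → colour (lookup v x) ≢ true
      flips x e e′ = bi x (parity⇒even (trans (parity-offset x) e)) (parity⇒even (trans (parity-offset (lookup v x)) e′))
    bwd : On (face₁ ++ face₂) (Annular (Opposite colour) face₁ face₂) v → ConnectedGenus 0 N 2 (ms , v) × Bicolored N 2 (ms , v)
    bwd (ann , out) = from (connected⇔annular v) (annular-map (λ _ _ → tt) ann , out)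
      , (ev₁ VecAll.∷ ev₂ VecAll.∷ VecAll.[])
      , λ x ev ev′ → not-¬ (trans (sym (parity-offset x)) (even⇒parity ev))
          (sym (trans (cong not (sym (trans (sym (parity-offset (lookup v x))) (even⇒parity ev′)))) (opposite-sym′ x)))
      where
      opposite-sym′ : ∀ x → not (colour (lookup v x)) ≡ colour x
      opposite-sym′ x = sym (opposite-sym colour {x} {lookup v x} (annular-opposite colour balanced ann (everywhere x)))

-- Summation over the sizes of the faces

Indexed : ℕ → (ℕ → ℕ → B → Set) → (ℕ → ℕ → A) → A × B → Set
Indexed L Q g (a , b) = ∃₂ λ i j → suc (i + j) ≡ L × a ≡ g i j × Q i j b

card-compositions : ∀ L {F : ℕ → ℕ → ℕ} (Q : ℕ → ℕ → B → Set) (g : ℕ → ℕ → A) → (∀ {i j i′ j′} → g i j ≡ g i′ j′ → i ≡ i′) →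
  (∀ i j → suc (i + j) ≡ L → HasCard (Q i j) (F i j)) →
  HasCard (Indexed L Q g) (Σ₂ F L)
card-compositions zero Q g inj h = card-∅ λ { _ (_ , _ , () , _) }
card-compositions {B = B} {A = A} (suc L) {F} Q g inj h = card-⇔ (λ p → mk⇔ (join p) (part p))
  (card-⊎ disjoint head (card-compositions L (Q ∘ suc) (g ∘ suc) (ℕ.suc-injective ∘ inj) λ i j e → h (suc i) j (cong suc e)))
  where
  Head : A × B → Set
  Head (a , b) = a ≡ g 0 L × Q 0 L b
  head : HasCard Head (F 0 L)
  head = subst (HasCard Head) (ℕ.*-identityˡ (F 0 L))
      (card-× _,_ proj₁ proj₂ (λ p q → (p , q) , refl , refl) (λ (p , q) → p , q , refl)
    (card-singleton (g 0 L)) (λ _ → h 0 L refl))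
  disjoint : ∀ p → Head p → ¬ Indexed L (Q ∘ suc) (g ∘ suc) p
  disjoint _ (e , _) (i , j , _ , e′ , _) = ℕ.0≢1+n (inj (trans (sym e) e′))
  join : ∀ p → Head p ⊎ Indexed L (Q ∘ suc) (g ∘ suc) p → Indexed (suc L) Q g p
  join _ (inj₁ (e , q)) = 0 , L , refl , e , q
  join _ (inj₂ (i , j , e , e′ , q)) = suc i , j , cong suc e , e′ , q
  part : ∀ p → Indexed (suc L) Q g p → Head p ⊎ Indexed L (Q ∘ suc) (g ∘ suc) p
  part _ (zero , j , refl , e′ , q) = inj₁ (e′ , q)
  part _ (suc i , j , e , e′ , q) = inj₂ (i , j , ℕ.suc-injective e , e′ , q)

sizes : ℕ → ℕ → Vec ℕ 2
sizes i j = suc i ∷ suc j ∷ []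

sizes-injective : ∀ {i j i′ j′} → sizes i j ≡ sizes i′ j′ → i ≡ i′
sizes-injective refl = refl

-- `n + suc (n + 0)` is what `2 * suc n` leaves after one successor; this shift fits the convention
-- i + j + 1 of `Σ₂`.
composition : ∀ {n i j} → suc (i + j) ≡ n + suc (n + 0) → suc i + suc j ≡ 2 * suc n
composition {i = i} {j} e = cong suc (trans (ℕ.+-suc i j) e)

two-faces : ∀ {n} {ms : Vec ℕ 2} → IsComposition (2 * suc n) ms →
            ∃₂ λ i j → suc (i + j) ≡ n + suc (n + 0) × ms ≡ suc i ∷ suc j ∷ []
two-faces {ms = suc i ∷ suc j ∷ []} (s≤s _ VecAll.∷ s≤s _ VecAll.∷ VecAll.[] , e) = i , j
  , trans (sym (ℕ.+-suc i j)) (ℕ.suc-injective (trans (cong (suc i +_) (sym (ℕ.+-identityʳ (suc j)))) e)) , refl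

card-faces : ∀ N {i j ok κ} (sum≡ : suc i + suc j ≡ 2 * N) (colouring : Colouring ok κ) → let open TwoFaces N i j sum≡ in
  Colouring.Adm colouring face₁ face₂ → HasCard (On (face₁ ++ face₂) (Annular ok face₁ face₂))
      (annularCount (κ (suc j)) j (suc i))
card-faces N {i} {j} {ok} {κ} sum≡ colouring adm =
  subst₂ (λ l₁ l₂ → HasCard (On (face₁ ++ face₂) (Annular ok face₁ face₂)) (annularCount (κ l₂) (pred l₂) l₁)) length₁ length₂
    (card-Annular colouring (length face₁) face₁ face₂ ℕ.≤-refl faces-unique adm)
  where open TwoFaces N i j sum≡

ε-planar : ∀ N → εIs 0 N 2 (N * 4 ^ (N ∸ 1))
-- There is no composition of 0 into two positive parts.
ε-planar zero = card-∅ λ { ((zero ∷ _ ∷ []) , _) ((() VecAll.∷ _ , _) , _) ; ((suc _ ∷ _ ∷ []) , _) ((_ , ()) , _) }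
-- The first term of `T` has `b = 0` and reduces to 0, so `T` at `2 * suc n` is the sum over the
-- compositions.
ε-planar (suc n) = subst (HasCard _) (trans (T-id (2 * suc n)) (gluings-even (suc n)))
  (card-⇔ (λ (ms , v) → mk⇔
      (λ { (i , j , e , refl , con) → con })
      (λ con → case two-faces (proj₁ con) of λ { (i , j , e , refl) → i , j , e , refl , con }))
    (card-compositions (n + suc (n + 0)) (λ i j v → ConnectedGenus 0 (suc n) 2 (suc i ∷ suc j ∷ [] , v)) sizes sizes-injective
      λ i j e → let open TwoFaces (suc n) i j (composition e) in
        card-⇔ (λ v → mk⇔ (from (connected⇔annular v)) (to (connected⇔annular v)))
            (card-faces (suc n) (composition e) unrestricted tt)))

B-planar : ∀ n → BIs 0 (suc n) 2 (n * 4 ^ (n ∸ 1))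
B-planar n = subst (HasCard _) (trans (cong (Total.T half) (ℕ.*-suc 2 n)) (trans (T-half (2 * n)) (gluings-even n)))
  (card-⇔ (λ (ms , v) → mk⇔
      (λ { (i , j , e , refl , con) → con })
      (λ con → case two-faces (proj₁ (proj₁ con)) of λ { (i , j , e , refl) → i , j , e , refl , con }))
    (card-compositions (n + suc (n + 0)) Gluing sizes sizes-injective piece))
  where
  Gluing : ℕ → ℕ → Table (2 * suc n) → Set
  Gluing i j v = ConnectedGenus 0 (suc n) 2 (suc i ∷ suc j ∷ [] , v) × Bicolored (suc n) 2 (suc i ∷ suc j ∷ [] , v)
  piece : ∀ i j → suc (i + j) ≡ n + suc (n + 0) → HasCard (Gluing i j) (annularCount (half (suc j)) j (suc i))
  piece i j e with even⊎odd (suc j)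
  -- An odd face admits no bicoloured gluing, in accordance with the value 0 of `half`. In the other
  -- case the first face is even too, as the total is.
  ... | k , inj₂ odd = subst (HasCard (Gluing i j))
      (sym (trans (cong (λ t → annularCount t j (suc i)) (trans (cong half odd) (half-odd k)))
          (annularCount-zero j (suc i))))
    (card-∅ λ { v (_ , (_ VecAll.∷ ev VecAll.∷ VecAll.[]) , _) → case trans (sym (even⇒parity ev)) (trans (cong parity odd) (cong not (even⇒parity {2 * k} (divides k (ℕ.*-comm 2 k))))) of λ () })
  ... | k , inj₁ even = card-⇔ (λ v → mk⇔ (from (bicolored⇔annular v)) (to (bicolored⇔annular v)))
      (card-faces (suc n) sum≡ (bicolouring colour) balanced)
    where
    sum≡ : suc i + suc j ≡ 2 * suc n
    sum≡ = composition e
    ev₂ : Even (suc j)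
    ev₂ = divides k (trans even (ℕ.*-comm 2 k))
    ev₁ : Even (suc i)
    ev₁ = parity⇒even (trans (sym (parity-+ (suc i) ev₂)) (trans (cong parity (trans (ℕ.+-comm (suc j) (suc i)) sum≡))
            (even⇒parity {2 * suc n} (divides (suc n) (ℕ.*-comm 2 (suc n))))))
    open Bicolored₂ (suc n) i j sum≡ ev₁ ev₂

theorem4 : (N : ℕ) → 1 ≤ N →
    BIs 0 N 2 ((N ∸ 1) * 4 ^ (N ∸ 2)) × εIs 0 (N ∸ 1) 2 ((N ∸ 1) * 4 ^ (N ∸ 2))
theorem4 (suc n) _ = B-planar n , ε-planar n
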